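{- Let $n \ge 5$. If $\Delta$ is a triangulation of an $(n-1)$-dimensional homology manifold with exactly $2n+1$ vertices, with first Betti number $\beta_1 \neq 0$, and whose orientation double cover has vanishing second Betti number, then $\Delta$ is combinatorially isomorphic to $M^n$.
   Context: Betti numbers are taken with rational coefficients. $M^n$ is the simplicial complex on vertex set $\mathbb{Z}/(2n+1)$ whose facets are the sets $\{i, i+1, \dots, i+n\} \setminus \{i+j\}$ for $i \in \mathbb{Z}/(2n+1)$ and $1 \le j \le n-1$ (Kühnel's triangulation; it is a triangulation of $S^{n-2}\times S^1$ for $n$ odd and of the nonorientable $S^{n-2}$-bundle over $S^1$ for $n$ even). -}

module Defs where

open import Data.Bool using (Bool; true; false; not; if_then_else_; _∧_; T)
import Data.Bool.Properties as BoolP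
open import Data.Nat using (ℕ; zero; suc; _≤_; _∸_; _%_) renaming (_≟_ to _≟ℕ_) renaming (_+_ to _+ℕ_)
open import Data.Fin using (Fin; toℕ)
open import Data.Fin.Subset using (Subset; _∈_; _⊆_; _∩_; ∣_∣; ⊥; ⁅_⁆) renaming (_∪_ to _∪ˢ_)
open import Data.Vec using (Vec; []; _∷_; tabulate; lookup)
import Data.Vec.Properties as VecP
open import Data.List using (List; []; _∷_; map; foldr; _++_)
open import Data.List.Relation.Unary.All using (All)
open import Data.Rational using (ℚ; 0ℚ; 1ℚ; _+_; _*_; -_)
open import Data.Product using (Σ; ∃; _×_; _,_)
open import Relation.Binary.PropositionalEquality using (_≡_; _≢_)
open import Relation.Nullary using (¬_)
open import Relation.Nullary.Decidable using (⌊_⌋)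
open import Function.Bundles using (Inverse; _↔_)

_==ˢ_ : ∀ {m} → Subset m → Subset m → Bool
S ==ˢ S′ = ⌊ VecP.≡-dec BoolP._≟_ S S′ ⌋

allSubsets : ∀ m → List (Subset m)
allSubsets zero    = [] ∷ []
allSubsets (suc m) = map (true ∷_) (allSubsets m) ++ map (false ∷_) (allSubsets m)

allB : ∀ {A : Set} → (A → Bool) → List A → Bool
allB p = foldr (λ x b → p x ∧ b) true

_⊆ᵇ_ : ∀ {m} → Subset m → Subset m → Bool
[]       ⊆ᵇ []       = true
(true ∷ S) ⊆ᵇ (false ∷ T′) = false
(_ ∷ S)  ⊆ᵇ (_ ∷ T′) = S ⊆ᵇ T′

-- Simplicial incidence numbers [τ : σ] ∈ {0, ±1}, vertices ordered by Fin.
-- [τ : σ] = (-1)^i if σ = τ minus its i-th vertex (0-based), else 0.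
-- The Bool argument is the parity of the number of vertices of τ seen so far.

incS′ : ∀ {m} → Bool → Subset m → Subset m → ℚ
incS′ p []          []          = 0ℚ
incS′ p (true ∷ τ)  (true ∷ σ)  = incS′ (not p) τ σ
incS′ p (false ∷ τ) (false ∷ σ) = incS′ p τ σ
incS′ p (true ∷ τ)  (false ∷ σ) = if τ ==ˢ σ then (if p then - 1ℚ else 1ℚ) else 0ℚ
incS′ p (false ∷ τ) (true ∷ σ)  = 0ℚ

incS : ∀ {m} → Subset m → Subset m → ℚ
incS = incS′ false

-- A finite "cell complex" presented by its cells and incidence numbers,
-- with rational chains as finite formal linear combinations.

record CellCx : Set₁ where
  field
    Cell  : Set
    valid : Cell → Set           -- which cells actually belong to the complex
    size  : Cell → ℕ             -- dimension + 1
    _≟ᶜ_  : Cell → Cell → Bool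
    inc   : Cell → Cell → ℚ

module _ (K : CellCx) where
  open CellCx K

  Chain : Set
  Chain = List (Cell × ℚ)

  sumℚ : List ℚ → ℚ
  sumℚ = foldr _+_ 0ℚ

  coeff : Chain → Cell → ℚ
  coeff c σ = sumℚ (map (λ { (τ , q) → if τ ≟ᶜ σ then q else 0ℚ }) c)

  ∂coeff : Chain → Cell → ℚ
  ∂coeff c σ = sumℚ (map (λ { (τ , q) → q * inc τ σ }) c)

  ChainOfSize : ℕ → Chain → Set
  ChainOfSize s c = All (λ { (τ , q) → valid τ × size τ ≡ s }) c

  IsCycle : Chain → Set
  IsCycle c = ∀ σ → valid σ → ∂coeff c σ ≡ 0ℚ

  IsBoundary : ℕ → Chain → Set
  IsBoundary s c = ∃ λ d → ChainOfSize (suc s) d × (∀ σ → valid σ → ∂coeff d σ ≡ coeff c σ)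

  -- the homology group in "size" s (= degree s - 1) is zero
  HomologyVanishes : ℕ → Set
  HomologyVanishes s = ∀ c → ChainOfSize s c → IsCycle c → IsBoundary s c

  HomologyIsℚ : ℕ → Set
  HomologyIsℚ s =
    ∃ λ z → ChainOfSize s z × IsCycle z × ¬ IsBoundary s z ×
      (∀ w → ChainOfSize s w → IsCycle w →
        ∃ λ (q : ℚ) → IsBoundary s (w ++ map (λ { (τ , r) → (τ , - (q * r)) }) z))

SComplex : ℕ → Set
SComplex m = Subset m → Bool

IsSimplicialComplex : ∀ {m} → SComplex m → Set
IsSimplicialComplex {m} Δ = ∀ (S S′ : Subset m) → S ⊆ S′ → T (Δ S′) → T (Δ S)

-- the augmented simplicial chain complex (cells = all faces, including ∅):
-- its homology in size s is the reduced homology H̃_{s-1}(Δ; ℚ)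
-- (which agrees with ordinary homology H_{s-1} for s ≥ 2).
simplicialCx : ∀ {m} → SComplex m → CellCx
simplicialCx {m} Δ = record
  { Cell = Subset m ; valid = λ S → T (Δ S) ; size = ∣_∣ ; _≟ᶜ_ = _==ˢ_ ; inc = incS }

link : ∀ {m} → SComplex m → Subset m → SComplex m
link Δ F S = Δ (S ∪ˢ F) ∧ ((S ∩ F) ==ˢ ⊥)

-- Betti-number conditions with rational coefficients
-- Δ is a ℚ-homology sphere of dimension t - 1 (reduced homology of S^{t-1})
IsHomologySphere : ∀ {m} → ℕ → SComplex m → Set
IsHomologySphere t Δ =
  (∀ s → s ≢ t → HomologyVanishes (simplicialCx Δ) s) × HomologyIsℚ (simplicialCx Δ) t

-- Δ is a (ℚ-)homology manifold of dimension d = n - 1: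
-- every face has at most n vertices, and the link of every nonempty face F
-- is a homology sphere of dimension n - 1 - |F|.
IsHomologyManifold : ∀ {m} → ℕ → SComplex m → Set
IsHomologyManifold n Δ =
  (∀ F → T (Δ F) → ∣ F ∣ ≤ n) ×
  (∀ F → T (Δ F) → 1 ≤ ∣ F ∣ → IsHomologySphere (n ∸ ∣ F ∣) (link Δ F))

-- Orientation double cover of an (n-1)-dimensional homology manifold Δ.
-- Facets are faces with n vertices; an orientation of a facet F is a Bool
-- (true = the orientation given by the increasing vertex order).
-- A cell of the cover is a pair (G , ε) with G a nonempty face and ε a
-- coherent orientation of the facets of the star of G (values of ε on
-- other subsets are irrelevant). Its faces are the (H , η) with H ⊂ G
-- of codimension one and η agreeing with ε on the star of G.

sgn : Bool → ℚ
sgn true  = 1ℚ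
sgn false = - 1ℚ

module Cover {m : ℕ} (n : ℕ) (Δ : SComplex m) where

  isFacet : Subset m → Bool
  isFacet F = Δ F ∧ ⌊ ∣ F ∣ ≟ℕ n ⌋

  inStar : Subset m → Subset m → Bool
  inStar G F = isFacet F ∧ (G ⊆ᵇ F)

  CoherentOnStar : Subset m → (Subset m → Bool) → Set
  CoherentOnStar G ε = ∀ F₁ F₂ → T (inStar G F₁) → T (inStar G F₂) →
    ∣ F₁ ∩ F₂ ∣ ≡ n ∸ 1 →
    sgn (ε F₁) * incS F₁ (F₁ ∩ F₂) ≡ - (sgn (ε F₂) * incS F₂ (F₁ ∩ F₂))

  agreeOnStar : Subset m → (Subset m → Bool) → (Subset m → Bool) → Bool
  agreeOnStar G ε η =
    allB (λ F → if inStar G F then ⌊ ε F BoolP.≟ η F ⌋ else true) (allSubsets m)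

  coverCx : CellCx
  coverCx = record
    { Cell  = Subset m × (Subset m → Bool)
    ; valid = λ { (G , ε) → T (Δ G) × 1 ≤ ∣ G ∣ × CoherentOnStar G ε }
    ; size  = λ { (G , ε) → ∣ G ∣ }
    ; _≟ᶜ_  = λ { (G , ε) (G′ , ε′) → (G ==ˢ G′) ∧ agreeOnStar G ε ε′ }
    ; inc   = λ { (G , ε) (H , η) → if agreeOnStar G ε η then incS G H else 0ℚ }
    }

orientationDoubleCover : ∀ {m} → ℕ → SComplex m → CellCx
orientationDoubleCover n Δ = Cover.coverCx n Δ

-- Kühnel's complex M^n on vertex set ℤ/(2n+1) = Fin (2n+1):
-- facets {i, …, i+n} ∖ {i+j}, 1 ≤ j ≤ n-1.

IsFaceOfM : (n : ℕ) → Subset (suc (n +ℕ n)) → Set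
IsFaceOfM n S =
  ∃ λ (i : Fin (suc (n +ℕ n))) → ∃ λ (j : ℕ) → 1 ≤ j × j ≤ n ∸ 1 ×
    (∀ x → x ∈ S → ∃ λ (k : ℕ) → k ≤ n × k ≢ j ×
       toℕ x ≡ (toℕ i +ℕ k) % suc (n +ℕ n))

image : ∀ {m} → Fin m ↔ Fin m → Subset m → Subset m
image π S = tabulate (λ y → lookup S (Inverse.from π y))

IsomorphicToM : (n : ℕ) → SComplex (suc (n +ℕ n)) → Set
IsomorphicToM n Δ = ∃ λ (π : Fin (suc (n +ℕ n)) ↔ Fin (suc (n +ℕ n))) →
  ∀ S → (T (Δ S) → IsFaceOfM n (image π S)) × (IsFaceOfM n (image π S) → T (Δ S))

{-# OPTIONS --safe #-}

-- Only three consequences of the hypotheses matter: Δ is pure with two facets on every ridge, vertex stars are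
-- strongly connected, and some rational 1-cocycle φ is not a coboundary.
--
-- Let S have n + 1 vertices and contain two facets, with φ trivial on S; the n vertices of T = ∁ S then span a
-- missing simplex. Its boundary cuts the facets meeting T into two colours, according to the value of φ from S
-- to T. Since ∂∂ = 0 modulo 2, the outer boundary in S of one colour is a cut of the complete graph on S. As T
-- has only n vertices, a pigeonhole argument shows that this cut isolates a single vertex x, and that x is the
-- only neighbour of that colour of some β in T. Exchanging x and β gives another such S. Iterating, a vertex
-- returns exactly n steps after it left, so the exchanged vertices run through a cyclic order of all 2n + 1
-- vertices in which every S is an interval: its facets are those of M^n, and by strong connectivity Δ has no
-- others.
module Submission where

open import Defs
open import Data.Bool using (Bool; true; false; not; _∧_; _∨_; if_then_else_; _xor_; T)
import Data.Bool.Properties as BoolP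
open import Data.Empty using (⊥-elim) renaming (⊥ to Empty)
open import Data.Fin using (Fin; zero; suc; _≟_; toℕ; fromℕ<; punchOut)
import Data.Fin as Fin
open import Data.Fin.Properties using (any?; all?; toℕ<n; toℕ-fromℕ<; toℕ-injective; punchOut-injective)
import Data.Fin.Properties as FinP
open import Data.Fin.Subset using (Subset; ∣_∣; ⊥; ⁅_⁆; ∁; _∪_; _∩_)
open import Data.Fin.Subset.Properties using (∣∁p∣≡n∸∣p∣; anySubset?)
open import Data.List using (List; []; _∷_; length; map; _++_; filter)
open import Data.List.Membership.Propositional using () renaming (_∈_ to _∈ˡ_)
open import Data.List.Membership.Propositional.Properties using (∈-map⁺; ∈-++⁺ˡ; ∈-++⁺ʳ; ∈-filter⁺; ∈-filter⁻)
open import Data.List.Relation.Unary.All as All using (All; []; _∷_)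
open import Data.List.Relation.Unary.Any using (here; there)
open import Data.Nat using (ℕ; zero; suc; _≤_; _<_; z≤n; s≤s; s≤s⁻¹; _∸_; _%_; _/_; _≤?_; _<?_)
import Data.Nat as ℕ
open import Data.Nat.DivMod using (m≡m%n+[m/n]*n; m%n<n; %-distribˡ-+; m%n%n≡m%n; m<n⇒m%n≡m; [m+n]%n≡m%n; _mod_)
import Data.Nat.Properties as ℕP
open import Data.Product using (∃; _×_; _,_; proj₁; proj₂)
open import Data.Rational using (ℚ; 0ℚ; 1ℚ)
import Data.Rational as ℚ
import Data.Rational.Properties as ℚP
open import Data.Rational.Solver using (module +-*-Solver)
open import Data.Sum using (_⊎_; inj₁; inj₂; [_,_]′)
open import Data.Vec using (Vec; []; _∷_; lookup; tabulate; _[_]≔_; _[_]=_)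
import Data.Vec.Properties as VecP
open import Data.Vec.Properties using (lookup∘update; lookup∘update′; []≔-idempotent; []≔-commutes; []≔-lookup; lookup∘tabulate; lookup-map; lookup-zipWith; []=⇒lookup; lookup⇒[]=)
import Algebra.Properties.Group as GroupP
open import Function using (_∘_)
open import Function.Bundles using (mk↔ₛ′)
open import Relation.Binary using (Tri; tri<; tri≈; tri>)
open import Relation.Binary.PropositionalEquality using (_≡_; _≢_; refl; sym; trans; cong; cong₂; subst; module ≡-Reasoning)
open import Relation.Nullary using (¬_; Dec; yes; no; contradiction)
open import Relation.Nullary.Decidable using (_×-dec_; _→-dec_; ⌊_⌋; ¬?; map′)

-- The hypothesis on the first Betti number is a negation and hands over no cocycle. Hence the
-- argument by contradiction: without a cyclic order no two-coloured S exists, so every cocycle has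
-- a potential and every rational 1-cycle bounds.
--
-- Around T a cocycle is used only through the question whether the level it induces at a chosen
-- vertex equals a chosen number. The answers form chains modulo 2, so no signs have to be followed.
--
-- The number of vertices enters through |S| = n + 1 and |T| = n. A spanning tree of S has n edges,
-- while one vertex of T is blocked by the opposite colour; this is the margin of the pigeonhole
-- argument. Two facets in S are required because the argument may end at the vertex omitted by one
-- of them, but not at both. Each exchange leaves two facets in the new S, so it can be repeated.

-- Finite sets of vertices: adding, removing, counting.

module Subsets where

  infix 4 _∈_ _∉_ _⊑_
  infixl 6 _⊞_ _⊟_

  private variable
    m : ℕ
    p q : Subset m
    x y z : Fin m

  -- A record around the equation lets unification recover `x` and `p`; non-membership is the
  -- positive equation `false`, not a negation.
  record _∈_ (x : Fin m) (p : Subset m) : Set where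
    constructor mk∈
    field at : lookup p x ≡ true
  open _∈_ public

  record _∉_ (x : Fin m) (p : Subset m) : Set where
    constructor mk∉
    field at : lookup p x ≡ false
  open _∉_ public renaming (at to off)

  _⊑_ : Subset m → Subset m → Set
  p ⊑ q = ∀ x → x ∈ p → x ∈ q

  abstract
    _⊞_ _⊟_ : Subset m → Fin m → Subset m
    p ⊞ x = p [ x ]≔ true
    p ⊟ x = p [ x ]≔ false

  true≢false : ∀ {b a} {A : Set a} → b ≡ true → b ≡ false → A
  true≢false refl ()

  in∧out : ∀ {a} {A : Set a} → x ∈ p → x ∉ p → A
  in∧out i o = true≢false (at i) (off o)

  abstract
    in? : ∀ (x : Fin m) p → x ∈ p ⊎ x ∉ p
    in? x p with lookup p x in e
    ... | true  = inj₁ (mk∈ e)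
    ... | false = inj₂ (mk∉ e)

  abstract
    not-in : ¬ (x ∈ p) → x ∉ p
    not-in {x = x} {p = p} h with in? x p
    ... | inj₁ i = ⊥-elim (h i)
    ... | inj₂ o = o

  abstract
    _∈?_ : ∀ (x : Fin m) p → Dec (x ∈ p)
    x ∈? p with in? x p
    ... | inj₁ i = yes i
    ... | inj₂ o = no λ i → in∧out i o

  abstract
    _∉?_ : ∀ (x : Fin m) p → Dec (x ∉ p)
    x ∉? p with in? x p
    ... | inj₁ i = no λ o → in∧out i o
    ... | inj₂ o = yes o

  in≢out : x ∈ p → y ∉ p → x ≢ y
  in≢out i o refl = in∧out i o

  abstract
    ⊞-≔ : (p : Subset m) (x : Fin m) → p ⊞ x ≡ p [ x ]≔ true
    ⊞-≔ p x = refl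

  abstract
    ⊞-new : x ∈ p ⊞ x
    ⊞-new {x = x} {p = p} = mk∈ (lookup∘update x p true)

  abstract
    ⊞-old : y ∈ p → y ∈ p ⊞ x
    ⊞-old {y = y} {p = p} {x = x} i with y ≟ x
    ... | yes refl = ⊞-new
    ... | no y≢x   = mk∈ (trans (lookup∘update′ y≢x p true) (at i))

  abstract
    ⊞-other : y ≢ x → y ∈ p ⊞ x → y ∈ p
    ⊞-other {p = p} y≢x i = mk∈ (trans (sym (lookup∘update′ y≢x p true)) (at i))

  ⊞-inv : y ∈ p ⊞ x → y ≡ x ⊎ y ∈ p
  ⊞-inv {y = y} {x = x} i with y ≟ x
  ... | yes e  = inj₁ e
  ... | no y≢x = inj₂ (⊞-other y≢x i)

  abstract
    ⊞-out : y ≢ x → y ∉ p → y ∉ p ⊞ x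
    ⊞-out {p = p} y≢x o = mk∉ (trans (lookup∘update′ y≢x p true) (off o))

  abstract
    ⊞-out-inv : y ∉ p ⊞ x → y ≢ x × y ∉ p
    ⊞-out-inv {y = y} {p = p} {x = x} o with y ≟ x
    ... | yes refl = in∧out ⊞-new o
    ... | no y≢x   = y≢x , mk∉ (trans (sym (lookup∘update′ y≢x p true)) (off o))

  abstract
    ⊟-gone : x ∉ p ⊟ x
    ⊟-gone {x = x} {p = p} = mk∉ (lookup∘update x p false)

  abstract
    ⊟-keep : y ≢ x → y ∈ p → y ∈ p ⊟ x
    ⊟-keep {p = p} y≢x i = mk∈ (trans (lookup∘update′ y≢x p false) (at i))

  abstract
    ⊟-inv : y ∈ p ⊟ x → y ≢ x × y ∈ p
    ⊟-inv {y = y} {p = p} {x = x} i with y ≟ x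
    ... | yes refl = in∧out i ⊟-gone
    ... | no y≢x   = y≢x , mk∈ (trans (sym (lookup∘update′ y≢x p false)) (at i))

  ⊟-sub : p ⊟ x ⊑ p
  ⊟-sub y i = proj₂ (⊟-inv i)

  abstract
    ⊟-out : y ∉ p → y ∉ p ⊟ x
    ⊟-out {y = y} {p = p} {x = x} o with y ≟ x
    ... | yes refl = ⊟-gone
    ... | no y≢x   = mk∉ (trans (lookup∘update′ y≢x p false) (off o))

  abstract
    ⊟-out-inv : y ∉ p ⊟ x → y ≡ x ⊎ y ∉ p
    ⊟-out-inv {y = y} {p = p} {x = x} o with y ≟ x
    ... | yes e  = inj₁ e
    ... | no y≢x = inj₂ (mk∉ (trans (sym (lookup∘update′ y≢x p false)) (off o)))

  ∉⊥ : x ∉ ⊥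
  ∉⊥ {x = zero}  = mk∉ refl
  ∉⊥ {x = suc x} = mk∉ (off (∉⊥ {x = x}))

  ∈⁅⁆ : x ∈ ⁅ x ⁆
  ∈⁅⁆ {x = zero}  = mk∈ refl
  ∈⁅⁆ {x = suc x} = mk∈ (at (∈⁅⁆ {x = x}))

  abstract
    ⁅⁆≡⊥⊞ : (x : Fin m) → ⁅ x ⁆ ≡ ⊥ ⊞ x
    ⁅⁆≡⊥⊞ zero    = refl
    ⁅⁆≡⊥⊞ (suc x) = cong (false ∷_) (⁅⁆≡⊥⊞ x)

  ∁-in : x ∉ p → x ∈ ∁ p
  ∁-in {x = x} {p = p} o = mk∈ (trans (lookup-map x not p) (cong not (off o)))

  ∁-out : x ∈ p → x ∉ ∁ p
  ∁-out {x = x} {p = p} i = mk∉ (trans (lookup-map x not p) (cong not (at i)))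

  ∁-in-inv : x ∈ ∁ p → x ∉ p
  ∁-in-inv i = not-in λ j → in∧out i (∁-out j)

  ext : (∀ x → lookup p x ≡ lookup q x) → p ≡ q
  ext {p = []}    {[]}    h = refl
  ext {p = a ∷ p} {b ∷ q} h = cong₂ _∷_ (h zero) (ext (h ∘ suc))

  ⊑-antisym : p ⊑ q → q ⊑ p → p ≡ q
  ⊑-antisym {p = p} {q} f g = ext lem
    where
    lem : ∀ x → lookup p x ≡ lookup q x
    lem x with in? x p | in? x q
    ... | inj₁ i | _      = trans (at i) (sym (at (f x i)))
    ... | inj₂ o | inj₁ i = in∧out (g x i) o
    ... | inj₂ o | inj₂ u = trans (off o) (sym (off u))

  abstract
    ⊟⊞ : x ∈ p → p ⊟ x ⊞ x ≡ p
    ⊟⊞ {x = x} {p = p} i = trans ([]≔-idempotent p x) (trans (cong (p [ x ]≔_) (sym (at i))) ([]≔-lookup p x))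

  abstract
    ⊞⊟ : x ∉ p → p ⊞ x ⊟ x ≡ p
    ⊞⊟ {x = x} {p = p} o = trans ([]≔-idempotent p x) (trans (cong (p [ x ]≔_) (sym (off o))) ([]≔-lookup p x))

  abstract
    ⊞-comm : ∀ (p : Subset m) x y → p ⊞ x ⊞ y ≡ p ⊞ y ⊞ x
    ⊞-comm p x y with x ≟ y
    ... | yes refl = refl
    ... | no x≢y   = []≔-commutes p x y x≢y

  abstract
    ⊟-comm : ∀ (p : Subset m) x y → p ⊟ x ⊟ y ≡ p ⊟ y ⊟ x
    ⊟-comm p x y with x ≟ y
    ... | yes refl = refl
    ... | no x≢y   = []≔-commutes p x y x≢y

  abstract
    ⊟⊞-comm : ∀ (p : Subset m) {x y} → x ≢ y → p ⊟ x ⊞ y ≡ p ⊞ y ⊟ x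
    ⊟⊞-comm p x≢y = []≔-commutes p _ _ x≢y

  abstract
    size-⊞ : x ∉ p → ∣ p ⊞ x ∣ ≡ suc ∣ p ∣
    size-⊞ {x = zero}  {p = false ∷ p} o = refl
    size-⊞ {x = zero}  {p = true  ∷ p} (mk∉ ())
    size-⊞ {x = suc x} {p = true  ∷ p} o = cong suc (size-⊞ {x = x} {p} (mk∉ (off o)))
    size-⊞ {x = suc x} {p = false ∷ p} o = size-⊞ {x = x} {p} (mk∉ (off o))

  size-⊟ : x ∈ p → suc ∣ p ⊟ x ∣ ≡ ∣ p ∣
  size-⊟ {x = x} {p = p} i = trans (sym (size-⊞ {x = x} {p = p ⊟ x} ⊟-gone)) (cong ∣_∣ (⊟⊞ i))

  ⊑-tail : ∀ {a b} → (a ∷ p) ⊑ (b ∷ q) → p ⊑ q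
  ⊑-tail f x i = mk∈ (at (f (suc x) (mk∈ (at i))))

  size-mono : p ⊑ q → ∣ p ∣ ≤ ∣ q ∣
  size-mono {p = []}        {[]}        f = z≤n
  size-mono {p = true  ∷ p} {true  ∷ q} f = s≤s (size-mono (⊑-tail f))
  size-mono {p = true  ∷ p} {false ∷ q} f = in∧out (f zero (mk∈ refl)) (mk∉ refl)
  size-mono {p = false ∷ p} {true  ∷ q} f = ℕP.m≤n⇒m≤1+n (size-mono (⊑-tail f))
  size-mono {p = false ∷ p} {false ∷ q} f = size-mono (⊑-tail f)

  abstract
    diff : (p q : Subset m) → ∣ p ∣ < ∣ q ∣ → ∃ λ x → x ∈ q × x ∉ p
    diff (true  ∷ p) (true  ∷ q) (s≤s h) with diff p q h
    ... | x , i , o = suc x , mk∈ (at i) , mk∉ (off o)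
    diff (true  ∷ p) (false ∷ q) h with diff p q (ℕP.<-trans (ℕP.n<1+n _) h)
    ... | x , i , o = suc x , mk∈ (at i) , mk∉ (off o)
    diff (false ∷ p) (true  ∷ q) h = zero , mk∈ refl , mk∉ refl
    diff (false ∷ p) (false ∷ q) h with diff p q h
    ... | x , i , o = suc x , mk∈ (at i) , mk∉ (off o)

  size-⊥ : ∀ m → ∣ ⊥ {m} ∣ ≡ 0
  size-⊥ zero    = refl
  size-⊥ (suc m) = size-⊥ m

  abstract
    inhabited : (p : Subset m) → 1 ≤ ∣ p ∣ → ∃ λ x → x ∈ p
    inhabited {m} p h with diff ⊥ p (subst (_< ∣ p ∣) (sym (size-⊥ m)) h)
    ... | x , i , _ = x , i

  nonempty : x ∈ p → 1 ≤ ∣ p ∣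
  nonempty i = subst (1 ≤_) (size-⊟ i) (s≤s z≤n)

  ⊑-size : p ⊑ q → ∣ q ∣ ≤ ∣ p ∣ → p ≡ q
  ⊑-size {p = p} {q} f h = ⊑-antisym f lem
    where
    lem : q ⊑ p
    lem x i with in? x p
    ... | inj₁ j = j
    ... | inj₂ o = contradiction (subst (_≤ ∣ q ∣) (size-⊞ o) (size-mono p⊞x⊑q)) (ℕP.<⇒≱ (s≤s h))
      where
      p⊞x⊑q : p ⊞ x ⊑ q
      p⊞x⊑q y j with ⊞-inv j
      ... | inj₁ refl = i
      ... | inj₂ k    = f y k

  abstract
    ⊑-codim1 : p ⊑ q → suc ∣ p ∣ ≡ ∣ q ∣ → ∃ λ x → x ∈ q × x ∉ p × p ≡ q ⊟ x
    ⊑-codim1 {p = p} {q} f h with diff p q (ℕP.≤-reflexive h)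
    ... | x , i , o = x , i , o , ⊑-size (λ y j → ⊟-keep (in≢out j o) (f y j))
                                    (ℕP.≤-reflexive (ℕP.suc-injective (trans (size-⊟ i) (sym h))))

  abstract
    ⊑-codim2 : p ⊑ q → suc (suc ∣ p ∣) ≡ ∣ q ∣ →
      ∃ λ x → ∃ λ y → x ≢ y × x ∈ q × y ∈ q × x ∉ p × y ∉ p × p ≡ q ⊟ x ⊟ y
    ⊑-codim2 {p = p} {q} f h with diff p q (subst (suc ∣ p ∣ ≤_) h (ℕP.n≤1+n _))
    ... | x , i , o with ⊑-codim1 {p = p} {q = q ⊟ x} (λ y j → ⊟-keep (in≢out j o) (f y j))
                           (ℕP.suc-injective (trans h (sym (size-⊟ i))))
    ... | y , j , u , e = x , y , (λ x≡y → proj₁ (⊟-inv j) (sym x≡y)) , i , proj₂ (⊟-inv j) , o , u , e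

  -- `a` is a default value off `p`, where nothing is claimed.
  choice : {A : Set} {p : Subset m} {P : Fin m → A → Set} → A →
    (∀ z → z ∈ p → ∃ (P z)) → ∃ λ f → ∀ z → z ∈ p → P z (f z)
  choice {m} {A} {p} {P} a k = (λ z → f z (in? z p)) , λ z i → pf z (in? z p) i
    where
    f : ∀ z → z ∈ p ⊎ z ∉ p → A
    f z (inj₁ i) = proj₁ (k z i)
    f z (inj₂ _) = a
    pf : ∀ z d → z ∈ p → P z (f z d)
    pf z (inj₁ i) _ = proj₂ (k z i)
    pf z (inj₂ o) i = in∧out i o

  abstract
    -- Pick `z`: either another point of `p` has the same image, or `f` sends `p ⊟ z` into `q ⊟ f z`
    -- and the induction on `k` continues.
    pigeonhole : ∀ k (p q : Subset m) (f : Fin m → Fin m) → ∣ p ∣ ≡ k → ∣ q ∣ < k →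
      (∀ z → z ∈ p → f z ∈ q) → ∃ λ z → ∃ λ w → z ≢ w × z ∈ p × w ∈ p × f z ≡ f w
    pigeonhole (suc k) p q f ep eq h with inhabited p (subst (1 ≤_) (sym ep) (s≤s z≤n))
    ... | z , i with any? (λ w → (w ∈? (p ⊟ z)) ×-dec (f z ≟ f w))
    ... | yes (w , j , e) = z , w , (λ z≡w → proj₁ (⊟-inv j) (sym z≡w)) , i , proj₂ (⊟-inv j) , e
    ... | no none with pigeonhole k (p ⊟ z) (q ⊟ f z) f
                         (ℕP.suc-injective (trans (size-⊟ i) ep))
                         (s≤s⁻¹ (subst (_< suc k) (sym (size-⊟ (h z i))) eq))
                         (λ w j → ⊟-keep (λ e → none (w , j , sym e)) (h w (proj₂ (⊟-inv j))))
    ... | w , w′ , ne , j , j′ , e = w , w′ , ne , proj₂ (⊟-inv j) , proj₂ (⊟-inv j′) , e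

  ⊟-shrink : ∀ (p : Subset m) x → ∣ p ∣ ≤ suc ∣ p ⊟ x ∣
  ⊟-shrink p x with in? x p
  ... | inj₁ i = ℕP.≤-reflexive (sym (size-⊟ i))
  ... | inj₂ o = ℕP.m≤n⇒m≤1+n (size-mono λ y i → ⊟-keep (in≢out i o) i)

  abstract
    avoid : ∀ (xs : List (Fin m)) p → length xs < ∣ p ∣ → ∃ λ s → s ∈ p × All (s ≢_) xs
    avoid [] p h with inhabited p h
    ... | s , i = s , i , []
    avoid (x ∷ xs) p h with avoid xs (p ⊟ x) (s≤s⁻¹ (ℕP.≤-trans h (⊟-shrink p x)))
    ... | s , i , a = s , proj₂ (⊟-inv i) , proj₁ (⊟-inv i) ∷ a


open Subsets

-- Boundaries modulo 2 and pseudomanifolds.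

module Pseudomanifolds where
  open import Data.Nat using (_+_)

  xsum : ∀ {m} → (Fin m → Bool) → Bool
  xsum {zero}  f = false
  xsum {suc m} f = f zero xor xsum (f ∘ suc)

  xsum-0 : ∀ {m} (f : Fin m → Bool) → (∀ i → f i ≡ false) → xsum f ≡ false
  xsum-0 {zero}  f h = refl
  xsum-0 {suc m} f h rewrite h zero = xsum-0 (f ∘ suc) (h ∘ suc)

  xsum-cong : ∀ {m} {f g : Fin m → Bool} → (∀ i → f i ≡ g i) → xsum f ≡ xsum g
  xsum-cong {zero}  h = refl
  xsum-cong {suc m} h = cong₂ _xor_ (h zero) (xsum-cong (h ∘ suc))

  xor-interchange : ∀ a b c d → (a xor b) xor (c xor d) ≡ (a xor c) xor (b xor d)
  xor-interchange true  true  true  d = refl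
  xor-interchange true  true  false d = sym (BoolP.not-involutive d)
  xor-interchange true  false true  d = BoolP.not-involutive d
  xor-interchange true  false false d = refl
  xor-interchange false true  true  d = refl
  xor-interchange false true  false d = refl
  xor-interchange false false c     d = refl

  xsum-xor : ∀ {m} (f g : Fin m → Bool) → xsum (λ i → f i xor g i) ≡ xsum f xor xsum g
  xsum-xor {zero}  f g = refl
  xsum-xor {suc m} f g rewrite xsum-xor (f ∘ suc) (g ∘ suc) =
    xor-interchange (f zero) (g zero) (xsum (f ∘ suc)) (xsum (g ∘ suc))

  -- Off-diagonal entries cancel in pairs; this is the cancellation behind ∂∂ = 0.
  xsum-symmetric : ∀ {m} (F : Fin m → Fin m → Bool) → (∀ i j → F i j ≡ F j i) → (∀ i → F i i ≡ false) →
    xsum (λ i → xsum (F i)) ≡ false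
  xsum-symmetric {zero}  F s d = refl
  xsum-symmetric {suc m} F s d
    rewrite d zero
          | xsum-xor (λ i → F (suc i) zero) (λ i → xsum (λ j → F (suc i) (suc j)))
          | xsum-symmetric (λ i j → F (suc i) (suc j)) (λ i j → s (suc i) (suc j)) (d ∘ suc)
          | BoolP.xor-identityʳ (xsum (λ i → F (suc i) zero))
          | xsum-cong (λ i → s (suc i) zero) = BoolP.xor-same (xsum (λ j → F zero (suc j)))

  without : ∀ {m} → Fin m → (Fin m → Bool) → Fin m → Bool
  without x f i = if ⌊ i ≟ x ⌋ then false else f i

  without-off : ∀ {m} {x i : Fin m} f → i ≢ x → without x f i ≡ f i
  without-off {x = x} {i} f ne with i ≟ x
  ... | yes e = contradiction e ne
  ... | no _  = refl

  xsum-split : ∀ {m} (x : Fin m) (f : Fin m → Bool) → xsum f ≡ f x xor xsum (without x f)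
  xsum-split {suc m} zero f = cong (f zero xor_) (xsum-cong {f = f ∘ suc} {g = λ i → without zero f (suc i)} λ i → refl)
  xsum-split {suc m} (suc x) f rewrite xsum-split x (f ∘ suc) =
    trans (swap (f zero) (f (suc x)) (xsum (without x (f ∘ suc))))
          (cong (λ w → f (suc x) xor (f zero xor w)) (xsum-cong lem))
    where
    swap : ∀ a b c → a xor (b xor c) ≡ b xor (a xor c)
    swap true  true  c = refl
    swap true  false c = refl
    swap false b     c = refl
    lem : ∀ i → without x (f ∘ suc) i ≡ without (suc x) f (suc i)
    lem i with i ≟ x
    ... | yes _ = refl
    ... | no _  = refl

  xsum-only : ∀ {m} {x : Fin m} (f : Fin m → Bool) → (∀ i → i ≢ x → f i ≡ false) → xsum f ≡ f x
  xsum-only {x = x} f h = trans (xsum-split x f) (trans (cong (f x xor_) (xsum-0 _ lem)) (BoolP.xor-identityʳ _))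
    where
    lem : ∀ i → without x f i ≡ false
    lem i with i ≟ x
    ... | yes _ = refl
    ... | no ix = h i ix

  xsum-two : ∀ {m} {x y : Fin m} (f : Fin m → Bool) → x ≢ y →
    (∀ i → i ≢ x → i ≢ y → f i ≡ false) → xsum f ≡ f x xor f y
  xsum-two {x = x} {y} f xy h = trans (xsum-split x f)
    (cong (f x xor_) (trans (xsum-only (without x f) lem) (without-off f (xy ∘ sym))))
    where
    lem : ∀ i → i ≢ y → without x f i ≡ false
    lem i iy with i ≟ x
    ... | yes _ = refl
    ... | no ix = h i ix iy

  xsum-three : ∀ {m} {x y z : Fin m} (f : Fin m → Bool) → x ≢ y → x ≢ z → y ≢ z →
    (∀ i → i ≢ x → i ≢ y → i ≢ z → f i ≡ false) → xsum f ≡ f x xor (f y xor f z)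
  xsum-three {x = x} {y} {z} f xy xz yz h = trans (xsum-split x f)
    (cong (f x xor_) (trans (xsum-two (without x f) yz lem)
      (cong₂ _xor_ (without-off f (xy ∘ sym)) (without-off f (xz ∘ sym)))))
    where
    lem : ∀ i → i ≢ y → i ≢ z → without x f i ≡ false
    lem i iy iz with i ≟ x
    ... | yes _ = refl
    ... | no ix = h i ix iy iz

  xsum-witness : ∀ {m} (f : Fin m → Bool) → xsum f ≡ true → ∃ λ i → f i ≡ true
  xsum-witness {suc m} f h with f zero in e
  ... | true  = zero , e
  ... | false with xsum-witness (f ∘ suc) h
  ...   | i , e′ = suc i , e′

  bd-term : ∀ {m} → (Subset m → Bool) → Subset m → Fin m → Bool
  bd-term D ρ y = not (lookup ρ y) ∧ D (ρ ⊞ y)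

  abstract
    -- The coefficient at `ρ` of the boundary modulo 2 of the chain `D`. Terms with `y` already in
    -- `ρ` are switched off, because there `ρ ⊞ y` is no coface.
    bd : ∀ {m} → (Subset m → Bool) → Subset m → Bool
    bd D ρ = xsum (bd-term D ρ)

    bd-in : ∀ {m} {D : Subset m → Bool} {ρ y} → y ∈ ρ → bd-term D ρ y ≡ false
    bd-in i rewrite at i = refl

    bd-off : ∀ {m} {D : Subset m → Bool} {ρ y} → y ∉ ρ → bd-term D ρ y ≡ D (ρ ⊞ y)
    bd-off o rewrite off o = refl

    bd-two : ∀ {m} {D : Subset m → Bool} {ρ a b} → a ≢ b → a ∉ ρ → b ∉ ρ →
      (∀ c → c ∉ ρ → c ≢ a → c ≢ b → D (ρ ⊞ c) ≡ false) → bd D ρ ≡ D (ρ ⊞ a) xor D (ρ ⊞ b)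
    bd-two {D = D} {ρ} {a} {b} ab ao bo h =
      trans (xsum-two (bd-term D ρ) ab lem) (cong₂ _xor_ (bd-off {D = D} ao) (bd-off {D = D} bo))
      where
      lem : ∀ i → i ≢ a → i ≢ b → bd-term D ρ i ≡ false
      lem i ia ib with in? i ρ
      ... | inj₁ j = bd-in {D = D} j
      ... | inj₂ o = trans (bd-off {D = D} o) (h i o ia ib)

    bd-none : ∀ {m} {D : Subset m → Bool} {ρ} → (∀ c → c ∉ ρ → D (ρ ⊞ c) ≡ false) → bd D ρ ≡ false
    bd-none {D = D} {ρ} h = xsum-0 _ lem
      where
      lem : ∀ i → bd-term D ρ i ≡ false
      lem i with in? i ρ
      ... | inj₁ j = bd-in {D = D} j
      ... | inj₂ o = trans (bd-off {D = D} o) (h i o)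

    bd-witness : ∀ {m} {D : Subset m → Bool} {ρ} → bd D ρ ≡ true → ∃ λ b → b ∉ ρ × D (ρ ⊞ b) ≡ true
    bd-witness {D = D} {ρ} h with xsum-witness _ h
    ... | b , e with in? b ρ
    ...   | inj₁ i = true≢false e (bd-in {D = D} i)
    ...   | inj₂ o = b , o , trans (sym (bd-off {D = D} o)) e

    bd-bd : ∀ {m} (D : Subset m → Bool) η → xsum (λ w → not (lookup η w) ∧ bd D (η ⊞ w)) ≡ false
    bd-bd {m} D η = trans (xsum-cong {g = λ i → xsum (F i)} pull) (xsum-symmetric F F-sym F-diag)
      where
      F : Fin m → Fin m → Bool
      F i j = not (lookup η i) ∧ bd-term D (η ⊞ i) j
      pull : ∀ i → not (lookup η i) ∧ bd D (η ⊞ i) ≡ xsum (F i)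
      pull i with lookup η i
      ... | true  = sym (xsum-0 {m} (λ _ → false) λ _ → refl)
      ... | false = refl
      F-diag : ∀ i → F i i ≡ false
      F-diag i = trans (cong (not (lookup η i) ∧_) (bd-in {D = D} {ρ = η ⊞ i} ⊞-new)) (BoolP.∧-zeroʳ _)
      F-sym : ∀ i j → F i j ≡ F j i
      F-sym i j with i ≟ j
      ... | yes refl = refl
      ... | no ne with in? i η | in? j η
      ...   | inj₁ a | _ rewrite at a | bd-in {D = D} {ρ = η ⊞ j} (⊞-old a) = sym (BoolP.∧-zeroʳ _)
      ...   | inj₂ a | inj₁ b rewrite at b | bd-in {D = D} {ρ = η ⊞ i} (⊞-old b) = BoolP.∧-zeroʳ _
      ...   | inj₂ a | inj₂ b
        rewrite off a | off b
              | bd-off {D = D} {ρ = η ⊞ i} {y = j} (⊞-out (ne ∘ sym) b)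
              | bd-off {D = D} {ρ = η ⊞ j} {y = i} (⊞-out ne a) = cong D (⊞-comm η i j)

    -- Serves to compare boundary coefficients at neighbouring ridges: around a face of codimension
    -- two, all but three of them are known to vanish.
    bd-bd-three : ∀ {m} (D : Subset m → Bool) {η x y z} → x ≢ y → x ≢ z → y ≢ z → x ∉ η → y ∉ η → z ∉ η →
      (∀ w → w ∉ η → w ≢ x → w ≢ y → w ≢ z → bd D (η ⊞ w) ≡ false) →
      bd D (η ⊞ x) xor (bd D (η ⊞ y) xor bd D (η ⊞ z)) ≡ false
    bd-bd-three {m} D {η} {x} {y} {z} xy xz yz xo yo zo h =
      trans (sym (trans (xsum-three f xy xz yz lem) (cong₂ _xor_ (ev xo) (cong₂ _xor_ (ev yo) (ev zo))))) (bd-bd D η)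
      where
      f : Fin m → Bool
      f w = not (lookup η w) ∧ bd D (η ⊞ w)
      ev : ∀ {w} → w ∉ η → f w ≡ bd D (η ⊞ w)
      ev o rewrite off o = refl
      lem : ∀ i → i ≢ x → i ≢ y → i ≢ z → f i ≡ false
      lem i ix iy iz with in? i η
      ... | inj₁ j rewrite at j = refl
      ... | inj₂ o = trans (ev o) (h i o ix iy iz)

  xor-false : ∀ {a b} → a xor b ≡ false → a ≡ b
  xor-false {true}  {true}  e = refl
  xor-false {false} {false} e = refl

  not-true : ∀ {b} → ¬ (b ≡ true) → b ≡ false
  not-true {true}  h = ⊥-elim (h refl)
  not-true {false} _ = refl

  IsFace : ∀ {m} → (Subset m → Bool) → Subset m → Set
  IsFace Δ p = Δ p ≡ true

  IsFacet : ∀ {m} → ℕ → (Subset m → Bool) → Subset m → Set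
  IsFacet n Δ p = IsFace Δ p × ∣ p ∣ ≡ n

  -- Strong connectivity is asked only of vertex stars and is stated without paths of facets: a
  -- property that passes across every ridge through `u` passes to all facets through `u`. Each
  -- application then chooses a property `D` and checks it ridge by ridge. Purity is `extend`.
  record IsPM {m} (n : ℕ) (Δ : Subset m → Bool) : Set where
    field
      down   : ∀ {p q} → p ⊑ q → IsFace Δ q → IsFace Δ p
      dim    : ∀ {p} → IsFace Δ p → ∣ p ∣ ≤ n
      vertex : ∀ v → IsFace Δ (⊥ ⊞ v)
      extend : ∀ {p} → IsFace Δ p → 1 ≤ ∣ p ∣ → ∣ p ∣ < n → ∃ λ v → v ∉ p × IsFace Δ (p ⊞ v)
      two    : ∀ {p a} → suc ∣ p ∣ ≡ n → a ∉ p → IsFace Δ (p ⊞ a) →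
               ∃ λ b → b ≢ a × b ∉ p × IsFace Δ (p ⊞ b) × (∀ c → c ∉ p → IsFace Δ (p ⊞ c) → c ≡ a ⊎ c ≡ b)
      star-connected : ∀ u (D : Subset m → Bool) →
        (∀ ρ a b → u ∈ ρ → suc ∣ ρ ∣ ≡ n → a ∉ ρ → b ∉ ρ → IsFace Δ (ρ ⊞ a) → IsFace Δ (ρ ⊞ b) →
           D (ρ ⊞ a) ≡ true → D (ρ ⊞ b) ≡ true) →
        ∀ τ τ′ → u ∈ τ → u ∈ τ′ → IsFacet n Δ τ → IsFacet n Δ τ′ → D τ ≡ true → D τ′ ≡ true

    Face Facet : Subset m → Set
    Face  = IsFace Δ
    Facet = IsFacet n Δ

    face? : ∀ p → Face p ⊎ Δ p ≡ false
    face? p with Δ p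
    ... | true  = inj₁ refl
    ... | false = inj₂ refl

    Face? : ∀ p → Dec (Face p)
    Face? p = Δ p BoolP.≟ true

    extend-facet : ∀ k {p} → Face p → 1 ≤ ∣ p ∣ → k + ∣ p ∣ ≡ n → ∃ λ τ → p ⊑ τ × Facet τ
    extend-facet zero    {p} f h e = p , (λ _ i → i) , f , e
    extend-facet (suc k) {p} f h e with extend f h (subst (suc ∣ p ∣ ≤_) e (s≤s (ℕP.m≤n+m _ k)))
    ... | v , o , f′ with extend-facet k f′ (nonempty {x = v} {p = p ⊞ v} ⊞-new)
                            (trans (cong (k +_) (size-⊞ o)) (trans (ℕP.+-suc k _) e))
    ...   | τ , s , F = τ , (λ x i → s x (⊞-old i)) , F

    facet⊇ : ∀ {p} → Face p → 1 ≤ ∣ p ∣ → ∃ λ τ → p ⊑ τ × Facet τ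
    facet⊇ f h = extend-facet _ f h (ℕP.m∸n+n≡m (dim f))

    third : ∀ {p a b c} → suc ∣ p ∣ ≡ n → a ∉ p → b ∉ p → c ∉ p →
      Face (p ⊞ a) → Face (p ⊞ b) → Face (p ⊞ c) → a ≢ b → c ≡ a ⊎ c ≡ b
    third s ao bo co fa fb fc ab with two s ao fa
    ... | b′ , _ , _ , _ , only with only _ bo fb | only _ co fc
    ...   | inj₁ e | _ = contradiction (sym e) ab
    ...   | inj₂ e | inj₁ e′ = inj₁ e′
    ...   | inj₂ e | inj₂ e′ = inj₂ (trans e′ (sym e))

    ridge? : ∀ {ρ} → suc ∣ ρ ∣ ≡ n →
      (∃ λ a → ∃ λ b → b ≢ a × a ∉ ρ × b ∉ ρ × Face (ρ ⊞ a) × Face (ρ ⊞ b) ×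
         (∀ c → c ∉ ρ → Face (ρ ⊞ c) → c ≡ a ⊎ c ≡ b))
      ⊎ (∀ c → c ∉ ρ → Δ (ρ ⊞ c) ≡ false)
    ridge? {ρ} s with any? (λ a → (a ∉? ρ) ×-dec Face? (ρ ⊞ a))
    ... | yes (a , ao , fa) with two s ao fa
    ...   | b , ba , bo , fb , only = inj₁ (a , b , ba , ao , bo , fa , fb , only)
    ridge? {ρ} s | no none = inj₂ λ c co → not-true λ fc → none (c , co , fc)

    -- A ridge lies in no facet or in exactly two, and equal contributions of the two cancel.
    bd-closed : ∀ {D ρ} → suc ∣ ρ ∣ ≡ n → (∀ τ → Δ τ ≡ false → D τ ≡ false) →
      (∀ a b → a ∉ ρ → b ∉ ρ → Face (ρ ⊞ a) → Face (ρ ⊞ b) → D (ρ ⊞ a) ≡ D (ρ ⊞ b)) → bd D ρ ≡ false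
    bd-closed {D} {ρ} s z h with ridge? s
    ... | inj₂ none = bd-none {D = D} λ c co → z _ (none c co)
    ... | inj₁ (a , b , ba , ao , bo , fa , fb , only) =
      trans (bd-two {D = D} (ba ∘ sym) ao bo other) (trans (cong (_xor D (ρ ⊞ b)) (h a b ao bo fa fb)) (BoolP.xor-same (D (ρ ⊞ b))))
      where
      other : ∀ c → c ∉ ρ → c ≢ a → c ≢ b → D (ρ ⊞ c) ≡ false
      other c co ca cb with face? (ρ ⊞ c)
      ... | inj₂ e = z _ e
      ... | inj₁ f with only c co f
      ...   | inj₁ e = contradiction e ca
      ...   | inj₂ e = contradiction e cb

    bd-pair : ∀ {D ρ a b} → suc ∣ ρ ∣ ≡ n → (∀ τ → Δ τ ≡ false → D τ ≡ false) → a ≢ b → a ∉ ρ → b ∉ ρ →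
      Face (ρ ⊞ a) → Face (ρ ⊞ b) → bd D ρ ≡ D (ρ ⊞ a) xor D (ρ ⊞ b)
    bd-pair {D} {ρ} {a} {b} s z ab ao bo fa fb = bd-two {D = D} ab ao bo other
      where
      other : ∀ c → c ∉ ρ → c ≢ a → c ≢ b → D (ρ ⊞ c) ≡ false
      other c co ca cb with face? (ρ ⊞ c)
      ... | inj₂ e = z _ e
      ... | inj₁ f with third s ao bo co fa fb f ab
      ...   | inj₁ e = contradiction e ca
      ...   | inj₂ e = contradiction e cb

    bd-balanced : ∀ {D ρ a b} → suc ∣ ρ ∣ ≡ n → (∀ τ → Δ τ ≡ false → D τ ≡ false) → bd D ρ ≡ false →
      a ∉ ρ → b ∉ ρ → Face (ρ ⊞ a) → Face (ρ ⊞ b) → D (ρ ⊞ a) ≡ D (ρ ⊞ b)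
    bd-balanced {D} {ρ} {a} {b} s z e ao bo fa fb with a ≟ b
    ... | yes refl = refl
    ... | no ab = xor-false (trans (sym (bd-pair {D} s z ab ao bo fa fb)) e)

open Pseudomanifolds

-- Splittings along the boundary of a missing simplex, and the cuts they induce on S.

module Splittings where

  isYes-true : ∀ {A : Set} {d : Dec A} → ⌊ d ⌋ ≡ true → A
  isYes-true {d = yes a} _ = a

  isYes-yes : ∀ {A : Set} {d : Dec A} → A → ⌊ d ⌋ ≡ true
  isYes-yes {d = yes _} _ = refl
  isYes-yes {d = no n}  a = contradiction a n

  isYes-no : ∀ {A : Set} {d : Dec A} → ¬ A → ⌊ d ⌋ ≡ false
  isYes-no {d = yes a} n = contradiction a n
  isYes-no {d = no _}  _ = refl

  xor-solve : ∀ a b c → a xor (b xor c) ≡ false → a ≡ c xor b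
  xor-solve a b c e = trans (xor-false e) (BoolP.xor-comm b c)

  -- T = ∁ S is a missing simplex whose boundary splits the complex; colour s b tells on which side of ∂T
  -- the edge s b leaves the vertex b of T. Its values on pairs that are not edges carry no meaning.
  record Split {m : ℕ} (n : ℕ) (Δ : Subset m → Bool) : Set where
    field
      S      : Subset m
      colour : Fin m → Fin m → Bool
      size-S : ∣ S ∣ ≡ suc n
      size-T : ∣ ∁ S ∣ ≡ n
      colour-S : ∀ {p s s′ b} → IsFace Δ p → s ∈ S → s′ ∈ S → b ∉ S → s ∈ p → s′ ∈ p → b ∈ p →
        colour s b ≡ colour s′ b
      colour-T : ∀ {p s b b′} → IsFace Δ p → s ∈ S → b ∉ S → b′ ∉ S → s ∈ p → b ∈ p → b′ ∈ p →
        colour s b ≡ colour s b′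
      -- Each ridge `∁ S ⊟ x` of ∂T lies in one facet on either side; `a` is the apex on the side
      -- `col`.
      both-sides : ∀ x col → x ∉ S → ∃ λ a → a ∈ S × IsFace Δ (∁ S ⊟ x ⊞ a) × (∀ t → t ∉ S → t ≢ x → colour a t ≡ col)
      missing  : ¬ IsFace Δ (∁ S)
      s₀ s₁    : Fin m
      s₀≢s₁    : s₀ ≢ s₁
      s₀∈S     : s₀ ∈ S
      s₁∈S     : s₁ ∈ S
      face₀    : IsFace Δ (S ⊟ s₀)
      face₁    : IsFace Δ (S ⊟ s₁)

  -- The two sides of ∂T are symmetric; results for the colour `true` are applied to the other side
  -- through this exchange.
  swap-colours : ∀ {m n} {Δ : Subset m → Bool} → Split n Δ → Split n Δ
  swap-colours sp = record
    { S = S ; colour = λ s b → not (colour s b) ; size-S = size-S ; size-T = size-T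
    ; colour-S = λ f a b c d e g → cong not (colour-S f a b c d e g)
    ; colour-T = λ f a b c d e g → cong not (colour-T f a b c d e g)
    ; both-sides = λ x col o → let a , i , f , h = both-sides x (not col) o in
        a , i , f , λ t u v → trans (cong not (h t u v)) (BoolP.not-involutive col)
    ; missing = missing ; s₀ = s₀ ; s₁ = s₁ ; s₀≢s₁ = s₀≢s₁ ; s₀∈S = s₀∈S ; s₁∈S = s₁∈S
    ; face₀ = face₀ ; face₁ = face₁ }
    where open Split sp

  module Sizes {m n : ℕ} (n≥5 : 5 ≤ n) (S : Subset m) (size-S : ∣ S ∣ ≡ suc n) (size-T : ∣ ∁ S ∣ ≡ n) where
    size-S⊟ : ∀ {x} → x ∈ S → ∣ S ⊟ x ∣ ≡ n
    size-S⊟ i = ℕP.suc-injective (trans (size-⊟ i) size-S)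

    size-S⊟⊟ : ∀ {x y} → x ∈ S → y ∈ S → x ≢ y → suc ∣ S ⊟ x ⊟ y ∣ ≡ n
    size-S⊟⊟ i j ne = trans (size-⊟ (⊟-keep (ne ∘ sym) j)) (size-S⊟ i)

    size-T⊟ : ∀ {x} → x ∉ S → suc ∣ ∁ S ⊟ x ∣ ≡ n
    size-T⊟ o = trans (size-⊟ (∁-in o)) size-T

    size-T⊟⊞ : ∀ {x a} → x ∉ S → a ∈ S → ∣ ∁ S ⊟ x ⊞ a ∣ ≡ n
    size-T⊟⊞ o i = trans (size-⊞ (⊟-out (∁-out i))) (size-T⊟ o)

    abstract
      avoid-T : ∀ xs → length xs < 5 → ∃ λ t → t ∉ S × All (t ≢_) xs
      avoid-T xs h with avoid xs (∁ S) (ℕP.≤-trans h (subst (5 ≤_) (sym size-T) n≥5))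
      ... | t , i , al = t , ∁-in-inv i , al

      avoid-S : ∀ xs → length xs < 5 → ∃ λ s → s ∈ S × All (s ≢_) xs
      avoid-S xs h = avoid xs S (ℕP.≤-trans h (subst (5 ≤_) (sym size-S) (ℕP.m≤n⇒m≤1+n n≥5)))

  module Cut {m n : ℕ} {Δ : Subset m → Bool} (pm : IsPM n Δ) (n≥5 : 5 ≤ n) (sp : Split n Δ) where
    open IsPM pm
    open Split sp
    open Sizes n≥5 S size-S size-T public

    private
      V : Set
      V = Fin m

      Mixed : Subset m → Set
      Mixed τ = ∃ λ s → ∃ λ b → s ∈ S × s ∈ τ × b ∉ S × b ∈ τ × colour s b ≡ true

      Mixed? : ∀ τ → Dec (Mixed τ)
      Mixed? τ = any? λ s → any? λ b →
        (s ∈? S) ×-dec (s ∈? τ) ×-dec (b ∉? S) ×-dec (b ∈? τ) ×-dec (colour s b BoolP.≟ true)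

    abstract
      -- One side of ∂T as a chain modulo 2. Faces inside S get `false`, so at a ridge inside S the
      -- boundary of `D` sees only facets that stick out of S.
      D : Subset m → Bool
      D τ = ⌊ Face? τ ×-dec Mixed? τ ⌋

      D-true : ∀ {τ} → D τ ≡ true → Face τ × Mixed τ
      D-true {τ} e = isYes-true {d = Face? τ ×-dec Mixed? τ} e

      D-value : ∀ {τ s b} → Face τ → s ∈ S → s ∈ τ → b ∉ S → b ∈ τ → D τ ≡ colour s b
      D-value {τ} {s} {b} f sS sτ bS bτ with colour s b in e
      ... | true  = isYes-yes {d = Face? τ ×-dec Mixed? τ} (f , s , b , sS , sτ , bS , bτ , e)
      ... | false = isYes-no {d = Face? τ ×-dec Mixed? τ} λ where
        (_ , s′ , b′ , s′S , s′τ , b′S , b′τ , e′) →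
          true≢false (trans (trans (colour-S f sS s′S bS sτ s′τ bτ) (colour-T f s′S bS b′S s′τ bτ b′τ)) e′) e

      D-inside : ∀ {τ} → τ ⊑ S → D τ ≡ false
      D-inside {τ} h = isYes-no {d = Face? τ ×-dec Mixed? τ} λ where
        (_ , _ , b , _ , _ , bS , bτ , _) → in∧out (h b bτ) bS

      D-nonface : ∀ τ → Δ τ ≡ false → D τ ≡ false
      D-nonface τ e = isYes-no {d = Face? τ ×-dec Mixed? τ} λ (f , _) → true≢false f e

    D-mixed-ridge : ∀ {ρ s b c d} → s ∈ S → s ∈ ρ → b ∉ S → b ∈ ρ →
      Face (ρ ⊞ c) → Face (ρ ⊞ d) → D (ρ ⊞ c) ≡ D (ρ ⊞ d)
    D-mixed-ridge sS sρ bS bρ fc fd =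
      trans (D-value fc sS (⊞-old sρ) bS (⊞-old bρ)) (sym (D-value fd sS (⊞-old sρ) bS (⊞-old bρ)))

    bd-mixed : ∀ {ρ s b} → suc ∣ ρ ∣ ≡ n → s ∈ S → s ∈ ρ → b ∉ S → b ∈ ρ → bd D ρ ≡ false
    bd-mixed e sS sρ bS bρ = bd-closed {D} e D-nonface λ c d _ _ → D-mixed-ridge sS sρ bS bρ

    -- A ridge inside S is S minus a pair of vertices, so the boundary of `D` within S is a graph on
    -- S, with adjacency `g`.
    g : V → V → Bool
    g x y = bd D (S ⊟ x ⊟ y)

    private
      refill : ∀ {x y z} → x ∈ S → x ≢ y → x ≢ z → S ⊟ x ⊟ y ⊟ z ⊞ x ≡ S ⊟ y ⊟ z
      refill {x} {y} {z} i xy xz = trans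
        (cong (_⊞ x) (trans (cong (_⊟ z) (⊟-comm S x y)) (⊟-comm (S ⊟ y) x z)))
        (⊟⊞ (⊟-keep xz (⊟-keep xy i)))

    abstract
      -- ∂∂ = 0 at `S ⊟ x ⊟ y ⊟ z`. This set still contains a vertex of S, so its cofaces with a
      -- vertex of T are mixed ridges and carry no boundary. Thus every triangle of the graph `g`
      -- has an even number of edges, which is what makes `g` a cut.
      g-triple : ∀ {x y z} → x ∈ S → y ∈ S → z ∈ S → x ≢ y → x ≢ z → y ≢ z → g y z ≡ g x y xor g x z
      g-triple {x} {y} {z} xi yi zi xy xz yz = xor-solve (g y z) (g x z) (g x y)
        (subst (λ w → bd D w xor (g x z xor g x y) ≡ false) (refill xi xy xz)
        (subst (λ w → bd D (η ⊞ x) xor (bd D w xor g x y) ≡ false) (trans (cong (_⊞ y) (cong (_⊟ z) (⊟-comm S x y))) (refill yi (xy ∘ sym) yz))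
        (subst (λ w → bd D (η ⊞ x) xor (bd D (η ⊞ y) xor bd D w) ≡ false) (⊟⊞ z∈)
        (bd-bd-three D xy xz yz (⊟-out (⊟-out ⊟-gone)) (⊟-out ⊟-gone) ⊟-gone outside))))
        where
        η : Subset m
        η = S ⊟ x ⊟ y ⊟ z
        z∈ : z ∈ S ⊟ x ⊟ y
        z∈ = ⊟-keep (yz ∘ sym) (⊟-keep (xz ∘ sym) zi)
        size-η : suc (suc ∣ η ∣) ≡ n
        size-η = trans (cong suc (size-⊟ z∈)) (size-S⊟⊟ xi yi xy)
        outside : ∀ w → w ∉ η → w ≢ x → w ≢ y → w ≢ z → bd D (η ⊞ w) ≡ false
        outside w wo wx wy wz with ⊟-out-inv wo
        ... | inj₁ e = contradiction e wz
        ... | inj₂ o₁ with ⊟-out-inv o₁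
        ...   | inj₁ e = contradiction e wy
        ...   | inj₂ o₂ with ⊟-out-inv o₂
        ...     | inj₁ e = contradiction e wx
        ...     | inj₂ w∉S with inhabited η (s≤s⁻¹ (s≤s⁻¹ (subst (3 ≤_) (sym size-η) (ℕP.≤-trans (s≤s (s≤s (s≤s z≤n))) n≥5))))
        ...       | s , si = bd-mixed (trans (cong suc (size-⊞ wo)) size-η) (⊟-sub s (⊟-sub s (⊟-sub s si))) (⊞-old si) w∉S ⊞-new

    abstract
      -- One shore of the cut, normalised so that `s₀` lies on the other: a cut is recovered from
      -- the neighbours of a single vertex.
      A : V → Bool
      A x = if ⌊ x ≟ s₀ ⌋ then false else g s₀ x

      A-s₀ : A s₀ ≡ false
      A-s₀ with s₀ ≟ s₀
      ... | yes _ = refl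
      ... | no ne = contradiction refl ne

      A-off : ∀ {x} → x ≢ s₀ → A x ≡ g s₀ x
      A-off {x} ne with x ≟ s₀
      ... | yes e = contradiction e ne
      ... | no _  = refl

      g-A : ∀ {x y} → x ∈ S → y ∈ S → x ≢ y → g x y ≡ A x xor A y
      g-A {x} {y} xi yi xy with x ≟ s₀ | y ≟ s₀
      ... | yes refl | yes refl = contradiction refl xy
      ... | yes refl | no ny = refl
      ... | no nx | yes refl = trans (cong (bd D) (⊟-comm S x s₀)) (sym (BoolP.xor-identityʳ _))
      ... | no nx | no ny = g-triple s₀∈S xi yi (nx ∘ sym) (ny ∘ sym) xy

      -- The two facets on the ridge are `S ⊟ x` and `S ⊟ y` themselves, both inside S, where `D` is
      -- `false`.
      g-inner : ∀ {x y} → x ∈ S → y ∈ S → x ≢ y → Face (S ⊟ x) → Face (S ⊟ y) → g x y ≡ false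
      g-inner {x} {y} xi yi xy fx fy = trans (bd-pair {D} (size-S⊟⊟ xi yi xy) D-nonface xy (⊟-out ⊟-gone) ⊟-gone fx′ fy′)
        (cong₂ _xor_ (D-inside (subst (_⊑ S) (sym ex) ⊟-sub)) (D-inside (subst (_⊑ S) (sym ey) ⊟-sub)))
        where
        ex : S ⊟ x ⊟ y ⊞ x ≡ S ⊟ y
        ex = trans (cong (_⊞ x) (⊟-comm S x y)) (⊟⊞ (⊟-keep xy xi))
        ey : S ⊟ x ⊟ y ⊞ y ≡ S ⊟ x
        ey = ⊟⊞ (⊟-keep (xy ∘ sym) yi)
        fx′ : Face (S ⊟ x ⊟ y ⊞ x)
        fx′ = subst Face (sym ex) fy
        fy′ : Face (S ⊟ x ⊟ y ⊞ y)
        fy′ = subst Face (sym ey) fx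

    A-inner : ∀ {x} → x ∈ S → Face (S ⊟ x) → A x ≡ false
    A-inner {x} xi fx with x ≟ s₀
    ... | yes refl = A-s₀
    ... | no ne = trans (A-off ne) (g-inner s₀∈S xi (ne ∘ sym) face₀ fx)

    abstract
      -- The second facet on the ridge `S ⊟ s₀ ⊟ x` could stay inside S only as `S ⊟ x`.
      outer : ∀ {x} → x ∈ S → x ≢ s₀ → ¬ Face (S ⊟ x) → ∃ λ b → b ∉ S × Face (S ⊟ s₀ ⊟ x ⊞ b)
      outer {x} xi ne nf with two {S ⊟ s₀ ⊟ x} {x} (size-S⊟⊟ s₀∈S xi (ne ∘ sym)) ⊟-gone (subst Face (sym (⊟⊞ (⊟-keep ne xi))) face₀)
      ... | b , bx , bo , fb , _ with ⊟-out-inv bo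
      ...   | inj₁ e = contradiction e bx
      ...   | inj₂ o with ⊟-out-inv o
      ...     | inj₂ o′   = b , o′ , fb
      ...     | inj₁ refl = contradiction (subst Face (trans (cong (_⊞ s₀) (⊟-comm S s₀ x)) (⊟⊞ (⊟-keep (ne ∘ sym) s₀∈S))) fb) nf

    A-outer : ∀ {x b s} → x ∈ S → x ≢ s₀ → b ∉ S → Face (S ⊟ s₀ ⊟ x ⊞ b) → s ∈ S ⊟ s₀ ⊟ x → A x ≡ colour s b
    A-outer {x} {b} {s} xi ne bo fb si = begin
      A x                                           ≡⟨ A-off ne ⟩
      g s₀ x                                        ≡⟨ bd-pair {D} (size-S⊟⊟ s₀∈S xi (ne ∘ sym)) D-nonface (in≢out xi bo) ⊟-gone
                                                         (⊟-out (⊟-out bo)) (subst Face (sym e) face₀) fb ⟩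
      D (S ⊟ s₀ ⊟ x ⊞ x) xor D (S ⊟ s₀ ⊟ x ⊞ b)     ≡⟨ cong₂ _xor_ (D-inside (subst (_⊑ S) (sym e) ⊟-sub))
                                                         (D-value fb (⊟-sub s (⊟-sub s si)) (⊞-old si) bo ⊞-new) ⟩
      colour s b                                    ∎
      where
      open ≡-Reasoning
      e : S ⊟ s₀ ⊟ x ⊞ x ≡ S ⊟ s₀
      e = ⊟⊞ (⊟-keep ne xi)

    abstract
      -- On a cut edge the boundary is odd, so a facet of `D` lies over the ridge; its apex is
      -- outside S because `D` vanishes inside S. That facet shows `b` the colour `true` from all of
      -- S except perhaps `a` and `y`.
      crossing : ∀ {a y} → a ∈ S → y ∈ S → A a ≡ true → A y ≡ false →
        ∃ λ b → b ∉ S × Face (S ⊟ a ⊟ y ⊞ b) × (∀ s → s ∈ S → s ≢ a → s ≢ y → colour s b ≡ true)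
      crossing {a} {y} ai yi Aa Ay with bd-witness {D = D} {ρ = S ⊟ a ⊟ y} (trans (g-A ai yi a≢y) (cong₂ _xor_ Aa Ay))
        where
        a≢y : a ≢ y
        a≢y refl = true≢false Aa Ay
      ... | b , bo , e = b , b∉S , fb , λ s si sa sy →
          trans (sym (D-value fb si (⊞-old (⊟-keep sy (⊟-keep sa si))) b∉S ⊞-new)) e
        where
        fb : Face (S ⊟ a ⊟ y ⊞ b)
        fb = proj₁ (D-true e)
        b∉S : b ∉ S
        b∉S = not-in λ bi → true≢false e (D-inside λ u ui → [ (λ { refl → bi }) , (λ j → ⊟-sub u (⊟-sub u j)) ]′ (⊞-inv ui))

    abstract
      facet-through : ∀ {s} → s ∈ S → ∃ λ σ → σ ⊑ S × Facet σ × s ∈ σ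
      facet-through {s} i with s ≟ s₀
      ... | yes refl = S ⊟ s₁ , ⊟-sub , (face₁ , size-S⊟ s₁∈S) , ⊟-keep s₀≢s₁ i
      ... | no ne    = S ⊟ s₀ , ⊟-sub , (face₀ , size-S⊟ s₀∈S) , ⊟-keep ne i

    abstract
      -- If the cut were empty, `D` would pass across every ridge through `a`, where `a` is an apex
      -- over ∂T: across mixed ridges because their colour is fixed, across ridges in S because the
      -- boundary vanishes. It would then spread from a `true` facet over ∂T to a facet inside S,
      -- where it is `false`.
      A-inhabited : ∃ λ a → a ∈ S × A a ≡ true
      A-inhabited with any? (λ a → (a ∈? S) ×-dec (A a BoolP.≟ true))
      ... | yes r = r
      ... | no none with avoid-T [] (s≤s z≤n)
      ...   | x , x∉S , _ with both-sides x true x∉S | avoid-T (x ∷ []) (s≤s (s≤s z≤n))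
      ...     | a , a∈S , f , col | t , t∉S , t≢x ∷ [] with facet-through a∈S
      ...       | σ , σ⊑S , F , a∈σ = true≢false Dσ (D-inside σ⊑S)
        where
        A-empty : ∀ {y} → y ∈ S → A y ≡ false
        A-empty i = not-true λ e → none (_ , i , e)
        closed : ∀ ρ c d → a ∈ ρ → suc ∣ ρ ∣ ≡ n → c ∉ ρ → d ∉ ρ → Face (ρ ⊞ c) → Face (ρ ⊞ d) →
          D (ρ ⊞ c) ≡ true → D (ρ ⊞ d) ≡ true
        closed ρ c d aρ e co d∉ fc fd h with any? (λ b → (b ∈? ρ) ×-dec (b ∉? S))
        ... | yes (b , bρ , bS) = trans (sym (D-mixed-ridge a∈S aρ bS bρ fc fd)) h
        ... | no ρ⊑S with ⊑-codim2 {p = ρ} {q = S} (λ y i → [ (λ j → j) , (λ o → contradiction (y , i , o) ρ⊑S) ]′ (in? y S)) (trans (cong suc e) (sym size-S))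
        ...   | y , z , y≢z , yi , zi , _ , _ , refl =
          trans (sym (bd-balanced {D} e D-nonface (trans (g-A yi zi y≢z) (cong₂ _xor_ (A-empty yi) (A-empty zi))) co d∉ fc fd)) h
        Dσ : D σ ≡ true
        Dσ = star-connected a D closed _ σ ⊞-new a∈σ (f , size-T⊟⊞ x∉S a∈S) F
               (trans (D-value f a∈S ⊞-new t∉S (⊞-old (⊟-keep t≢x (∁-in t∉S)))) (col t t∉S t≢x))

    -- The simplices a ∪ (T - t) form a closed pseudomanifold, so they would make up all of the star of a,
    -- but a also lies in a facet contained in S.
    abstract
      no-cone : ∀ {a} → a ∈ S → (∀ t → t ∉ S → Face (∁ S ⊟ t ⊞ a)) → Empty
      no-cone {a} a∈S cone with avoid-T [] (s≤s z≤n) | facet-through a∈S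
      ... | t , t∉S , _ | σ , σ⊑S , F , a∈σ with avoid (a ∷ []) σ (subst (2 ≤_) (sym (proj₂ F)) (ℕP.≤-trans (s≤s (s≤s z≤n)) n≥5))
      ...   | s , s∈σ , s≢a ∷ [] = isYes-true {d = Only-a? σ} Dσ s s∈σ (σ⊑S s s∈σ) s≢a
        where
        Only-a? : ∀ τ → Dec (∀ s → s ∈ τ → s ∈ S → ¬ (s ≢ a))
        Only-a? τ with any? (λ s → (s ∈? τ) ×-dec (s ∈? S) ×-dec (¬? (s ≟ a)))
        ... | yes (s , i , j , ne) = no λ h → h s i j ne
        ... | no none = yes λ s i j ne → none (s , i , j , ne)
        O : Subset m → Bool
        O τ = ⌊ Only-a? τ ⌋
        closed : ∀ ρ c d → a ∈ ρ → suc ∣ ρ ∣ ≡ n → c ∉ ρ → d ∉ ρ → Face (ρ ⊞ c) → Face (ρ ⊞ d) →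
          O (ρ ⊞ c) ≡ true → O (ρ ⊞ d) ≡ true
        closed ρ c d aρ e co d∉ fc fd h with isYes-true {d = Only-a? (ρ ⊞ c)} h
        ... | only with ⊑-codim2 {p = ρ ⊟ a} {q = ∁ S} (λ y i → ∁-in (not-in λ j → only y (⊞-old (⊟-sub y i)) j (proj₁ (⊟-inv i))))
                          (trans (cong suc (size-⊟ aρ)) (trans e (sym size-T)))
        ...   | x , y , x≢y , xi , yi , xo , yo , eq = isYes-yes {d = Only-a? (ρ ⊞ d)} d-only
          where
          xS : x ∉ S
          xS = ∁-in-inv xi
          yS : y ∉ S
          yS = ∁-in-inv yi
          ρ≡ : ρ ≡ ∁ S ⊟ x ⊟ y ⊞ a
          ρ≡ = trans (sym (⊟⊞ aρ)) (cong (_⊞ a) eq)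
          out : ∀ {w} → w ∉ S → w ∉ ρ ⊟ a → w ∉ ρ
          out wS w with ⊟-out-inv w
          ... | inj₁ refl = in∧out a∈S wS
          ... | inj₂ o = o
          fy : Face (ρ ⊞ y)
          fy = subst Face (sym (trans (cong (_⊞ y) ρ≡) (trans (⊞-comm _ a y) (cong (_⊞ a) (⊟⊞ (⊟-keep (x≢y ∘ sym) yi)))))) (cone x xS)
          fx : Face (ρ ⊞ x)
          fx = subst Face (sym (trans (cong (_⊞ x) ρ≡) (trans (⊞-comm _ a x) (cong (_⊞ a) (trans (cong (_⊞ x) (⊟-comm _ x y)) (⊟⊞ (⊟-keep x≢y xi))))))) (cone y yS)
          d∉S : d ∉ S
          d∉S with third e (out xS xo) (out yS yo) d∉ fx fy fd x≢y
          ... | inj₁ refl = xS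
          ... | inj₂ refl = yS
          d-only : ∀ s → s ∈ ρ ⊞ d → s ∈ S → ¬ (s ≢ a)
          d-only s i j with ⊞-inv i
          ... | inj₁ refl = in∧out j d∉S
          ... | inj₂ k = only s (⊞-old k) j
        Dσ : O σ ≡ true
        Dσ = star-connected a O closed _ σ ⊞-new a∈σ (cone t t∉S , size-T⊟⊞ t∉S a∈S) F
          (isYes-yes {d = Only-a? (∁ S ⊟ t ⊞ a)} λ s i j ne → [ ne , (λ k → in∧out j (∁-in-inv (⊟-sub s k))) ]′ (⊞-inv i))

    -- `a` is the only vertex of S that `b` can see on the side `false`; that it does see one is
    -- `opposite`.
    Sole : V → V → Set
    Sole b a = ∀ s → s ∈ S → colour s b ≡ false → s ≡ a

    abstract
      opposite : ∀ {b} → b ∉ S → ∃ λ a → a ∈ S × colour a b ≡ false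
      opposite {b} bo with avoid-T (b ∷ []) (s≤s (s≤s z≤n))
      ... | t , t∉S , t≢b ∷ [] with both-sides t false t∉S
      ...   | a , i , _ , col = a , i , col b bo (t≢b ∘ sym)

    abstract
      sole-opposite : ∀ {b a} → b ∉ S → Sole b a → a ∈ S × colour a b ≡ false
      sole-opposite bo sole with opposite bo
      ... | s , i , e with sole s i e
      ...   | refl = i , e

    abstract
      -- The `false` facet over `∁ S ⊟ t` contains `b`, so its apex can only be `a`.
      sole-cone : ∀ {b a t} → b ∉ S → Sole b a → t ∉ S → t ≢ b →
        Face (∁ S ⊟ t ⊞ a) × (∀ u → u ∉ S → u ≢ t → colour a u ≡ false)
      sole-cone {b} {a} {t} bo sole to t≢b with both-sides t false to
      ... | s , i , f , col with sole s i (col b bo (t≢b ∘ sym))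
      ...   | refl = f , col

    abstract
      -- Over a ridge of ∂T containing both `b` and `b′` the `false` apex is common, so the two sole
      -- vertices coincide. If `b` and `b′` differed, the cones obtained from them would together
      -- include every `∁ S ⊟ u ⊞ s`, against `no-cone`.
      sole-unique : ∀ {b b′ a a′} → b ∉ S → b′ ∉ S → Sole b a → Sole b′ a′ → b ≡ b′ × a ≡ a′
      sole-unique {b} {b′} {a} {a′} bo bo′ so so′ with b ≟ b′
      ... | yes refl with opposite bo
      ...   | s , i , e = refl , trans (sym (so s i e)) (so′ s i e)
      sole-unique {b} {b′} {a} {a′} bo bo′ so so′ | no b≢b′ with avoid-T (b ∷ b′ ∷ []) (s≤s (s≤s (s≤s z≤n)))
      ...   | t , to , t≢b ∷ t≢b′ ∷ [] with both-sides t false to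
      ...     | s , i , _ , col with so s i (col b bo (t≢b ∘ sym)) | so′ s i (col b′ bo′ (t≢b′ ∘ sym))
      ...       | refl | refl = ⊥-elim (no-cone i cone)
        where
        cone : ∀ u → u ∉ S → Face (∁ S ⊟ u ⊞ s)
        cone u uo with u ≟ b
        ... | no u≢b  = proj₁ (sole-cone bo so uo u≢b)
        ... | yes refl = proj₁ (sole-cone bo′ so′ uo b≢b′)

    abstract
      -- Meant for the exchanged colours: it yields a vertex of T that the other colour occupies,
      -- and so removes one candidate from the pigeonhole argument for this colour.
      far : ∃ λ c → ∃ λ a → c ∉ S × (∀ s → s ∈ S → s ≢ a → s ≢ s₀ → colour s c ≡ true)
      far with A-inhabited
      ... | a , ai , Aa with crossing ai s₀∈S Aa A-s₀
      ...   | c , co , _ , col = c , a , co , col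

open Splittings

-- The vertex isolated by the cut, and its exchange.

module Exchanges where

  module Advance {m n : ℕ} {Δ : Subset m → Bool} (pm : IsPM n Δ) (n≥5 : 5 ≤ n) (sp : Split n Δ) where
    open IsPM pm
    open Split sp
    open Cut pm n≥5 sp
    private
      module Other = Cut pm n≥5 (swap-colours sp)
      V : Set
      V = Fin m

    private
      -- `b` is an outer apex over the tree edge belonging to `z`: `z` is joined to `y₀` on the
      -- shore `A` and to `a₀` on the other. The face is kept only in the second case, which is the
      -- one that feeds `Doubled`.
      Across : V → V → V → V → Set
      Across a₀ y₀ z b = b ∉ S × (
        (A z ≡ true × (∀ s → s ∈ S → colour s b ≡ false → s ≡ z ⊎ s ≡ y₀)) ⊎
        (A z ≡ false × Face (S ⊟ a₀ ⊟ z ⊞ b) × (∀ s → s ∈ S → colour s b ≡ false → s ≡ a₀ ⊎ s ≡ z)))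

      opp : ∀ {s x y b} → (s ≢ x → s ≢ y → colour s b ≡ true) → colour s b ≡ false → s ≡ x ⊎ s ≡ y
      opp {s} {x} {y} h e with s ≟ x | s ≟ y
      ... | yes p | _ = inj₁ p
      ... | no _ | yes q = inj₂ q
      ... | no p | no q = true≢false (h p q) e

      across : ∀ {a₀ y₀} → a₀ ∈ S → y₀ ∈ S → A a₀ ≡ true → A y₀ ≡ false → ∀ z → z ∈ S ⊟ a₀ → ∃ (Across a₀ y₀ z)
      across ai yi Aa Ay z zi with A z in Az
      ... | true with crossing (⊟-sub z zi) yi Az Ay
      ...   | b , bo , f , col = b , bo , inj₁ (refl , λ s i → opp (col s i))
      across ai yi Aa Ay z zi | false with crossing ai (⊟-sub z zi) Aa Az
      ...   | b , bo , f , col = b , bo , inj₂ (refl , f , λ s i → opp (col s i))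

      few-opposite : ∀ {a₀ y₀ z b} → Across a₀ y₀ z b → ∃ λ p → ∃ λ q → ∀ s → s ∈ S → colour s b ≡ false → s ≡ p ⊎ s ≡ q
      few-opposite (_ , inj₁ (_ , h))     = _ , _ , h
      few-opposite (_ , inj₂ (_ , _ , h)) = _ , _ , h

      -- `c` sees at most two vertices of S as `true`; an apex over a tree edge sees at most two as
      -- `false`; S has more than four.
      far-excluded : ∀ {c a p q} → (∀ s → s ∈ S → s ≢ a → s ≢ s₀ → not (colour s c) ≡ true) →
        ¬ (∀ s → s ∈ S → colour s c ≡ false → s ≡ p ⊎ s ≡ q)
      far-excluded {c} {a} {p} {q} col h with avoid-S (a ∷ s₀ ∷ p ∷ q ∷ []) (s≤s (s≤s (s≤s (s≤s (s≤s z≤n)))))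
      ... | s , i , sa ∷ ss₀ ∷ sp ∷ sq ∷ [] with h s i (not-true λ e → true≢false (col s i sa ss₀) (cong not e))
      ...   | inj₁ e = sp e
      ...   | inj₂ e = sq e

    -- Once `a` is exchanged for `b`, these become the two facets inside the new S that the next
    -- splitting needs.
    record Doubled (a b : V) : Set where
      constructor doubled
      field
        {z w} : V
        z≢w : z ≢ w
        z∈S : z ∈ S
        w∈S : w ∈ S
        z≢a : z ≢ a
        w≢a : w ≢ a
        face-z : Face (S ⊟ a ⊟ z ⊞ b)
        face-w : Face (S ⊟ a ⊟ w ⊞ b)

    -- The n edges of the spanning tree joining a₀ to the complement of A and y₀ to A give n ridges of S crossing
    -- the cut A, but at most n - 1 vertices of T can see them: two of the ridges share their outer vertex.
    abstract
      two-ridges : ∀ {a₀ y₀} → a₀ ∈ S → y₀ ∈ S → A a₀ ≡ true → A y₀ ≡ false →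
        (∃ λ b → b ∉ S × Sole b a₀ × Doubled a₀ b) ⊎ (∃ λ b → b ∉ S × Sole b y₀)
      two-ridges {a₀} {y₀} ai yi Aa Ay
        with choice a₀ (across ai yi Aa Ay) | Other.far
      ... | f , acr | c , a , co , col with pigeonhole n (S ⊟ a₀) (∁ S ⊟ c) f (size-S⊟ ai)
                                             (ℕP.≤-reflexive (size-T⊟ co))
                                             (λ z i → ⊟-keep (λ { refl → far-excluded col (proj₂ (proj₂ (few-opposite (acr z i)))) })
                                                             (∁-in (proj₁ (acr z i))))
      -- A vertex that `b` sees as `false` lies on both tree edges. Distinct edges share at most one
      -- end: `a₀` if both issue from `a₀`, otherwise at most `y₀`.
      ... | z , w , z≢w , zi , wi , e with acr z zi | subst (Across a₀ y₀ w) (sym e) (acr w wi)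
      ...   | bo , inj₂ (Az , fz , hz) | _ , inj₂ (Aw , fw , hw) =
        inj₁ (f z , bo , sole , doubled z≢w (⊟-sub z zi) (⊟-sub w wi) (proj₁ (⊟-inv zi)) (proj₁ (⊟-inv wi)) fz fw)
        where
        sole : Sole (f z) a₀
        sole s i g with hz s i g | hw s i g
        ... | inj₁ p    | _         = p
        ... | inj₂ refl | inj₁ p    = p
        ... | inj₂ refl | inj₂ refl = contradiction refl z≢w
      ...   | bo , inj₁ (Az , hz) | _ , inj₁ (Aw , hw) = inj₂ (f z , bo , sole)
        where
        sole : Sole (f z) y₀
        sole s i g with hz s i g | hw s i g
        ... | inj₂ p    | _         = p
        ... | inj₁ refl | inj₂ p    = p
        ... | inj₁ refl | inj₁ refl = contradiction refl z≢w
      ...   | bo , inj₁ (Az , hz) | _ , inj₂ (Aw , _ , hw) = inj₂ (f z , bo , sole)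
        where
        sole : Sole (f z) y₀
        sole s i g with hz s i g | hw s i g
        ... | inj₂ p    | _         = p
        ... | inj₁ refl | inj₁ p    = contradiction p (proj₁ (⊟-inv zi))
        ... | inj₁ refl | inj₂ refl = contradiction refl z≢w
      ...   | bo , inj₂ (Az , _ , hz) | _ , inj₁ (Aw , hw) = inj₂ (f z , bo , sole)
        where
        sole : Sole (f z) y₀
        sole s i g with hw s i g | hz s i g
        ... | inj₂ p    | _         = p
        ... | inj₁ refl | inj₁ p    = contradiction p (proj₁ (⊟-inv wi))
        ... | inj₁ refl | inj₂ refl = contradiction refl z≢w

    abstract
      -- The unwanted alternative of `two-ridges` cannot occur for both `s₀` and `s₁` in the role of
      -- `y₀`, since the sole vertex is unique.
      sole-in-A : ∀ {a₀} → a₀ ∈ S → A a₀ ≡ true → ∃ λ b → b ∉ S × Sole b a₀ × Doubled a₀ b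
      sole-in-A ai Aa with two-ridges ai s₀∈S Aa A-s₀ | two-ridges ai s₁∈S Aa (A-inner s₁∈S face₁)
      ... | inj₁ r | _ = r
      ... | inj₂ _ | inj₁ r = r
      ... | inj₂ (b , bo , so) | inj₂ (b′ , bo′ , so′) = contradiction (proj₂ (sole-unique bo bo′ so so′)) s₀≢s₁

    A-unique : ∀ {a a′} → a ∈ S → a′ ∈ S → A a ≡ true → A a′ ≡ true → a ≡ a′
    A-unique ai ai′ Aa Aa′ with sole-in-A ai Aa | sole-in-A ai′ Aa′
    ... | b , bo , so , _ | b′ , bo′ , so′ , _ = proj₂ (sole-unique bo bo′ so so′)

    record Exit : Set where
      field
        x β : V
        x∈S : x ∈ S
        β∉S : β ∉ S
        A-x : A x ≡ true
        sole : Sole β x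
        twice : Doubled x β

    abstract
      exit : Exit
      exit with A-inhabited
      ... | a , ai , Aa with sole-in-A ai Aa
      ...   | b , bo , so , d = record { x = a ; β = b ; x∈S = ai ; β∉S = bo ; A-x = Aa ; sole = so ; twice = d }

  module Next {m n : ℕ} {Δ : Subset m → Bool} (pm : IsPM n Δ) (n≥5 : 5 ≤ n) (sp : Split n Δ)
              (ex : Advance.Exit pm n≥5 sp) where
    open IsPM pm
    open Split sp
    open Cut pm n≥5 sp
    open Advance pm n≥5 sp using (Exit)
    open Exit ex public

    private
      V : Set
      V = Fin m

    x-nonface : ¬ Face (S ⊟ x)
    x-nonface f = true≢false A-x (A-inner x∈S f)

    colour-xβ : colour x β ≡ false
    colour-xβ = proj₂ (sole-opposite β∉S sole)

    colour-β : ∀ {s} → s ∈ S → s ≢ x → colour s β ≡ true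
    colour-β {s} i ne with colour s β in e
    ... | true  = refl
    ... | false = contradiction (sole s i e) ne

    -- For `b` other than `β`, a ridge `∁ S ⊟ t` containing `b` and `β` has `x` as its `false` apex.
    colour-x : ∀ {b} → b ∉ S → colour x b ≡ false
    colour-x {b} bo with b ≟ β
    ... | yes refl = colour-xβ
    ... | no b≢β with avoid-T (b ∷ β ∷ []) (s≤s (s≤s (s≤s z≤n)))
    ...   | t , to , t≢b ∷ t≢β ∷ [] = proj₂ (sole-cone β∉S sole to t≢β) b bo (t≢b ∘ sym)

    private
      x≢β : x ≢ β
      x≢β = in≢out x∈S β∉S

      S′ : Subset m
      S′ = S ⊟ x ⊞ β

      -- The sphere ∂T is pushed across the simplices `∁ S ⊟ t ⊞ x` with `t` other than `β`, which
      -- move from the side `false` to the side `true`. Of the pairs between S and T that remain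
      -- such pairs, only `x` with `β` changes its colour; the new pairs of `β` get `true` and those
      -- of `x` get `false`.
      colour′ : V → V → Bool
      colour′ s b = if ⌊ s ≟ β ⌋ then true else if ⌊ b ≟ x ⌋ then false else colour s b

    colour′-β : ∀ b → colour′ β b ≡ true
    colour′-β b with β ≟ β
    ... | yes _ = refl
    ... | no ne = contradiction refl ne

    colour′-x : ∀ {s} → s ≢ β → colour′ s x ≡ false
    colour′-x {s} ne with s ≟ β | x ≟ x
    ... | yes e | _ = contradiction e ne
    ... | no _ | yes _ = refl
    ... | no _ | no n′ = contradiction refl n′

    colour′-old : ∀ {s b} → s ≢ β → b ≢ x → colour′ s b ≡ colour s b
    colour′-old {s} {b} ne ne′ with s ≟ β | b ≟ x
    ... | yes e | _ = contradiction e ne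
    ... | no _ | yes e = contradiction e ne′
    ... | no _ | no _ = refl

    private
      old-S : ∀ {s} → s ∈ S′ → s ≢ β → s ∈ S × s ≢ x
      old-S i ne with ⊟-inv (⊞-other ne i)
      ... | sx , j = j , sx

      old-T : ∀ {b} → b ∉ S′ → b ≢ x → b ∉ S × b ≢ β
      old-T o ne with ⊞-out-inv o
      ... | bβ , o′ with ⊟-out-inv o′
      ...   | inj₁ e = contradiction e ne
      ...   | inj₂ u = u , bβ

      β-colour : ∀ {p s b} → Face p → s ∈ S′ → s ≢ β → b ∉ S′ → β ∈ p → s ∈ p → b ∈ p → colour′ s b ≡ true
      β-colour {s = s} {b} f i ne o βp sp bp = lem (b ≟ x)
        where
        iS : s ∈ S
        iS = proj₁ (old-S i ne)
        sx : s ≢ x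
        sx = proj₂ (old-S i ne)
        lem : Dec (b ≡ x) → colour′ s b ≡ true
        -- No face contains `s`, `β` and `x`, because its edges to `β` would have different colours.
        lem (yes refl) = true≢false (trans (sym (colour-S f iS x∈S β∉S sp bp βp)) (colour-β iS sx)) colour-xβ
        lem (no bx) = trans (colour′-old ne bx) (trans (colour-T f iS (proj₁ (old-T o bx)) β∉S sp bp βp) (colour-β iS sx))

      colour′-S : ∀ {p s s′ b} → Face p → s ∈ S′ → s′ ∈ S′ → b ∉ S′ → s ∈ p → s′ ∈ p → b ∈ p → colour′ s b ≡ colour′ s′ b
      colour′-S {s = s} {s′} {b} f i i′ o sp sp′ bp = lem (s ≟ β) (s′ ≟ β) (b ≟ x)
        where
        lem : Dec (s ≡ β) → Dec (s′ ≡ β) → Dec (b ≡ x) → colour′ s b ≡ colour′ s′ b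
        lem (yes refl) (yes refl) _ = refl
        lem (yes refl) (no ne′) _ = trans (colour′-β b) (sym (β-colour f i′ ne′ o sp sp′ bp))
        lem (no ne) (yes refl) _ = trans (β-colour f i ne o sp′ sp bp) (sym (colour′-β b))
        lem (no ne) (no ne′) (yes refl) = trans (colour′-x ne) (sym (colour′-x ne′))
        lem (no ne) (no ne′) (no bx) = trans (colour′-old ne bx)
          (trans (colour-S f (proj₁ (old-S i ne)) (proj₁ (old-S i′ ne′)) (proj₁ (old-T o bx)) sp sp′ bp) (sym (colour′-old ne′ bx)))

      colour′-T-x : ∀ {p s b} → Face p → s ∈ S′ → s ≢ β → b ∉ S′ → b ≢ x → s ∈ p → x ∈ p → b ∈ p → colour s b ≡ false
      colour′-T-x f i ne o bx sp xp bp = trans (colour-S f (proj₁ (old-S i ne)) x∈S bo sp xp bp) (colour-x bo)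
        where bo = proj₁ (old-T o bx)

      colour′-T : ∀ {p s b b′} → Face p → s ∈ S′ → b ∉ S′ → b′ ∉ S′ → s ∈ p → b ∈ p → b′ ∈ p → colour′ s b ≡ colour′ s b′
      colour′-T {s = s} {b} {b′} f i o o′ sp bp bp′ = lem (s ≟ β) (b ≟ x) (b′ ≟ x)
        where
        lem : Dec (s ≡ β) → Dec (b ≡ x) → Dec (b′ ≡ x) → colour′ s b ≡ colour′ s b′
        lem (yes refl) _ _ = trans (colour′-β b) (sym (colour′-β b′))
        lem (no ne) (yes refl) (yes refl) = refl
        lem (no ne) (yes refl) (no bx′) =
          trans (colour′-x ne) (sym (trans (colour′-old ne bx′) (colour′-T-x f i ne o′ bx′ sp bp bp′)))
        lem (no ne) (no bx) (yes refl) =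
          trans (trans (colour′-old ne bx) (colour′-T-x f i ne o bx sp bp′ bp)) (sym (colour′-x ne))
        lem (no ne) (no bx) (no bx′) = trans (colour′-old ne bx)
          (trans (colour-T f (proj₁ (old-S i ne)) (proj₁ (old-T o bx)) (proj₁ (old-T o′ bx′)) sp bp bp′) (sym (colour′-old ne bx′)))

      T′≡ : ∁ S′ ≡ ∁ S ⊟ β ⊞ x
      T′≡ = ⊑-antisym to from
        where
        to : ∁ S′ ⊑ ∁ S ⊟ β ⊞ x
        to y i with y ≟ x
        ... | yes refl = ⊞-new
        ... | no yx with old-T (∁-in-inv i) yx
        ...   | yS , yβ = ⊞-old (⊟-keep yβ (∁-in yS))
        from : ∁ S ⊟ β ⊞ x ⊑ ∁ S′
        from y i with ⊞-inv i
        ... | inj₁ refl = ∁-in (⊞-out x≢β ⊟-gone)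
        ... | inj₂ j = ∁-in (⊞-out (proj₁ (⊟-inv j)) (⊟-out (∁-in-inv (⊟-sub y j))))

      -- `∁ S ⊟ β ⊞ x` is the one simplex that `sole-cone` does not provide; with it the cone from
      -- `x` over ∂T would be complete.
      missing′ : ¬ Face (∁ S′)
      missing′ f = no-cone x∈S cone
        where
        cone : ∀ t → t ∉ S → Face (∁ S ⊟ t ⊞ x)
        cone t to with t ≟ β
        ... | no ne    = proj₁ (sole-cone β∉S sole to ne)
        ... | yes refl = subst Face T′≡ f

      x∉S′ : x ∉ S′
      x∉S′ = ⊞-out x≢β ⊟-gone

      -- `∁ S′ ⊟ x` is the old ridge `∁ S ⊟ β`, so the old apices serve again; none of them is `x`,
      -- because the new T is missing.
      both-sides′-x : ∀ col → ∃ λ a → a ∈ S′ × Face (∁ S′ ⊟ x ⊞ a) × (∀ t → t ∉ S′ → t ≢ x → colour′ a t ≡ col)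
      both-sides′-x col with both-sides β col β∉S
      ... | a , ai , f , h = a , ⊞-old (⊟-keep ax ai) , subst Face (sym T⊟) f , h′
        where
        T⊟ : ∁ S′ ⊟ x ⊞ a ≡ ∁ S ⊟ β ⊞ a
        T⊟ = cong (_⊞ a) (trans (cong (_⊟ x) T′≡) (⊞⊟ (⊟-out (∁-out x∈S))))
        ax : a ≢ x
        ax refl = missing′ (subst Face (sym T′≡) f)
        h′ : ∀ t → t ∉ S′ → t ≢ x → colour′ a t ≡ col
        h′ t o tx with old-T o tx
        ... | tS , tβ = trans (colour′-old (in≢out ai β∉S) tx) (h t tS tβ)

      β-face : ∀ {t} → t ∉ S → t ≢ x → t ≢ β → Face (∁ S′ ⊟ t ⊞ β)
      β-face {t} tS tx tβ = subst Face (sym eq) (proj₁ (sole-cone β∉S sole tS tβ))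
        where
        eq : ∁ S′ ⊟ t ⊞ β ≡ ∁ S ⊟ t ⊞ x
        eq = trans (cong (λ w → w ⊟ t ⊞ β) T′≡) (trans (⊟⊞-comm (∁ S ⊟ β ⊞ x) tβ) (trans (cong (_⊟ t) (trans (⊞-comm (∁ S ⊟ β) x β)
               (cong (_⊞ x) (⊟⊞ (∁-in β∉S))))) (sym (⊟⊞-comm (∁ S) tx))))

      -- One facet over `∁ S′ ⊟ t` is the old cone simplex `∁ S ⊟ t ⊞ x`, now with apex `β` and
      -- colour `true`. The second facet also contains `x`, which sees only `false` in T.
      both-sides′-T : ∀ t col → t ∉ S′ → t ≢ x → ∃ λ a → a ∈ S′ × Face (∁ S′ ⊟ t ⊞ a) × (∀ u → u ∉ S′ → u ≢ t → colour′ a u ≡ col)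
      both-sides′-T t true to tx with old-T to tx
      ... | tS , tβ = β , ⊞-new , β-face tS tx tβ , λ u _ _ → colour′-β u
      both-sides′-T t false to tx with old-T to tx
      ... | tS , tβ with two {∁ S′ ⊟ t} {β} sizeρ (⊟-out (∁-out ⊞-new)) (β-face tS tx tβ)
        where
        sizeρ : suc ∣ ∁ S′ ⊟ t ∣ ≡ n
        sizeρ = trans (size-⊟ (∁-in to)) (trans (cong ∣_∣ T′≡) (size-T⊟⊞ β∉S x∈S))
      ...   | z , zβ , zo , fz , _ = z , z∈S′ , fz , col
        where
        z≢t : z ≢ t
        z≢t refl = missing′ (subst Face (⊟⊞ (∁-in to)) fz)
        z∈S′ : z ∈ S′
        z∈S′ with in? z S′
        ... | inj₁ i = i
        ... | inj₂ o = in∧out (⊟-keep z≢t (∁-in o)) zo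
        col : ∀ u → u ∉ S′ → u ≢ t → colour′ z u ≡ false
        col u uo ut = lem (u ≟ x)
          where
          lem : Dec (u ≡ x) → colour′ z u ≡ false
          lem (yes refl) = colour′-x zβ
          lem (no ux) = trans (colour′-old zβ ux) (colour′-T-x fz z∈S′ zβ uo ux ⊞-new
                          (⊞-old (⊟-keep (tx ∘ sym) (∁-in x∉S′))) (⊞-old (⊟-keep ut (∁-in uo))))

      face′ : ∀ {z} → z ∈ S → Face (S ⊟ x ⊟ z ⊞ β) → Face (S′ ⊟ z)
      face′ i = subst Face (⊟⊞-comm (S ⊟ x) (in≢out i β∉S))

    next : Split n Δ
    next = record
      { S = S′ ; colour = colour′
      ; size-S = trans (size-⊞ (⊟-out β∉S)) (cong suc (size-S⊟ x∈S))
      ; size-T = trans (cong ∣_∣ T′≡) (size-T⊟⊞ β∉S x∈S)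
      ; colour-S = colour′-S ; colour-T = colour′-T
      ; both-sides = λ t col to → both t col to (t ≟ x)
      ; missing = missing′
      ; s₀ = z ; s₁ = w ; s₀≢s₁ = z≢w
      ; s₀∈S = ⊞-old (⊟-keep z≢a z∈S) ; s₁∈S = ⊞-old (⊟-keep w≢a w∈S)
      ; face₀ = face′ z∈S face-z ; face₁ = face′ w∈S face-w }
      where
      open Advance.Doubled twice
      both : ∀ t col → t ∉ S′ → Dec (t ≡ x) → ∃ λ a → a ∈ S′ × Face (∁ S′ ⊟ t ⊞ a) × (∀ u → u ∉ S′ → u ≢ t → colour′ a u ≡ col)
      both t col to (yes refl) = both-sides′-x col
      both t col to (no tx)    = both-sides′-T t col to tx

  module Interior {m n : ℕ} {Δ : Subset m → Bool} (pm : IsPM n Δ) (n≥5 : 5 ≤ n) (sp : Split n Δ)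
              (ex : Advance.Exit pm n≥5 sp) where
    open IsPM pm
    open Split sp
    open Cut pm n≥5 sp
    open Advance pm n≥5 sp using (Exit; A-unique)
    open Exit ex
    private
      module Other  = Cut pm n≥5 (swap-colours sp)
      module OtherA = Advance pm n≥5 (swap-colours sp)

    private
      -- If `S ⊟ y` is no face, a facet sticks out of S over `S ⊟ s₀ ⊟ y`. The cut of the first
      -- colour isolates only `x`, so this facet has the other colour and puts `y` on the shore of
      -- the other cut.
      other-A : ∀ {y} → y ∈ S → y ≢ x → ¬ Face (S ⊟ y) → Other.A y ≡ true
      other-A {y} yi yx nf with outer yi y≢s₀ nf | avoid-S (s₀ ∷ y ∷ []) (s≤s (s≤s (s≤s z≤n)))
        where
        y≢s₀ : y ≢ s₀
        y≢s₀ refl = nf face₀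
      ... | b , bo , fb | s , si , ss₀ ∷ sy ∷ [] =
        trans (Other.A-outer yi y≢s₀ bo fb s∈) (cong not (trans (sym (A-outer yi y≢s₀ bo fb s∈))
          (not-true λ Ay → yx (A-unique yi x∈S Ay A-x))))
        where
        y≢s₀ : y ≢ s₀
        y≢s₀ refl = nf face₀
        s∈ : s ∈ S ⊟ s₀ ⊟ y
        s∈ = ⊟-keep sy (⊟-keep ss₀ si)

    -- The cut of the other colour isolates a single vertex too. Hence at least n - 1 of the n + 1
    -- sets `S ⊟ y` are facets, as many as an interval of n + 1 vertices contains in M^n.
    nonface-unique : ∀ {y z} → y ∈ S → z ∈ S → y ≢ x → z ≢ x → ¬ Face (S ⊟ y) → ¬ Face (S ⊟ z) → y ≡ z
    nonface-unique yi zi yx zx ny nz = OtherA.A-unique yi zi (other-A yi yx ny) (other-A zi zx nz)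

open Exchanges

-- The exchanges as a queue, and the cyclic order they trace.

module Traces where
  open import Data.Nat using (_+_)

  -- The exchanges indexed by time, reduced to what determines the order of the vertices; Δ enters
  -- only through the last two fields.
  record Trace {m : ℕ} (n : ℕ) (Δ : Subset m → Bool) : Set where
    field
      S : ℕ → Subset m
      colour : ℕ → Fin m → Fin m → Bool
      x β : ℕ → Fin m
      size-S : ∀ i → ∣ S i ∣ ≡ suc n
      x∈S : ∀ i → x i ∈ S i
      β∉S : ∀ i → β i ∉ S i
      S-suc : ∀ i → S (suc i) ≡ S i ⊟ x i ⊞ β i
      colour-β : ∀ i b → colour (suc i) (β i) b ≡ true
      colour-x′ : ∀ i {s} → s ≢ β i → colour (suc i) s (x i) ≡ false
      colour-old : ∀ i {s b} → s ≢ β i → b ≢ x i → colour (suc i) s b ≡ colour i s b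
      colour-x : ∀ i {b} → b ∉ S i → colour i (x i) b ≡ false
      sole : ∀ i s → s ∈ S i → colour i s (β i) ≡ false → s ≡ x i
      sole-unique : ∀ i {b a} → b ∉ S i → (∀ s → s ∈ S i → colour i s b ≡ false → s ≡ a) → b ≡ β i
      x-nonface : ∀ i → ¬ IsFace Δ (S i ⊟ x i)
      nonface-unique : ∀ i {y z} → y ∈ S i → z ∈ S i → y ≢ x i → z ≢ x i →
        ¬ IsFace Δ (S i ⊟ y) → ¬ IsFace Δ (S i ⊟ z) → y ≡ z

  trace : ∀ {m n} {Δ : Subset m → Bool} → IsPM n Δ → 5 ≤ n → Split n Δ → Trace n Δ
  trace {m} {n} {Δ} pm n≥5 sp = record
    { S = λ i → Split.S (st i) ; colour = λ i → Split.colour (st i)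
    ; x = λ i → Advance.Exit.x (ex i) ; β = λ i → Advance.Exit.β (ex i)
    ; size-S = λ i → Split.size-S (st i)
    ; x∈S = λ i → Advance.Exit.x∈S (ex i) ; β∉S = λ i → Advance.Exit.β∉S (ex i)
    ; S-suc = λ i → refl
    ; colour-β = λ i → Next.colour′-β pm n≥5 (st i) (ex i)
    ; colour-x′ = λ i → Next.colour′-x pm n≥5 (st i) (ex i)
    ; colour-old = λ i → Next.colour′-old pm n≥5 (st i) (ex i)
    ; colour-x = λ i → Next.colour-x pm n≥5 (st i) (ex i)
    ; sole = λ i → Advance.Exit.sole (ex i)
    ; sole-unique = λ i bo so → proj₁ (Cut.sole-unique pm n≥5 (st i) bo (Advance.Exit.β∉S (ex i)) so (Advance.Exit.sole (ex i)))
    ; x-nonface = λ i → Next.x-nonface pm n≥5 (st i) (ex i)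
    ; nonface-unique = λ i → Interior.nonface-unique pm n≥5 (st i) (ex i)
    }
    where
    ex′ : (sp : Split n Δ) → Advance.Exit pm n≥5 sp
    ex′ sp = Advance.exit pm n≥5 sp
    st : ℕ → Split n Δ
    st zero    = sp
    st (suc i) = Next.next pm n≥5 (st i) (ex′ (st i))
    ex : ∀ i → Advance.Exit pm n≥5 (st i)
    ex i = ex′ (st i)

  -- Kühnel's labelling as a periodic sequence over ℕ, so that intervals need no case distinction
  -- where they wrap around.
  record Cyclic {m : ℕ} (n : ℕ) (Δ : Subset m → Bool) : Set where
    field
      x : ℕ → Fin m
      period : ∀ i → x (suc (n + n) + i) ≡ x i
      distinct : ∀ i d → 1 ≤ d → d ≤ n + n → x i ≢ x (d + i)
      window : ∀ i j → 1 ≤ j → j < n → ∃ λ W → IsFacet n Δ W ×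
        (∀ t → t ≤ n → t ≢ j → x (t + i) ∈ W) × (∀ s → s ∈ W → ∃ λ t → t ≤ n × t ≢ j × s ≡ x (t + i))

  module FIFO {m n′ : ℕ} {Δ : Subset m → Bool} (tr : Trace (suc n′) Δ) (nonface? : ∀ p → Dec (IsFace Δ p)) where
    open Trace tr
    private
      n : ℕ
      n = suc n′
      V : Set
      V = Fin m

    -- For a vertex `b` waiting in T, this set is a countdown to its return to S.
    Opp : ℕ → V → Subset m
    Opp j b = tabulate (λ s → lookup (S j) s ∧ not (colour j s b))

    Opp-in : ∀ {j b s} → s ∈ S j → colour j s b ≡ false → s ∈ Opp j b
    Opp-in {j} {b} {s} i e = mk∈ (trans (lookup∘tabulate _ s) (cong₂ (λ u v → u ∧ not v) (at i) e))

    Opp-inv : ∀ {j b s} → s ∈ Opp j b → s ∈ S j × colour j s b ≡ false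
    Opp-inv {j} {b} {s} i with split (lookup (S j) s) (colour j s b) (trans (sym (lookup∘tabulate _ s)) (at i))
      where
      split : ∀ u v → u ∧ not v ≡ true → u ≡ true × v ≡ false
      split true false _ = refl , refl
    ... | p , q = mk∈ p , q

    S-suc-inv : ∀ {i s} → s ∈ S (suc i) → s ≢ β i → s ≢ x i × s ∈ S i
    S-suc-inv {i} {s} h ne = ⊟-inv (⊞-other ne (subst (s ∈_) (S-suc i) h))

    S-suc-in : ∀ {i s} → s ∈ S i → s ≢ x i → s ∈ S (suc i)
    S-suc-in {i} {s} h ne = subst (s ∈_) (sym (S-suc i)) (⊞-old (⊟-keep ne h))

    x∉S-suc : ∀ i → x i ∉ S (suc i)
    x∉S-suc i = subst (x i ∉_) (sym (S-suc i)) (⊞-out (in≢out (x∈S i) (β∉S i)) ⊟-gone)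

    Opp-start : ∀ i → Opp (suc i) (x i) ≡ S i ⊟ x i
    Opp-start i = ⊑-antisym to from
      where
      to : Opp (suc i) (x i) ⊑ S i ⊟ x i
      to s h with Opp-inv h
      ... | sS , e with s ≟ β i
      ...   | yes refl = true≢false (colour-β i (x i)) e
      ...   | no ne with S-suc-inv sS ne
      ...     | sx , k = ⊟-keep sx k
      from : S i ⊟ x i ⊑ Opp (suc i) (x i)
      from s h with ⊟-inv h
      ... | sx , k = Opp-in (S-suc-in k sx) (colour-x′ i (in≢out k (β∉S i)))

    x∈Opp : ∀ {j b} → b ∉ S j → x j ∈ Opp j b
    x∈Opp {j} bo = Opp-in (x∈S j) (colour-x j bo)

    -- The leaving vertex sees every vertex of T as `false` and drops out; the entering vertex sees
    -- everything as `true` and is never added.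
    Opp-step : ∀ {j b} → b ∉ S j → b ≢ β j → b ∉ S (suc j) × Opp (suc j) b ≡ Opp j b ⊟ x j
    Opp-step {j} {b} bo ne = subst (b ∉_) (sym (S-suc j)) (⊞-out ne (⊟-out bo)) , ⊑-antisym to from
      where
      bx : b ≢ x j
      bx refl = in∧out (x∈S j) bo
      to : Opp (suc j) b ⊑ Opp j b ⊟ x j
      to s h with Opp-inv h
      ... | sS , e with s ≟ β j
      ...   | yes refl = true≢false (colour-β j b) e
      ...   | no sβ with S-suc-inv sS sβ
      ...     | sx , k = ⊟-keep sx (Opp-in k (trans (sym (colour-old j sβ bx)) e))
      from : Opp j b ⊟ x j ⊑ Opp (suc j) b
      from s h with ⊟-inv h
      ... | sx , k with Opp-inv k
      ...   | sS , e = Opp-in (S-suc-in sS sx) (trans (colour-old j (in≢out sS (β∉S j)) bx) e)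

    -- When x i enters T it is opposite to the n other vertices of S i; every later step removes one of them,
    -- namely the leaving vertex, and x i returns to S exactly when the last one leaves.
    record Waiting (i k : ℕ) : Set where
      field
        outside : x i ∉ S (k + suc i)
        count   : k + ∣ Opp (k + suc i) (x i) ∣ ≡ n
        below   : Opp (k + suc i) (x i) ⊑ S i ⊟ x i
        covered : ∀ s → s ∈ S i ⊟ x i → s ∈ Opp (k + suc i) (x i) ⊎ (∃ λ t → t < k × s ≡ x (t + suc i))

    waiting : ∀ i k → k ≤ n′ → Waiting i k
    waiting i zero h = record
      { outside = x∉S-suc i
      ; count = trans (cong ∣_∣ (Opp-start i)) (ℕP.suc-injective (trans (size-⊟ (x∈S i)) (size-S i)))
      ; below = λ s k → subst (s ∈_) (Opp-start i) k
      ; covered = λ s k → inj₁ (subst (s ∈_) (sym (Opp-start i)) k) }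
    waiting i (suc k) h = record
      { outside = proj₁ step
      ; count = trans (sym (ℕP.+-suc k _)) (trans (cong (λ p → k + suc ∣ p ∣) (proj₂ step)) (trans (cong (k +_) (size-⊟ (x∈Opp W.outside))) W.count))
      ; below = λ s l → W.below s (⊟-sub s (subst (s ∈_) (proj₂ step) l))
      ; covered = cov }
      where
      module W = Waiting (waiting i k (ℕP.<⇒≤ h))
      j : ℕ
      j = k + suc i
      two≤ : 2 ≤ ∣ Opp j (x i) ∣
      two≤ = ℕP.+-cancelˡ-≤ k _ _ (subst (k + 2 ≤_) (sym W.count) (subst (_≤ n) (ℕP.+-comm 2 k) (s≤s h)))
      -- Two opposite vertices are left, whereas `β j` has only one, so it is not yet the turn of
      -- `x i`.
      not-β : x i ≢ β j
      not-β e with avoid (x j ∷ []) (Opp j (x i)) two≤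
      ... | s , si , sx ∷ [] with Opp-inv si
      ...   | sS , c = sx (sole j s sS (trans (cong (colour j s) (sym e)) c))
      step : x i ∉ S (suc j) × Opp (suc j) (x i) ≡ Opp j (x i) ⊟ x j
      step = Opp-step W.outside not-β
      cov : ∀ s → s ∈ S i ⊟ x i → s ∈ Opp (suc j) (x i) ⊎ (∃ λ t → t < suc k × s ≡ x (t + suc i))
      cov s h with W.covered s h
      ... | inj₂ (t , t<k , e) = inj₂ (t , ℕP.m<n⇒m<1+n t<k , e)
      ... | inj₁ o with s ≟ x j
      ...   | yes e = inj₂ (k , ℕP.≤-refl , e)
      ...   | no ne = inj₁ (subst (s ∈_) (sym (proj₂ step)) (⊟-keep ne o))

    private
      last-sole : ∀ i s → s ∈ Opp (n′ + suc i) (x i) → s ≡ x (n′ + suc i)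
      last-sole i s si with s ≟ x (n′ + suc i)
      ... | yes e = e
      ... | no ne = contradiction (nonempty (⊟-keep ne si)) (ℕP.<⇒≱ (s≤s (ℕP.≤-reflexive
          (ℕP.suc-injective (trans (size-⊟ (x∈Opp W.outside)) (ℕP.+-cancelˡ-≡ n′ _ _ (trans W.count (ℕP.+-comm 1 n′))))))))
        where module W = Waiting (waiting i n′ ℕP.≤-refl)

    -- After n - 1 removals a single opposite vertex is left. It makes `x i` a vertex with a sole
    -- neighbour, and `sole-unique` allows only one such vertex in T.
    return : ∀ i → x i ≡ β (n′ + suc i)
    return i = sole-unique (n′ + suc i) W.outside λ s sS c → last-sole i s (Opp-in sS c)
      where module W = Waiting (waiting i n′ ℕP.≤-refl)

    -- While `x i` waits, the other vertices of `S i` leave one by one; the one still opposite at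
    -- its return is the last of them.
    S-inv : ∀ i s → s ∈ S i → ∃ λ t → t ≤ n × s ≡ x (t + i)
    S-inv i s h with s ≟ x i
    ... | yes e = 0 , z≤n , e
    ... | no ne with Waiting.covered (waiting i n′ ℕP.≤-refl) s (⊟-keep ne h)
    ...   | inj₁ o = suc n′ , ℕP.≤-refl , trans (last-sole i s o) (cong x (ℕP.+-suc n′ i))
    ...   | inj₂ (t , t<n′ , e) = suc t , ℕP.m≤n⇒m≤1+n t<n′ , trans e (cong x (ℕP.+-suc t i))

    S-in : ∀ i t → t ≤ n → x (t + i) ∈ S i
    S-in i zero    h = x∈S i
    S-in i (suc t) h = subst (λ j → x j ∈ S i) (ℕP.+-suc t i) (⊟-sub _ (W.below _ (x∈Opp W.outside)))
      where module W = Waiting (waiting i t (s≤s⁻¹ h))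

    distinct-short : ∀ i d → 1 ≤ d → d ≤ n → x i ≢ x (d + i)
    distinct-short i (suc d) _ h e = in∧out (x∈S (d + suc i))
      (subst (_∉ S (d + suc i)) (trans e (cong x (sym (ℕP.+-suc d i)))) (Waiting.outside (waiting i d (s≤s⁻¹ h))))

    β-window : ∀ i s → s ∈ S (suc i) → s ∉ S i → s ≡ x (n + suc i)
    β-window i s h o with S-inv (suc i) s h
    ... | t , t≤n , refl with ℕP.m≤n⇒m<n∨m≡n t≤n
    ...   | inj₂ refl = refl
    ...   | inj₁ t<n  = in∧out (subst (_∈ S i) (cong x (sym (ℕP.+-suc t i))) (S-in i (suc t) t<n)) o

    β-x : ∀ i → β i ≡ x (n + suc i)
    β-x i = β-window i (β i) (subst (β i ∈_) (sym (S-suc i)) ⊞-new) (β∉S i)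

    -- A vertex stays n steps in T by `return` and n + 1 steps in S by `β-x`.
    period : ∀ i → x (suc (n + n) + i) ≡ x i
    period i = sym (trans (return i) (trans (β-x (n′ + suc i)) (cong x idx)))
      where
      idx : n + suc (n′ + suc i) ≡ suc (n + n) + i
      idx = trans (ℕP.+-suc n _) (cong suc (trans (cong (n +_) (ℕP.+-suc n′ i)) (sym (ℕP.+-assoc n n i))))

    -- For `d` beyond n, go round the other way: the remaining distance `suc (n + n) ∸ d` is at most
    -- n.
    distinct : ∀ i d → 1 ≤ d → d ≤ n + n → x i ≢ x (d + i)
    distinct i d 1≤d d≤2n e with ℕP.≤-total d n
    ... | inj₁ d≤n = distinct-short i d 1≤d d≤n e
    ... | inj₂ n≤d = distinct-short (d + i) e′ (ℕP.m<n⇒0<n∸m (s≤s d≤2n))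
          (subst (suc (n + n) ∸ d ≤_) (ℕP.m+n∸n≡m n (suc n)) (subst (λ w → w ∸ d ≤ n + suc n ∸ suc n) (ℕP.+-suc n n) lem))
          (trans (sym e) (trans (sym (period i)) (cong x idx)))
      where
      e′ : ℕ
      e′ = suc (n + n) ∸ d
      n<d : suc n ≤ d
      n<d with ℕP.m≤n⇒m<n∨m≡n n≤d
      ... | inj₁ h = h
      ... | inj₂ refl = contradiction e (distinct-short i n 1≤d ℕP.≤-refl)
      lem : n + suc n ∸ d ≤ n + suc n ∸ suc n
      lem = ℕP.∸-monoʳ-≤ (n + suc n) n<d
      idx : suc (n + n) + i ≡ e′ + (d + i)
      idx = trans (cong (_+ i) (sym (ℕP.m∸n+n≡m (ℕP.m≤n⇒m≤1+n d≤2n)))) (ℕP.+-assoc e′ d i)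

    private
      distinct-in : ∀ i {s t} → s ≤ n → t ≤ n → s ≢ t → x (s + i) ≢ x (t + i)
      distinct-in i {s} {t} s≤ t≤ ne e with ℕP.<-cmp s t
      ... | tri≈ _ p _ = ne p
      ... | tri< p _ _ = distinct-short (s + i) (t ∸ s) (ℕP.m<n⇒0<n∸m p) (ℕP.≤-trans (ℕP.m∸n≤m t s) t≤)
            (trans e (cong x (trans (cong (_+ i) (sym (ℕP.m∸n+n≡m (ℕP.<⇒≤ p)))) (ℕP.+-assoc (t ∸ s) s i))))
      ... | tri> _ _ p = distinct-short (t + i) (s ∸ t) (ℕP.m<n⇒0<n∸m p) (ℕP.≤-trans (ℕP.m∸n≤m s t) s≤)
            (trans (sym e) (cong x (trans (cong (_+ i) (sym (ℕP.m∸n+n≡m (ℕP.<⇒≤ p)))) (ℕP.+-assoc (s ∸ t) t i))))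

      -- Two sets `S (suc i) ⊟ y` are known to be no faces: the one omitting `x (suc i)`, and the
      -- one omitting the newest vertex `β i`, which is `S i ⊟ x i` again. By `nonface-unique` there
      -- is no third.
      window-suc : ∀ i j → 1 ≤ j → j < n → IsFace Δ (S (suc i) ⊟ x (j + suc i))
      window-suc i j 1≤j j<n with nonface? (S (suc i) ⊟ x (j + suc i))
      ... | yes f = f
      ... | no nf = contradiction
        (nonface-unique (suc i) (S-in (suc i) j (ℕP.<⇒≤ j<n)) (S-in (suc i) n ℕP.≤-refl)
          (distinct-in (suc i) {j} {0} (ℕP.<⇒≤ j<n) z≤n (λ { refl → contradiction 1≤j λ () }))
          (distinct-in (suc i) {n} {0} ℕP.≤-refl z≤n (λ ()))
          nf (λ f → x-nonface i (subst (IsFace Δ) eq f)))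
        (distinct-in (suc i) (ℕP.<⇒≤ j<n) ℕP.≤-refl (ℕP.<⇒≢ j<n))
        where
        eq : S (suc i) ⊟ x (n + suc i) ≡ S i ⊟ x i
        eq = trans (cong₂ _⊟_ (S-suc i) (sym (β-x i))) (⊞⊟ (⊟-out (β∉S i)))

      shift : ∀ t i → x (t + suc (n + n + i)) ≡ x (t + i)
      shift t i = trans (cong x (trans (ℕP.+-suc t _) (cong suc (trans (sym (ℕP.+-assoc t (n + n) i))
          (trans (cong (_+ i) (ℕP.+-comm t (n + n))) (ℕP.+-assoc (n + n) t i)))))) (period (t + i))

    cyclic : Cyclic n Δ
    cyclic = record { x = x ; period = period ; distinct = distinct ; window = win }
      where
      win : ∀ i j → 1 ≤ j → j < n → ∃ λ W → IsFacet n Δ W ×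
        (∀ t → t ≤ n → t ≢ j → x (t + i) ∈ W) × (∀ s → s ∈ W → ∃ λ t → t ≤ n × t ≢ j × s ≡ x (t + i))
      win i j 1≤j j<n = S I ⊟ x (j + I) ,
        (window-suc (n + n + i) j 1≤j j<n , ℕP.suc-injective (trans (size-⊟ (S-in I j (ℕP.<⇒≤ j<n))) (size-S I))) , to , from
        where
        -- `window-suc` needs a preceding exchange, so the interval at time `i` is replaced by the
        -- same interval one full period later.
        I : ℕ
        I = suc (n + n + i)
        to : ∀ t → t ≤ n → t ≢ j → x (t + i) ∈ S I ⊟ x (j + I)
        to t t≤ ne = subst (_∈ S I ⊟ x (j + I)) (shift t i)
          (⊟-keep (distinct-in I t≤ (ℕP.<⇒≤ j<n) ne) (S-in I t t≤))
        from : ∀ s → s ∈ S I ⊟ x (j + I) → ∃ λ t → t ≤ n × t ≢ j × s ≡ x (t + i)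
        from s h with ⊟-inv h
        ... | sx , k with S-inv I s k
        ...   | t , t≤ , e = t , t≤ , (λ { refl → sx e }) , trans e (shift t i)

open Traces

-- From a cyclic order to the isomorphism with M^n.

module CyclicOrders where
  open import Data.Nat using (_+_; _*_)

  injective⇒inverse : ∀ {k} (v : Fin (suc k) → Fin (suc k)) → (∀ i j → v i ≡ v j → i ≡ j) → ∀ y → ∃ λ i → v i ≡ y
  injective⇒inverse {k} v inj y with any? (λ i → v i ≟ y)
  ... | yes r = r
  ... | no none with FinP.pigeonhole ℕP.≤-refl (λ i → punchOut {i = y} {j = v i} (λ e → none (i , sym e)))
  ...   | i , j , i<j , e = contradiction (inj i j (punchOut-injective {i = y} (λ e → none (i , sym e)) (λ e → none (j , sym e)) e)) (FinP.<⇒≢ i<j)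

  module Cycle {n : ℕ} {Δ : Subset (suc (n + n)) → Bool} (cyc : Cyclic n Δ) where
    open Cyclic cyc
    private
      N : ℕ
      N = suc (n + n)

    x-multiple : ∀ k a → x (a + k * N) ≡ x a
    x-multiple zero    a = cong x (ℕP.+-identityʳ a)
    x-multiple (suc k) a = trans (cong x (trans (sym (ℕP.+-assoc a N (k * N))) (trans (cong (_+ k * N) (ℕP.+-comm a N)) (ℕP.+-assoc N a (k * N)))))
      (trans (period (a + k * N)) (x-multiple k a))

    x-mod : ∀ a → x (a % N) ≡ x a
    x-mod a = trans (sym (x-multiple (a / N) (a % N))) (cong x (sym (m≡m%n+[m/n]*n a N)))

    x-shift : ∀ t s → x (t + s % N) ≡ x (t + s)
    x-shift t s = trans (sym (x-multiple (s / N) (t + s % N))) (cong x (trans (ℕP.+-assoc t _ _) (cong (t +_) (sym (m≡m%n+[m/n]*n s N)))))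

    distinct-upto : ∀ {a b} s → a ≤ n + n → b ≤ n + n → x (a + s) ≡ x (b + s) → a ≡ b
    distinct-upto {a} {b} s a≤ b≤ e with ℕP.<-cmp a b
    ... | tri≈ _ p _ = p
    ... | tri< p _ _ = contradiction (trans e (cong x (trans (cong (_+ s) (sym (ℕP.m∸n+n≡m (ℕP.<⇒≤ p)))) (ℕP.+-assoc (b ∸ a) a s))))
                         (distinct (a + s) (b ∸ a) (ℕP.m<n⇒0<n∸m p) (ℕP.≤-trans (ℕP.m∸n≤m b a) b≤))
    ... | tri> _ _ p = contradiction (trans (sym e) (cong x (trans (cong (_+ s) (sym (ℕP.m∸n+n≡m (ℕP.<⇒≤ p)))) (ℕP.+-assoc (a ∸ b) b s))))
                         (distinct (b + s) (a ∸ b) (ℕP.m<n⇒0<n∸m p) (ℕP.≤-trans (ℕP.m∸n≤m a b) a≤))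

    x-injective : ∀ a b → x a ≡ x b → a % N ≡ b % N
    x-injective a b e = distinct-upto 0 (s≤s⁻¹ (m%n<n a N)) (s≤s⁻¹ (m%n<n b N))
      (trans (cong x (ℕP.+-identityʳ _)) (trans (x-mod a) (trans e (trans (sym (x-mod b)) (cong x (sym (ℕP.+-identityʳ _)))))))

    v : Fin N → Fin N
    v k = x (toℕ k)

    v-injective : ∀ i j → v i ≡ v j → i ≡ j
    v-injective i j e = toℕ-injective (trans (sym (m<n⇒m%n≡m (toℕ<n i))) (trans (x-injective (toℕ i) (toℕ j) e) (m<n⇒m%n≡m (toℕ<n j))))

    abstract
      v⁻¹ : Fin N → Fin N
      v⁻¹ y = proj₁ (injective⇒inverse v v-injective y)

      v-v⁻¹ : ∀ y → v (v⁻¹ y) ≡ y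
      v-v⁻¹ y = proj₂ (injective⇒inverse v v-injective y)

  module ToM {n : ℕ} {Δ : Subset (suc (n + n)) → Bool} (pm : IsPM n Δ) (n≥5 : 5 ≤ n) (cyc : Cyclic n Δ) where
    open IsPM pm
    open Cyclic cyc
    open Cycle cyc
    private
      N : ℕ
      N = suc (n + n)

    InWindow : ℕ → ℕ → Subset N → Set
    InWindow s j τ = ∀ y → y ∈ τ → ∃ λ k → k ≤ n × k ≢ j × y ≡ x (k + s)

    -- The faces of M^n carried over by `x`. All data lie in `Fin N` to make the predicate
    -- decidable; `InWindow` is the form with free indices.
    MFace : Subset N → Set
    MFace τ = ∃ λ (s : Fin N) → ∃ λ (j : Fin N) → 1 ≤ toℕ j × toℕ j < n ×
      (∀ y → y ∈ τ → ∃ λ (k : Fin N) → toℕ k ≤ n × toℕ k ≢ toℕ j × y ≡ x (toℕ k + toℕ s))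

    abstract
      MFace? : ∀ τ → Dec (MFace τ)
      MFace? τ = any? λ s → any? λ j → (1 ≤? toℕ j) ×-dec (toℕ j <? n) ×-dec (all? λ y → (y ∈? τ) →-dec
        (any? λ k → (toℕ k ≤? n) ×-dec ¬? (toℕ k ℕP.≟ toℕ j) ×-dec (y ≟ x (toℕ k + toℕ s))))

    n≤N : ∀ {k} → k ≤ n → k < N
    n≤N h = s≤s (ℕP.≤-trans h (ℕP.m≤m+n n n))

    to-MFace : ∀ {s j τ} → 1 ≤ j → j < n → InWindow s j τ → MFace τ
    to-MFace {s} {j} {τ} 1≤j j<n h = s′ , j′ , subst (1 ≤_) (sym ej) 1≤j , subst (_< n) (sym ej) j<n , lem
      where
      s′ j′ : Fin N
      s′ = fromℕ< (m%n<n s N)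
      j′ = fromℕ< (n≤N (ℕP.<⇒≤ j<n))
      ej : toℕ j′ ≡ j
      ej = toℕ-fromℕ< _
      lem : ∀ y → y ∈ τ → ∃ λ (k : Fin N) → toℕ k ≤ n × toℕ k ≢ toℕ j′ × y ≡ x (toℕ k + toℕ s′)
      lem y i with h y i
      ... | k , k≤ , kj , e = fromℕ< (n≤N k≤) , subst (_≤ n) (sym ek) k≤ , (λ q → kj (trans (sym ek) (trans q ej))) ,
              trans e (trans (sym (x-shift k s)) (cong x (cong₂ _+_ (sym ek) (sym (toℕ-fromℕ< _)))))
        where
        ek : toℕ (fromℕ< (n≤N k≤)) ≡ k
        ek = toℕ-fromℕ< _

    from-MFace : ∀ {τ} → MFace τ → ∃ λ s → ∃ λ j → 1 ≤ j × j < n × InWindow s j τ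
    from-MFace (s , j , 1≤j , j<n , h) = toℕ s , toℕ j , 1≤j , j<n , λ y i → let k , k≤ , kj , e = h y i in toℕ k , k≤ , kj , e

    MFace⇒Face : ∀ {τ} → MFace τ → Face τ
    MFace⇒Face m with from-MFace m
    ... | s , j , 1≤j , j<n , h with window s j 1≤j j<n
    ...   | W , (fW , _) , win , _ = down (λ y i → let k , k≤ , kj , e = h y i in subst (_∈ W) (sym e) (win k k≤ kj)) fW

    private
      Alternative : Subset N → Fin N → Set
      Alternative ρ a = ∃ λ a′ → a′ ∉ ρ × a′ ≢ a × MFace (ρ ⊞ a′)

      add : ∀ {s j ρ} k → InWindow s j ρ → k ≤ n → k ≢ j → InWindow s j (ρ ⊞ x (k + s))
      add k h k≤ kj y i with ⊞-inv i
      ... | inj₁ refl = k , k≤ , kj , refl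
      ... | inj₂ i′   = h y i′

      back : ∀ q k s → q ≤ n + n → x (k + (N ∸ q + s) + q) ≡ x (k + s)
      back q k s q≤ = trans (cong x eq) (period (k + s))
        where
        eq : k + (N ∸ q + s) + q ≡ N + (k + s)
        eq = begin
          k + (N ∸ q + s) + q     ≡⟨ ℕP.+-assoc k _ q ⟩
          k + (N ∸ q + s + q)     ≡⟨ cong (k +_) (trans (ℕP.+-assoc (N ∸ q) s q) (trans (cong (N ∸ q +_) (ℕP.+-comm s q)) (sym (ℕP.+-assoc (N ∸ q) q s)))) ⟩
          k + (N ∸ q + q + s)     ≡⟨ cong (λ w → k + (w + s)) (ℕP.m∸n+n≡m (ℕP.m≤n⇒m≤1+n q≤)) ⟩
          k + (N + s)             ≡⟨ trans (sym (ℕP.+-assoc k N s)) (trans (cong (_+ s) (ℕP.+-comm k N)) (ℕP.+-assoc N k s)) ⟩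
          N + (k + s)             ∎
          where open ≡-Reasoning

      -- The second facet of M^n on a ridge that omits `j` and `k` from a window. For `k` inside the
      -- window, `j` and `k` change roles. For `k` at an end, the window moves one place away from
      -- `k`, or two places if `j` is next to `k`; it gains a vertex at the far end, and after a
      -- move of two places the omitted vertex is next to it.
      alternative : ∀ {s j k ρ} → 1 ≤ j → j < n → k ≤ n → k ≢ j → x (k + s) ∉ ρ → InWindow s j ρ → Alternative ρ (x (k + s))
      alternative {s} {j} {k} {ρ} 1≤j j<n k≤ kj ao h = cases k≤ kj ao
        where
        n≤2n : ∀ {t} → t ≤ n → t ≤ n + n
        n≤2n h = ℕP.≤-trans h (ℕP.m≤m+n n n)
        2≤n : 2 ≤ n
        2≤n = ℕP.≤-trans (s≤s (s≤s z≤n)) n≥5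
        others : ∀ {k} → x (k + s) ∉ ρ → ∀ y → y ∈ ρ → ∃ λ t → t ≤ n × t ≢ j × t ≢ k × y ≡ x (t + s)
        others ao y i with h y i
        ... | t , t≤ , tj , e = t , t≤ , tj , (λ { refl → in∧out (subst (_∈ ρ) e i) ao }) , e
        fresh : ∀ {t} → t ≤ n + n → (t ≤ n → t ≡ j) → x (t + s) ∉ ρ
        fresh {t} t≤ only = not-in λ i → let u , u≤ , uj , e = h _ i ; t≡u = distinct-upto s t≤ (n≤2n u≤) e in
          uj (trans (sym t≡u) (only (subst (_≤ n) (sym t≡u) u≤)))
        too-big : ∀ {t} → n < t → t ≤ n → t ≡ j
        too-big p q = contradiction q (ℕP.<⇒≱ p)
        apart : ∀ {t k} → t ≤ n + n → k ≤ n → t ≢ k → x (t + s) ≢ x (k + s)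
        apart t≤ k≤ ne e = ne (distinct-upto s t≤ (n≤2n k≤) e)
        middle : ∀ {k} → 1 ≤ k → k < n → k ≢ j → x (k + s) ∉ ρ → Alternative ρ (x (k + s))
        middle {k} 1≤k k<n kj ao = x (j + s) , fresh (n≤2n (ℕP.<⇒≤ j<n)) (λ _ → refl) , apart (n≤2n (ℕP.<⇒≤ j<n)) (ℕP.<⇒≤ k<n) (kj ∘ sym) ,
          to-MFace 1≤k k<n (add j (λ y i → let t , t≤ , _ , tk , e = others ao y i in t , t≤ , tk , e) (ℕP.<⇒≤ j<n) (kj ∘ sym))
        first : ∀ j → j < n → 1 ≤ j → (∀ y → y ∈ ρ → ∃ λ t → t ≤ n × t ≢ j × t ≢ 0 × y ≡ x (t + s)) → Alternative ρ (x s)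
        first (suc zero) j<n _ oth = x (n + (2 + s)) ,
            subst (λ w → x w ∉ ρ) idx (fresh big (too-big (ℕP.m<n⇒m<1+n (ℕP.n<1+n n)))) ,
            (λ e → apart big z≤n (λ ()) (trans (cong x idx) e)) ,
            to-MFace {j = n ∸ 1} (ℕP.∸-monoˡ-≤ 1 2≤n) (ℕP.∸-monoʳ-< (s≤s z≤n) (ℕP.<⇒≤ 2≤n)) (add n shifted ℕP.≤-refl (ℕP.<⇒≢ (ℕP.∸-monoʳ-< (s≤s z≤n) (ℕP.<⇒≤ 2≤n)) ∘ sym))
          where
          idx : suc (suc n) + s ≡ n + (2 + s)
          idx = sym (trans (ℕP.+-suc n _) (cong suc (ℕP.+-suc n _)))
          big : suc (suc n) ≤ n + n
          big = ℕP.+-monoˡ-≤ n 2≤n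
          shifted : InWindow (2 + s) (n ∸ 1) ρ
          shifted y i with oth y i
          ... | zero , _ , _ , t0 , _ = contradiction refl t0
          ... | suc zero , _ , tj , _ , _ = contradiction refl tj
          ... | suc (suc t) , t≤ , _ , _ , e = t , ℕP.≤-trans (ℕP.m≤n⇒m≤1+n (ℕP.n≤1+n t)) t≤ , ℕP.<⇒≢ (ℕP.∸-monoˡ-≤ 1 t≤) ,
                trans e (cong x (sym (trans (ℕP.+-suc t _) (cong suc (ℕP.+-suc t _)))))
        first (suc (suc j)) j<n _ oth = x (n + (1 + s)) , subst (λ w → x w ∉ ρ) idx (fresh big (too-big ℕP.≤-refl)) ,
            (λ e → apart big z≤n (λ ()) (trans (cong x idx) e)) ,
            to-MFace {j = suc j} (s≤s z≤n) (ℕP.<-trans (ℕP.n<1+n _) j<n) (add n shifted ℕP.≤-refl (ℕP.<⇒≢ (ℕP.<-trans (ℕP.n<1+n _) j<n) ∘ sym))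
          where
          idx : suc n + s ≡ n + (1 + s)
          idx = sym (ℕP.+-suc n _)
          big : suc n ≤ n + n
          big = ℕP.+-monoˡ-≤ n (ℕP.<⇒≤ 2≤n)
          shifted : InWindow (1 + s) (suc j) ρ
          shifted y i with oth y i
          ... | zero , _ , _ , t0 , _ = contradiction refl t0
          ... | suc t , t≤ , tj , _ , e = t , ℕP.<⇒≤ t≤ , (λ p → tj (cong suc p)) , trans e (cong x (sym (ℕP.+-suc t s)))
        -- The window is moved back by q; modulo the period its new first vertex has index N - q.
        last : ∀ q j′ → 1 ≤ q → q ≤ 2 → 1 ≤ j′ → j′ < n →
          (∀ y → y ∈ ρ → ∃ λ t → q + t ≤ n × q + t ≢ j′ × y ≡ x (t + s)) → Alternative ρ (x (n + s))
        last q j′ 1≤q q≤2 1≤j′ j′<n oth = x (N ∸ q + s) , fresh big (too-big far) , apart big ℕP.≤-refl (ℕP.<⇒≢ far ∘ sym) ,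
          to-MFace {s = N ∸ q + s} 1≤j′ j′<n (add 0 moved z≤n (ℕP.<⇒≢ 1≤j′))
          where
          big : N ∸ q ≤ n + n
          big = ℕP.∸-monoʳ-≤ N 1≤q
          far : n < N ∸ q
          far = ℕP.≤-trans (ℕP.≤-trans (ℕP.+-monoʳ-≤ 1 (ℕP.≤-reflexive (sym (ℕP.m+n∸n≡m n 2)))) (lem n 2≤n)) (ℕP.∸-monoʳ-≤ N q≤2)
            where
            lem : ∀ n → 2 ≤ n → suc (n + 2 ∸ 2) ≤ suc (n + n) ∸ 2
            lem (suc (suc n)) _ = subst (_≤ suc (n + suc (suc n))) (sym (cong suc (ℕP.m+n∸n≡m (suc (suc n)) 2)))
              (s≤s (ℕP.m≤n+m (suc (suc n)) n))
            lem (suc zero) (s≤s ())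
          moved : InWindow (N ∸ q + s) j′ ρ
          moved y i with oth y i
          ... | t , qt≤ , qtj , e = q + t , qt≤ , qtj ,
            trans e (trans (sym (back q t s (ℕP.≤-trans q≤2 (n≤2n 2≤n)))) (cong x (trans (ℕP.+-comm _ q) (sym (ℕP.+-assoc q t _)))))
        final : x (n + s) ∉ ρ → Alternative ρ (x (n + s))
        final ao with ℕP.m≤n⇒m<n∨m≡n j<n
        ... | inj₁ sj<n = last 1 (suc j) ℕP.≤-refl (s≤s z≤n) (s≤s z≤n) sj<n λ y i → let t , t≤ , tj , tn , e = others ao y i in
                t , ℕP.≤∧≢⇒< t≤ tn , (λ p → tj (ℕP.suc-injective p)) , e
        ... | inj₂ sj≡n = last 2 1 (s≤s z≤n) ℕP.≤-refl ℕP.≤-refl 2≤n λ y i → let t , t≤ , tj , tn , e = others ao y i in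
                t , subst (suc t <_) sj≡n (s≤s (ℕP.≤∧≢⇒< (s≤s⁻¹ (subst (t <_) (sym sj≡n) (ℕP.≤∧≢⇒< t≤ tn))) tj)) , (λ ()) , e
        cases : ∀ {k} → k ≤ n → k ≢ j → x (k + s) ∉ ρ → Alternative ρ (x (k + s))
        cases {zero}  _  kj ao = first j j<n 1≤j (others ao)
        cases {suc k} k≤ kj ao with ℕP.m≤n⇒m<n∨m≡n k≤
        ... | inj₁ k<n  = middle (s≤s z≤n) k<n kj ao
        ... | inj₂ refl = final ao

    private
      D : Subset N → Bool
      D τ = ⌊ MFace? τ ⌋

      -- Δ has only two facets on the ridge, and `alternative` shows that both belong to M^n.
      closed : ∀ u ρ a b → u ∈ ρ → suc ∣ ρ ∣ ≡ n → a ∉ ρ → b ∉ ρ → Face (ρ ⊞ a) → Face (ρ ⊞ b) → D (ρ ⊞ a) ≡ true → D (ρ ⊞ b) ≡ true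
      closed u ρ a b _ e ao bo fa fb h with from-MFace (isYes-true {d = MFace? (ρ ⊞ a)} h)
      ... | s , j , 1≤j , j<n , win with win a ⊞-new
      ...   | k , k≤ , kj , refl with alternative 1≤j j<n k≤ kj ao (λ y i → win y (⊞-old i))
      ...     | a′ , a′o , a′a , M′ with third e ao a′o bo fa (MFace⇒Face M′) fb (a′a ∘ sym)
      ...       | inj₁ refl = h
      ...       | inj₂ refl = isYes-yes {d = MFace? (ρ ⊞ a′)} M′

    -- Every vertex `u` occurs in the cyclic order, so its star contains a facet of M^n, from which
    -- star connectivity reaches a facet above `p`. The empty face has no `u` and lies in every
    -- window.
    Face⇒MFace : ∀ {p} → Face p → MFace p
    Face⇒MFace {p} f with any? (λ u → u ∈? p)
    ... | no empty = to-MFace {s = 0} {j = 1} ℕP.≤-refl (ℕP.≤-trans (s≤s (s≤s z≤n)) n≥5) λ y i → contradiction (y , i) empty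
    ... | yes (u , ui) with facet⊇ f (nonempty ui) | window (toℕ (v⁻¹ u)) 1 ℕP.≤-refl (ℕP.≤-trans (s≤s (s≤s z≤n)) n≥5)
    ...   | τ , p⊑τ , F | W , FW , win , back′ = shrink (from-MFace (isYes-true {d = MFace? τ}
            (star-connected u D (closed u) W τ u∈W (p⊑τ u ui) FW F (isYes-yes {d = MFace? W} W-M))))
      where
      u∈W : u ∈ W
      u∈W = subst (_∈ W) (v-v⁻¹ u) (win 0 z≤n (λ ()))
      W-M : MFace W
      W-M = to-MFace ℕP.≤-refl (ℕP.≤-trans (s≤s (s≤s z≤n)) n≥5) back′
      shrink : (∃ λ s → ∃ λ j → 1 ≤ j × j < n × InWindow s j τ) → MFace p
      shrink (s , j , 1≤j , j<n , h) = to-MFace 1≤j j<n λ y i → h y (p⊑τ y i)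

    isomorphic : IsomorphicToM n (λ p → Δ p)
    isomorphic = π , λ S → to S , from S
      where
      π = mk↔ₛ′ v⁻¹ v (λ y → v-injective (v⁻¹ (v y)) y (v-v⁻¹ (v y))) v-v⁻¹
      ∈-image : ∀ {S y} → image π S [ y ]= true → v y ∈ S
      ∈-image {S} {y} i = mk∈ (trans (sym (lookup∘tabulate (λ y → lookup S (v y)) y)) ([]=⇒lookup i))
      image-∈ : ∀ {S y} → v y ∈ S → image π S [ y ]= true
      image-∈ {S} {y} i = lookup⇒[]= y (image π S) (trans (lookup∘tabulate (λ y → lookup S (v y)) y) (at i))
      T⇒ : ∀ {b} → T b → b ≡ true
      T⇒ {true} _ = refl
      ⇒T : ∀ {b} → b ≡ true → T b
      ⇒T refl = _
      to : ∀ S → T (Δ S) → IsFaceOfM n (image π S)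
      to S t with Face⇒MFace (T⇒ t)
      ... | s , j , 1≤j , j<n , h = s , toℕ j , 1≤j , ℕP.∸-monoˡ-≤ 1 j<n , λ y i → lem y (h (v y) (∈-image i))
        where
        lem : ∀ y → (∃ λ (k : Fin N) → toℕ k ≤ n × toℕ k ≢ toℕ j × v y ≡ x (toℕ k + toℕ s)) →
          ∃ λ k → k ≤ n × k ≢ toℕ j × toℕ y ≡ (toℕ s + k) % N
        lem y (k , k≤ , kj , e) = toℕ k , k≤ , kj , trans (sym (m<n⇒m%n≡m (toℕ<n y)))
          (trans (x-injective (toℕ y) (toℕ k + toℕ s) e) (cong (_% N) (ℕP.+-comm (toℕ k) (toℕ s))))
      from : ∀ S → IsFaceOfM n (image π S) → T (Δ S)
      from S (s , j , 1≤j , j≤ , h) = ⇒T (MFace⇒Face (to-MFace {s = toℕ s} {j = j} 1≤j j<n λ y i →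
          lem y (h (v⁻¹ y) (image-∈ (subst (_∈ S) (sym (v-v⁻¹ y)) i)))))
        where
        j<n : j < n
        j<n = ℕP.≤-<-trans j≤ (ℕP.∸-monoʳ-< (s≤s z≤n) (ℕP.≤-trans (s≤s z≤n) n≥5))
        lem : ∀ y → (∃ λ k → k ≤ n × k ≢ j × toℕ (v⁻¹ y) ≡ (toℕ s + k) % N) → ∃ λ k → k ≤ n × k ≢ j × y ≡ x (k + toℕ s)
        lem y (k , k≤ , kj , e) = k , k≤ , kj , trans (sym (v-v⁻¹ y)) (trans (cong x e)
          (trans (x-mod (toℕ s + k)) (cong x (ℕP.+-comm (toℕ s) k))))

  Σ-Vec? : ∀ {k m} {P : Vec (Fin m) k → Set} → (∀ v → Dec (P v)) → Dec (∃ P)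
  Σ-Vec? {zero}  P? = map′ (λ p → [] , p) (λ { ([] , p) → p }) (P? [])
  Σ-Vec? {suc k} P? = map′ (λ (a , v , p) → a ∷ v , p) (λ { (a ∷ v , p) → a , v , p }) (any? λ a → Σ-Vec? λ v → P? (a ∷ v))

  -- A cyclic order is a finite amount of data, so its existence is decidable and may be proved by contradiction.
  module Stable {n : ℕ} {Δ : Subset (suc (n + n)) → Bool} where
    private
      N : ℕ
      N = suc (n + n)

    InWin : Vec (Fin N) N → Fin N → Fin N → Fin N → Set
    InWin v i j y = ∃ λ (k : Fin N) → toℕ k ≤ n × k ≢ j × y ≡ lookup v ((toℕ k + toℕ i) mod N)

    InWin? : ∀ v i j y → Dec (InWin v i j y)
    InWin? v i j y = any? λ k → (toℕ k ≤? n) ×-dec ¬? (k ≟ j) ×-dec (y ≟ lookup v ((toℕ k + toℕ i) mod N))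

    abstract
      Win : Vec (Fin N) N → Fin N → Fin N → Subset N
      Win v i j = tabulate λ y → ⌊ InWin? v i j y ⌋

      Win-in : ∀ v i j {y} → InWin v i j y → y ∈ Win v i j
      Win-in v i j {y} h = mk∈ (trans (lookup∘tabulate (λ y → ⌊ InWin? v i j y ⌋) y) (isYes-yes {d = InWin? v i j y} h))

      Win-inv : ∀ v i j {y} → y ∈ Win v i j → InWin v i j y
      Win-inv v i j {y} h = isYes-true {d = InWin? v i j y} (trans (sym (lookup∘tabulate (λ y → ⌊ InWin? v i j y ⌋) y)) (at h))

    -- One period of the sequence: reading indices modulo `N` supplies `period`, and injectivity
    -- supplies `distinct`.
    IsCyclicOrder : Vec (Fin N) N → Set
    IsCyclicOrder v = (∀ i j → lookup v i ≡ lookup v j → i ≡ j) ×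
      (∀ i j → 1 ≤ toℕ j → toℕ j < n → Δ (Win v i j) ≡ true × ∣ Win v i j ∣ ≡ n)

    IsCyclicOrder? : ∀ v → Dec (IsCyclicOrder v)
    IsCyclicOrder? v = (all? λ i → all? λ j → (lookup v i ≟ lookup v j) →-dec (i ≟ j)) ×-dec
      (all? λ i → all? λ j → (1 ≤? toℕ j) →-dec (toℕ j <? n) →-dec (Δ (Win v i j) BoolP.≟ true) ×-dec (∣ Win v i j ∣ ℕP.≟ n))

    private
      small : ∀ {k} → k ≤ n → k < N
      small h = s≤s (ℕP.≤-trans h (ℕP.m≤m+n n n))

      toℕ-mod : ∀ a → toℕ (a mod N) ≡ a % N
      toℕ-mod a = toℕ-fromℕ< (m%n<n a N)

    to-vec : Cyclic n Δ → ∃ IsCyclicOrder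
    to-vec cyc = w , w-injective , wins
      where
      open Cyclic cyc
      open Cycle cyc
      w : Vec (Fin N) N
      w = tabulate v
      w-mod : ∀ a → lookup w (a mod N) ≡ x a
      w-mod a = trans (lookup∘tabulate v _) (trans (cong x (toℕ-mod a)) (x-mod a))
      w-injective : ∀ i j → lookup w i ≡ lookup w j → i ≡ j
      w-injective i j e = v-injective i j (trans (sym (lookup∘tabulate v i)) (trans e (lookup∘tabulate v j)))
      wins : ∀ i j → 1 ≤ toℕ j → toℕ j < n → Δ (Win w i j) ≡ true × ∣ Win w i j ∣ ≡ n
      wins i j 1≤j j<n with window (toℕ i) (toℕ j) 1≤j j<n
      ... | W , F , win , inv = subst (λ p → Δ p ≡ true × ∣ p ∣ ≡ n) (⊑-antisym to from) F
        where
        to : W ⊑ Win w i j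
        to y h with inv y h
        ... | t , t≤ , tj , e = Win-in w i j (fromℕ< (small t≤) , subst (_≤ n) (sym et) t≤ , (λ q → tj (trans (sym et) (cong toℕ q))) ,
              trans e (sym (trans (cong (λ t → lookup w ((t + toℕ i) mod N)) et) (w-mod (t + toℕ i)))))
          where
          et : toℕ (fromℕ< (small t≤)) ≡ t
          et = toℕ-fromℕ< (small t≤)
        from : Win w i j ⊑ W
        from y h with Win-inv w i j h
        ... | k , k≤ , kj , e = subst (_∈ W) (sym (trans e (w-mod (toℕ k + toℕ i)))) (win (toℕ k) k≤ (λ q → kj (toℕ-injective q)))

    from-vec : ∃ IsCyclicOrder → Cyclic n Δ
    from-vec (w , w-injective , wins) = record { x = x ; period = period ; distinct = distinct ; window = window }
      where
      x : ℕ → Fin N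
      x a = lookup w (a mod N)
      mod-cong : ∀ a b → a % N ≡ b % N → a mod N ≡ b mod N
      mod-cong a b e = toℕ-injective (trans (toℕ-mod a) (trans e (sym (toℕ-mod b))))
      period : ∀ i → x (suc (n + n) + i) ≡ x i
      period i = cong (lookup w) (mod-cong (N + i) i (trans (cong (_% N) (ℕP.+-comm N i)) ([m+n]%n≡m%n i N)))
      distinct : ∀ i d → 1 ≤ d → d ≤ n + n → x i ≢ x (d + i)
      distinct i d 1≤d d≤ e = lem (d + r <? N)
        where
        r : ℕ
        r = i % N
        r<N : r < N
        r<N = m%n<n i N
        same : r ≡ (d + r) % N
        same = trans (trans (sym (toℕ-mod i)) (trans (cong toℕ (w-injective (i mod N) ((d + i) mod N) e)) (toℕ-mod (d + i))))
          (trans (%-distribˡ-+ d i N) (trans (cong (λ z → (d % N + z) % N) (sym (m%n%n≡m%n i N))) (sym (%-distribˡ-+ d r N))))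
        -- As `r` and `d` are both below `N`, the sum wraps at most once, and neither way does it
        -- come back to `r`.
        lem : Dec (d + r < N) → _
        lem (yes p) = ℕP.<⇒≢ (ℕP.m<n+m r 1≤d) (trans same (m<n⇒m%n≡m p))
        lem (no q)  = ℕP.<⇒≢ back<r (sym (trans same (trans (cong (_% N) (sym (ℕP.m∸n+n≡m (ℕP.≮⇒≥ q))))
                        (trans ([m+n]%n≡m%n (d + r ∸ N) N) (m<n⇒m%n≡m (ℕP.<-trans back<r r<N))))))
          where
          back<r : d + r ∸ N < r
          back<r = ℕP.+-cancelʳ-< N _ r (subst (_< r + N) (sym (ℕP.m∸n+n≡m (ℕP.≮⇒≥ q)))
                     (subst (_< r + N) (ℕP.+-comm r d) (ℕP.+-monoʳ-< r (s≤s d≤))))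
      shift : ∀ t i → x (t + toℕ (i mod N)) ≡ x (t + i)
      shift t i = cong (lookup w) (mod-cong (t + toℕ (i mod N)) (t + i) (trans (cong (λ z → (t + z) % N) (toℕ-mod i))
        (trans (%-distribˡ-+ t (i % N) N) (trans (cong (λ z → (t % N + z) % N) (m%n%n≡m%n i N)) (sym (%-distribˡ-+ t i N))))))
      window : ∀ i j → 1 ≤ j → j < n → ∃ λ W → IsFacet n Δ W ×
        (∀ t → t ≤ n → t ≢ j → x (t + i) ∈ W) × (∀ s → s ∈ W → ∃ λ t → t ≤ n × t ≢ j × s ≡ x (t + i))
      window i j 1≤j j<n = Win w (i mod N) j′ , wins (i mod N) j′ (subst (1 ≤_) (sym ej) 1≤j) (subst (_< n) (sym ej) j<n) , to , from
        where
        j′ : Fin N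
        j′ = fromℕ< (small (ℕP.<⇒≤ j<n))
        ej : toℕ j′ ≡ j
        ej = toℕ-fromℕ< _
        to : ∀ t → t ≤ n → t ≢ j → x (t + i) ∈ Win w (i mod N) j′
        to t t≤ tj = Win-in w (i mod N) j′ (fromℕ< (small t≤) , subst (_≤ n) (sym et) t≤ , (λ q → tj (trans (sym et) (trans (cong toℕ q) ej))) ,
            trans (sym (shift t i)) (cong (λ t → x (t + toℕ (i mod N))) (sym et)))
          where
          et : toℕ (fromℕ< (small t≤)) ≡ t
          et = toℕ-fromℕ< (small t≤)
        from : ∀ s → s ∈ Win w (i mod N) j′ → ∃ λ t → t ≤ n × t ≢ j × s ≡ x (t + i)
        from s h with Win-inv w (i mod N) j′ h
        ... | k , k≤ , kj , e = toℕ k , k≤ , (λ q → kj (toℕ-injective (trans q (sym ej)))) , trans e (shift (toℕ k) i)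

    cyclic? : Dec (Cyclic n Δ)
    cyclic? = map′ from-vec to-vec (Σ-Vec? IsCyclicOrder?)

open CyclicOrders

-- Cocycles, and n + 1 vertices containing two adjacent facets.

module Pairs where
  open import Data.Rational using (_+_)

  -- The vertices may coincide, so `φ v v ≡ 0ℚ` and antisymmetry on edges are included. Values on
  -- pairs that are not edges are arbitrary.
  record Cocycle {m : ℕ} (Δ : Subset m → Bool) : Set where
    field
      φ : Fin m → Fin m → ℚ
      cocycle : ∀ {p u v w} → IsFace Δ p → u ∈ p → v ∈ p → w ∈ p → φ u v + φ v w ≡ φ u w

    IsCoboundaryOf : (Fin m → ℚ) → Set
    IsCoboundaryOf g = ∀ {p u v} → IsFace Δ p → u ∈ p → v ∈ p → g u + φ u v ≡ g v

  -- The two facets cover every pair in S except `s₀`, `s₁`. If that pair is an edge, `linked`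
  -- provides a triangle on it with third vertex in S, which makes a cocycle trivial on all of S.
  record Pair {m : ℕ} (n : ℕ) (Δ : Subset m → Bool) : Set where
    field
      S : Subset m
      size-S : ∣ S ∣ ≡ suc n
      size-T : ∣ ∁ S ∣ ≡ n
      s₀ s₁ : Fin m
      s₀≢s₁ : s₀ ≢ s₁
      s₀∈S : s₀ ∈ S
      s₁∈S : s₁ ∈ S
      face₀ : IsFace Δ (S ⊟ s₀)
      face₁ : IsFace Δ (S ⊟ s₁)
      linked : ∀ {p} → IsFace Δ p → s₀ ∈ p → s₁ ∈ p →
        ∃ λ r → ∃ λ q → r ∈ S × r ≢ s₀ × r ≢ s₁ × IsFace Δ q × s₀ ∈ q × s₁ ∈ q × r ∈ q

  module FindPair {m n : ℕ} {Δ : Subset m → Bool} (pm : IsPM n Δ) (n≥5 : 5 ≤ n) (m≡ : m ≡ suc (n ℕ.+ n)) where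
    open IsPM pm

    size-∁ : ∀ (p : Subset m) → ∣ p ∣ ≡ suc n → ∣ ∁ p ∣ ≡ n
    size-∁ p e = trans (∣∁p∣≡n∸∣p∣ p) (trans (cong₂ _∸_ m≡ e) (ℕP.m+n∸n≡m n n))

    private
      tri : Fin m → Fin m → Fin m → Subset m
      tri u v w = ⊥ ⊞ u ⊞ v ⊞ w

      tri-⊑ : ∀ {u v w p} → u ∈ p → v ∈ p → w ∈ p → tri u v w ⊑ p
      tri-⊑ ui vi wi y i with ⊞-inv i
      ... | inj₁ refl = wi
      ... | inj₂ j with ⊞-inv j
      ...   | inj₁ refl = vi
      ...   | inj₂ k with ⊞-inv k
      ...     | inj₁ refl = ui
      ...     | inj₂ l = in∧out l ∉⊥

    -- If the edge v b has no triangle meeting ρ, its star lives on the n + 2 vertices of ∁ ρ; a facet of the star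
    -- omits two of them, and the omitted pairs form a complete bipartite graph.
    module Suspended {ρ : Subset m} {v b : Fin m} (size-ρ : suc ∣ ρ ∣ ≡ n) (v∉ρ : v ∉ ρ) (b∉ρ : b ∉ ρ) (v≢b : v ≢ b)
      (edge : Face (⊥ ⊞ v ⊞ b)) (none : ∀ {r p} → r ∈ ρ → Face p → v ∈ p → b ∈ p → r ∈ p → Empty) where

      Y : Subset m
      Y = ∁ ρ

      size-Y : ∣ Y ∣ ≡ suc (suc n)
      size-Y = trans (∣∁p∣≡n∸∣p∣ ρ) (trans (cong (_∸ ∣ ρ ∣) (trans m≡ (trans (cong (λ k → suc (k ℕ.+ n)) (sym size-ρ))
        (trans (cong suc (sym (ℕP.+-suc ∣ ρ ∣ n))) (sym (ℕP.+-suc ∣ ρ ∣ (suc n))))))) (ℕP.m+n∸m≡n ∣ ρ ∣ _))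

      star-⊑ : ∀ {p} → Face p → v ∈ p → b ∈ p → p ⊑ Y
      star-⊑ f vp bp y i = ∁-in (not-in λ j → none j f vp bp i)

      -- Cross the ridge opposite `r`. It still contains `v` and `b`, so the new facet stays inside
      -- `Y` and gets back `p` or `q`.
      exchange : ∀ {p q r} → p ∈ Y → q ∈ Y → r ∈ Y → p ≢ q → r ≢ p → r ≢ q → All (_≢ v) (p ∷ q ∷ r ∷ []) → All (_≢ b) (p ∷ q ∷ r ∷ []) →
        Face (Y ⊟ p ⊟ q) → Face (Y ⊟ p ⊟ r) ⊎ Face (Y ⊟ q ⊟ r)
      exchange {p} {q} {r} pY qY rY pq rp rq (pv ∷ qv ∷ rv ∷ []) (pb ∷ qb ∷ rb ∷ []) f
        with two {Y ⊟ p ⊟ q ⊟ r} {r} sz ⊟-gone (subst Face (sym (⊟⊞ r∈)) f)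
        where
        r∈ : r ∈ Y ⊟ p ⊟ q
        r∈ = ⊟-keep rq (⊟-keep rp rY)
        sz : suc ∣ Y ⊟ p ⊟ q ⊟ r ∣ ≡ n
        sz = trans (size-⊟ r∈) (ℕP.suc-injective (ℕP.suc-injective
               (trans (cong suc (size-⊟ (⊟-keep (pq ∘ sym) qY))) (trans (size-⊟ pY) size-Y))))
      ... | z , zr , zo , fz , _ with ⊟-out-inv zo
      ...   | inj₁ e = contradiction e zr
      ...   | inj₂ o₁ with ⊟-out-inv o₁
      ...     | inj₁ refl = inj₁ (subst Face (trans (cong (_⊞ q) (⊟-comm (Y ⊟ p) q r)) (⊟⊞ (⊟-keep (rq ∘ sym) (⊟-keep (pq ∘ sym) qY)))) fz)
      ...     | inj₂ o₂ with ⊟-out-inv o₂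
      ...       | inj₁ refl = inj₂ (subst Face (trans (cong (_⊞ p) (trans (cong (_⊟ r) (⊟-comm Y p q)) (⊟-comm (Y ⊟ q) p r)))
                                (⊟⊞ (⊟-keep (rp ∘ sym) (⊟-keep pq pY)))) fz)
      ...       | inj₂ z∉Y = in∧out (star-⊑ fz (⊞-old (⊟-keep (rv ∘ sym) (⊟-keep (qv ∘ sym) (⊟-keep (pv ∘ sym) (∁-in v∉ρ)))))
                                (⊞-old (⊟-keep (rb ∘ sym) (⊟-keep (qb ∘ sym) (⊟-keep (pb ∘ sym) (∁-in b∉ρ))))) z ⊞-new) z∉Y

      -- Three omitted pairs with the common end `h`. Two of them give the facets inside `Y ⊟ h`;
      -- the facet of the third contains `o`, `r` and `v`, the triangle that `linked` demands.
      fan : ∀ {h o r r′} → h ∈ Y → o ∈ Y → r ∈ Y → o ≢ h → r ≢ h → r ≢ o → r′ ≢ r → r′ ≢ o → v ≢ h → v ≢ o → v ≢ r → v ≢ r′ →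
        Face (Y ⊟ h ⊟ o) → Face (Y ⊟ h ⊟ r) → Face (Y ⊟ h ⊟ r′) → Pair n Δ
      fan {h} {o} {r} {r′} hY oY rY oh rh ro r′r r′o vh vo vr vr′ fo fr fr′ = record
        { S = Y ⊟ h ; size-S = sz ; size-T = size-∁ (Y ⊟ h) sz
        ; s₀ = o ; s₁ = r ; s₀≢s₁ = ro ∘ sym ; s₀∈S = ⊟-keep oh oY ; s₁∈S = ⊟-keep rh rY ; face₀ = fo ; face₁ = fr
        ; linked = λ _ _ _ → v , Y ⊟ h ⊟ r′ , ⊟-keep vh (∁-in v∉ρ) , vo , vr , fr′ ,
            ⊟-keep (r′o ∘ sym) (⊟-keep oh oY) , ⊟-keep (r′r ∘ sym) (⊟-keep rh rY) , ⊟-keep vr′ (⊟-keep vh (∁-in v∉ρ)) }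
        where
        sz : ∣ Y ⊟ h ∣ ≡ suc n
        sz = ℕP.suc-injective (trans (size-⊟ hY) size-Y)

      -- Each of three further vertices forms an omitted pair with `p` or with `q`, so two of them
      -- share an end. With `v`, `b`, `p`, `q` this takes seven of the n + 2 vertices of `Y`, hence
      -- n at least 5.
      pair : Pair n Δ
      pair with facet⊇ edge (nonempty {x = b} {p = ⊥ ⊞ v ⊞ b} ⊞-new)
      ... | τ , e⊑τ , F with ⊑-codim2 {p = τ} {q = Y} (star-⊑ (proj₁ F) (e⊑τ v (⊞-old ⊞-new)) (e⊑τ b ⊞-new))
                               (trans (cong (λ k → suc (suc k)) (proj₂ F)) (sym size-Y))
      ...   | p , q , p≢q , pY , qY , pτ , qτ , refl
        with avoid (v ∷ b ∷ p ∷ q ∷ []) Y (subst (5 ≤_) (sym size-Y) (ℕP.m≤n⇒m≤1+n (ℕP.m≤n⇒m≤1+n n≥5)))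
      ...   | r₁ , r₁Y , v₁ ∷ b₁ ∷ p₁ ∷ q₁ ∷ []
        with avoid (v ∷ b ∷ p ∷ q ∷ r₁ ∷ []) Y (subst (6 ≤_) (sym size-Y) (ℕP.m≤n⇒m≤1+n (s≤s n≥5)))
      ...   | r₂ , r₂Y , v₂ ∷ b₂ ∷ p₂ ∷ q₂ ∷ r₁₂ ∷ []
        with avoid (v ∷ b ∷ p ∷ q ∷ r₁ ∷ r₂ ∷ []) Y (subst (7 ≤_) (sym size-Y) (s≤s (s≤s n≥5)))
      ...   | r₃ , r₃Y , v₃ ∷ b₃ ∷ p₃ ∷ q₃ ∷ r₁₃ ∷ r₂₃ ∷ [] = choose (ex r₁Y v₁ b₁ p₁ q₁) (ex r₂Y v₂ b₂ p₂ q₂) (ex r₃Y v₃ b₃ p₃ q₃)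
        where
        vτ : v ∈ Y ⊟ p ⊟ q
        vτ = e⊑τ v (⊞-old ⊞-new)
        bτ : b ∈ Y ⊟ p ⊟ q
        bτ = e⊑τ b ⊞-new
        vp : p ≢ v
        vp e = in≢out vτ pτ (sym e)
        vq : q ≢ v
        vq e = in≢out vτ qτ (sym e)
        ex : ∀ {r} → r ∈ Y → r ≢ v → r ≢ b → r ≢ p → r ≢ q → Face (Y ⊟ p ⊟ r) ⊎ Face (Y ⊟ q ⊟ r)
        ex rY rv rb rp rq = exchange pY qY rY p≢q rp rq (vp ∷ vq ∷ rv ∷ [])
          ((λ e → in≢out bτ pτ (sym e)) ∷ (λ e → in≢out bτ qτ (sym e)) ∷ rb ∷ []) (proj₁ F)
        fan-p : ∀ {r r′} → r ∈ Y → r ≢ v → r ≢ p → r ≢ q → r′ ≢ v → r′ ≢ q → r′ ≢ r → Face (Y ⊟ p ⊟ r) → Face (Y ⊟ p ⊟ r′) → Pair n Δ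
        fan-p rY rv rp rq rv′ rq′ rr = fan pY qY rY (p≢q ∘ sym) rp rq rr rq′ (vp ∘ sym) (vq ∘ sym) (rv ∘ sym) (rv′ ∘ sym) (proj₁ F)
        fan-q : ∀ {r r′} → r ∈ Y → r ≢ v → r ≢ p → r ≢ q → r′ ≢ v → r′ ≢ p → r′ ≢ r → Face (Y ⊟ q ⊟ r) → Face (Y ⊟ q ⊟ r′) → Pair n Δ
        fan-q rY rv rp rq rv′ rp′ rr = fan qY pY rY p≢q rq rp rr rp′ (vq ∘ sym) (vp ∘ sym) (rv ∘ sym) (rv′ ∘ sym)
          (subst Face (⊟-comm Y p q) (proj₁ F))
        choose : Face (Y ⊟ p ⊟ r₁) ⊎ Face (Y ⊟ q ⊟ r₁) → Face (Y ⊟ p ⊟ r₂) ⊎ Face (Y ⊟ q ⊟ r₂) →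
          Face (Y ⊟ p ⊟ r₃) ⊎ Face (Y ⊟ q ⊟ r₃) → Pair n Δ
        choose (inj₁ f₁) (inj₁ f₂) _         = fan-p r₁Y v₁ p₁ q₁ v₂ q₂ r₁₂ f₁ f₂
        choose (inj₁ f₁) (inj₂ f₂) (inj₁ f₃) = fan-p r₁Y v₁ p₁ q₁ v₃ q₃ r₁₃ f₁ f₃
        choose (inj₁ f₁) (inj₂ f₂) (inj₂ f₃) = fan-q r₂Y v₂ p₂ q₂ v₃ p₃ r₂₃ f₂ f₃
        choose (inj₂ f₁) (inj₂ f₂) _         = fan-q r₁Y v₁ p₁ q₁ v₂ p₂ r₁₂ f₁ f₂
        choose (inj₂ f₁) (inj₁ f₂) (inj₁ f₃) = fan-p r₂Y v₂ p₂ q₂ v₃ q₃ r₂₃ f₂ f₃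
        choose (inj₂ f₁) (inj₁ f₂) (inj₂ f₃) = fan-q r₁Y v₁ p₁ q₁ v₃ p₃ r₁₃ f₁ f₃

    abstract
      -- S is a facet together with the apex `b` of the facet across from `v`. The pair `v`, `b` is
      -- no edge, or has a triangle within S, or has a star that avoids `ρ`.
      pair : Pair n Δ
      pair with facet⊇ (vertex v) (nonempty {x = v} {p = ⊥ ⊞ v} ⊞-new)
        where
        v : Fin m
        v = subst Fin (sym m≡) zero
      ... | σ , v⊑σ , F , |σ| = go
        where
        v : Fin m
        v = subst Fin (sym m≡) zero
        v∈σ : v ∈ σ
        v∈σ = v⊑σ v ⊞-new
        ρ : Subset m
        ρ = σ ⊟ v
        size-ρ : suc ∣ ρ ∣ ≡ n
        size-ρ = trans (size-⊟ v∈σ) |σ|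
        go : Pair n Δ
        go with two {ρ} {v} size-ρ ⊟-gone (subst Face (sym (⊟⊞ v∈σ)) F)
        ... | b , b≢v , bo , fb , _ = decide (any? (λ r → (r ∈? ρ) ×-dec Face? (tri v b r))) (Face? (⊥ ⊞ v ⊞ b))
          where
          b∉σ : b ∉ σ
          b∉σ with ⊟-out-inv bo
          ... | inj₁ e = contradiction e b≢v
          ... | inj₂ o = o
          sz : ∣ σ ⊞ b ∣ ≡ suc n
          sz = trans (size-⊞ b∉σ) (cong suc |σ|)
          with-link : (∀ {p} → Face p → v ∈ p → b ∈ p →
            ∃ λ r → ∃ λ q → r ∈ σ ⊞ b × r ≢ v × r ≢ b × Face q × v ∈ q × b ∈ q × r ∈ q) → Pair n Δ
          with-link l = record
            { S = σ ⊞ b ; size-S = sz ; size-T = size-∁ (σ ⊞ b) sz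
            ; s₀ = v ; s₁ = b ; s₀≢s₁ = b≢v ∘ sym ; s₀∈S = ⊞-old v∈σ ; s₁∈S = ⊞-new
            ; face₀ = subst Face (⊟⊞-comm σ (b≢v ∘ sym)) fb ; face₁ = subst Face (sym (⊞⊟ b∉σ)) F
            ; linked = l }
          decide : Dec (∃ λ r → r ∈ ρ × Face (tri v b r)) → Dec (Face (⊥ ⊞ v ⊞ b)) → Pair n Δ
          decide (yes (r , rρ , f)) _ = with-link λ _ _ _ →
            r , tri v b r , ⊞-old (⊟-sub r rρ) , proj₁ (⊟-inv rρ) , in≢out rρ bo , f , ⊞-old (⊞-old ⊞-new) , ⊞-old ⊞-new , ⊞-new
          decide (no _) (no nf) = with-link λ f vp bp → contradiction (down (edge-⊑ vp bp) f) nf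
            where
            edge-⊑ : ∀ {p} → v ∈ p → b ∈ p → ⊥ ⊞ v ⊞ b ⊑ p
            edge-⊑ vp bp y i = tri-⊑ vp bp bp y (⊞-old i)
          decide (no none) (yes f) = Suspended.pair size-ρ ⊟-gone bo (b≢v ∘ sym) f
            λ {r} rρ f vp bp rp → none (r , rρ , down (tri-⊑ vp bp rp) f)

open Pairs

-- A cocycle without potential splits the complex.

module Bicolourings where
  open import Data.Rational using (_+_)

  +-cancelˡ : ∀ p {q r} → p + q ≡ p + r → q ≡ r
  +-cancelˡ p {q} {r} = GroupP.∙-cancelˡ ℚP.+-0-group p q r

  module Levels {m n : ℕ} {Δ : Subset m → Bool} (pm : IsPM n Δ) (n≥5 : 5 ≤ n) (co : Cocycle Δ) (pair : Pair n Δ) where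
    open IsPM pm
    open Cocycle co
    open Pair pair
    open Sizes n≥5 S size-S size-T public
    private
      V : Set
      V = Fin m

    φ-diag : ∀ {p v} → Face p → v ∈ p → φ v v ≡ 0ℚ
    φ-diag {v = v} f vp = +-cancelˡ (φ v v) (trans (cocycle f vp vp vp) (sym (ℚP.+-identityʳ _)))

    φ-return : ∀ {p u v} a → Face p → u ∈ p → v ∈ p → (a + φ u v) + φ v u ≡ a
    φ-return {u = u} {v} a f up vp = trans (ℚP.+-assoc a _ _)
      (trans (cong (a +_) (trans (cocycle f up vp up) (φ-diag f up))) (ℚP.+-identityʳ a))

    private
      base : ∃ λ r → r ∈ S × All (r ≢_) (s₀ ∷ s₁ ∷ [])
      base = avoid-S (s₀ ∷ s₁ ∷ []) (s≤s (s≤s (s≤s z≤n)))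

    -- A potential for `φ` on S. Its base vertex lies in both given facets, so only the edge from
    -- `s₀` to `s₁` is left to `linked`.
    f : V → ℚ
    f = φ (proj₁ base)

    private
      r∈ : proj₁ base ∈ S
      r∈ = proj₁ (proj₂ base)

      r≢s₀ : proj₁ base ≢ s₀
      r≢s₀ = All.head (proj₂ (proj₂ base))

      r≢s₁ : proj₁ base ≢ s₁
      r≢s₁ = All.head (All.tail (proj₂ (proj₂ base)))

      step₀ : ∀ {u v} → u ∈ S → v ∈ S → u ≢ s₀ → v ≢ s₀ → f u + φ u v ≡ f v
      step₀ ui vi un vn = cocycle face₀ (⊟-keep r≢s₀ r∈) (⊟-keep un ui) (⊟-keep vn vi)

      step₁ : ∀ {u v} → u ∈ S → v ∈ S → u ≢ s₁ → v ≢ s₁ → f u + φ u v ≡ f v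
      step₁ ui vi un vn = cocycle face₁ (⊟-keep r≢s₁ r∈) (⊟-keep un ui) (⊟-keep vn vi)

      step₀₁ : ∀ {p} → Face p → s₀ ∈ p → s₁ ∈ p → f s₀ + φ s₀ s₁ ≡ f s₁
      step₀₁ g i j with linked g i j
      ... | r , q , rS , r₀ , r₁ , h , i′ , j′ , k =
        trans (cong (f s₀ +_) (sym (cocycle h i′ k j′))) (trans (sym (ℚP.+-assoc (f s₀) _ _))
          (trans (cong (_+ φ r s₁) (step₁ s₀∈S rS s₀≢s₁ r₁)) (step₀ rS s₁∈S r₀ (s₀≢s₁ ∘ sym))))

    f-potential : ∀ {p u v} → Face p → u ∈ S → v ∈ S → u ∈ p → v ∈ p → f u + φ u v ≡ f v
    f-potential {u = u} {v} g uS vS up vp with u ≟ s₀ | v ≟ s₀ | u ≟ s₁ | v ≟ s₁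
    ... | no a | no b | _ | _ = step₀ uS vS a b
    ... | _ | _ | no a | no b = step₁ uS vS a b
    ... | yes refl | _ | yes e | _ = contradiction e s₀≢s₁
    ... | _ | yes refl | _ | yes e = contradiction e s₀≢s₁
    ... | yes refl | _ | _ | yes refl = step₀₁ g up vp
    ... | no _ | yes refl | yes refl | no _ =
      trans (cong (_+ φ s₁ s₀) (sym (step₀₁ g vp up))) (φ-return (f s₀) g vp up)

    -- The potential on S continued along the edge from `s` to `u`. A vertex of T may receive
    -- different levels from different `s`; these discrepancies are the obstruction to a global
    -- potential.
    L : V → V → ℚ
    L s u = f s + φ s u

    L-S : ∀ {p s s′ u} → Face p → s ∈ S → s′ ∈ S → s ∈ p → s′ ∈ p → u ∈ p → L s u ≡ L s′ u
    L-S {s = s} {s′} {u} g i i′ sp sp′ up = trans (cong (f s +_) (sym (cocycle g sp sp′ up)))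
      (trans (sym (ℚP.+-assoc (f s) _ _)) (cong (_+ φ s′ u) (f-potential g i i′ sp sp′)))

    L-T : ∀ {p s u v} → Face p → s ∈ p → u ∈ p → v ∈ p → L s u + φ u v ≡ L s v
    L-T {s = s} g sp up vp = trans (ℚP.+-assoc (f s) _ _) (cong (f s +_) (cocycle g sp up vp))

    private
      At : V → ℚ → Subset m → Set
      At u w τ = ∃ λ s → s ∈ S × s ∈ τ × L s u ≡ w

      At? : ∀ u w τ → Dec (At u w τ)
      At? u w τ = any? λ s → (s ∈? S) ×-dec (s ∈? τ) ×-dec (L s u ℚP.≟ w)

      Meets? : ∀ τ → Dec (∃ λ s → s ∈ S × s ∈ τ)
      Meets? τ = any? λ s → (s ∈? S) ×-dec (s ∈? τ)

    -- Indicator of the facets on which u has level w; d is its value on T, where no level is defined.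
    abstract
      E : V → ℚ → Bool → Subset m → Bool
      E u w d τ = ⌊ Face? τ ⌋ ∧ (if ⌊ Meets? τ ⌋ then ⌊ At? u w τ ⌋ else d)

      E-value : ∀ {u w d τ s} → Face τ → s ∈ S → s ∈ τ → u ∈ τ → E u w d τ ≡ ⌊ L s u ℚP.≟ w ⌋
      E-value {u} {w} {d} {τ} {s} g sS sτ uτ
        rewrite isYes-yes {d = Face? τ} g | isYes-yes {d = Meets? τ} (s , sS , sτ) with L s u ℚP.≟ w
      ... | yes e = isYes-yes {d = At? u w τ} (s , sS , sτ , e)
      ... | no ne = isYes-no {d = At? u w τ} λ (s′ , s′S , s′τ , e) → ne (trans (L-S g sS s′S sτ s′τ uτ) e)

      E-T : ∀ {u w d τ} → Face τ → (∀ s → s ∈ S → s ∉ τ) → E u w d τ ≡ d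
      E-T {u} {w} {d} {τ} g h
        rewrite isYes-yes {d = Face? τ} g | isYes-no {d = Meets? τ} (λ (s , sS , sτ) → in∧out sτ (h s sS)) = refl

      E-nonface : ∀ {u w d} τ → Δ τ ≡ false → E u w d τ ≡ false
      E-nonface {u} {w} {d} τ e rewrite isYes-no {d = Face? τ} (λ g → true≢false g e) = refl

    E-mixed : ∀ {u w d ρ s b c} → s ∈ S → s ∈ ρ → u ∈ ρ → Face (ρ ⊞ b) → Face (ρ ⊞ c) → E u w d (ρ ⊞ b) ≡ E u w d (ρ ⊞ c)
    E-mixed sS sρ uρ fb fc = trans (E-value fb sS (⊞-old sρ) (⊞-old uρ)) (sym (E-value fc sS (⊞-old sρ) (⊞-old uρ)))

    bd-mixed : ∀ {u w d ρ s} → suc ∣ ρ ∣ ≡ n → s ∈ S → s ∈ ρ → u ∈ ρ → bd (E u w d) ρ ≡ false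
    bd-mixed {u} {w} {d} e sS sρ uρ = bd-closed {E u w d} e E-nonface λ _ _ _ _ → E-mixed sS sρ uρ

    -- ∂∂ = 0 at `∁ S ⊟ x ⊟ y`. This face contains `u`, so its cofaces with a vertex of S carry no
    -- boundary and only the two cofaces inside T count; `s₀` is a dummy third vertex.
    bd-T : ∀ {u w d x y} → u ∉ S → x ∉ S → y ∉ S → u ≢ x → u ≢ y → bd (E u w d) (∁ S ⊟ x) ≡ bd (E u w d) (∁ S ⊟ y)
    bd-T {u} {w} {d} {x} {y} uo xo yo ux uy with x ≟ y
    ... | yes refl = refl
    ... | no x≢y = sym (xor-false (trans (cong₂ _xor_ (cong B (sym ηx)) (trans (cong B (sym ηy)) (trans (sym (BoolP.xor-identityʳ _))
        (cong (B (η ⊞ y) xor_) (sym Bz)))))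
        (bd-bd-three (E u w d) {η} {x} {y} {s₀} x≢y (λ e → in∧out s₀∈S (subst (_∉ S) e xo)) (λ e → in∧out s₀∈S (subst (_∉ S) e yo))
          (⊟-out ⊟-gone) ⊟-gone (⊟-out (⊟-out (∁-out s₀∈S))) rest)))
      where
      B : Subset m → Bool
      B = bd (E u w d)
      η : Subset m
      η = ∁ S ⊟ x ⊟ y
      uη : u ∈ η
      uη = ⊟-keep uy (⊟-keep ux (∁-in uo))
      y∈ : y ∈ ∁ S ⊟ x
      y∈ = ⊟-keep (x≢y ∘ sym) (∁-in yo)
      ηx : η ⊞ x ≡ ∁ S ⊟ y
      ηx = trans (cong (_⊞ x) (⊟-comm (∁ S) x y)) (⊟⊞ (⊟-keep x≢y (∁-in xo)))
      ηy : η ⊞ y ≡ ∁ S ⊟ x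
      ηy = ⊟⊞ y∈
      size : ∀ {z} → z ∉ η → suc ∣ η ⊞ z ∣ ≡ n
      size zo = trans (cong suc (trans (size-⊞ zo) (size-⊟ y∈))) (size-T⊟ xo)
      B-S : ∀ {z} → z ∈ S → z ∉ η → B (η ⊞ z) ≡ false
      B-S zS zo = bd-mixed (size zo) zS ⊞-new (⊞-old uη)
      Bz : B (η ⊞ s₀) ≡ false
      Bz = B-S s₀∈S (⊟-out (⊟-out (∁-out s₀∈S)))
      rest : ∀ z → z ∉ η → z ≢ x → z ≢ y → z ≢ s₀ → B (η ⊞ z) ≡ false
      rest z zo zx zy _ with in? z S
      ... | inj₁ i = B-S i zo
      ... | inj₂ o = in∧out (⊟-keep zy (⊟-keep zx (∁-in o))) zo

    T-facet : ∀ {τ} → Facet τ → (∀ s → s ∈ S → s ∉ τ) → τ ≡ ∁ S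
    T-facet {τ} (_ , e) h = ⊑-size (λ y i → ∁-in (not-in λ j → in∧out i (h y j))) (ℕP.≤-reflexive (trans size-T (sym e)))

    other-side : ∀ {x} → Face (∁ S) → x ∉ S → ∃ λ z → z ∈ S × Face (∁ S ⊟ x ⊞ z)
    other-side {x} g xo with two {∁ S ⊟ x} {x} (size-T⊟ xo) ⊟-gone (subst Face (sym (⊟⊞ (∁-in xo))) g)
    ... | z , zx , zo , h , _ = z , zS , h
      where
      zS : z ∈ S
      zS with in? z S
      ... | inj₁ i = i
      ... | inj₂ o = in∧out (⊟-keep zx (∁-in o)) zo

    beyond : ∀ {x a} → ¬ Face (∁ S) → x ∉ S → a ∉ ∁ S ⊟ x → Face (∁ S ⊟ x ⊞ a) → a ∈ S
    beyond {x} {a} nf xo ao fa with in? a S | a ≟ x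
    ... | inj₁ i | _        = i
    ... | inj₂ o | yes refl = contradiction (subst Face (⊟⊞ (∁-in xo)) fa) nf
    ... | inj₂ o | no ax    = in∧out (⊟-keep ax (∁-in o)) ao

    -- The only possible facet disjoint from S is T itself; across one of its ridges through `u` and
    -- `v` lies a facet with apex in S.
    reach-S : ∀ {p u v} → Face p → u ∈ p → v ∈ p → ∃ λ q → ∃ λ s → Facet q × s ∈ S × s ∈ q × u ∈ q × v ∈ q
    reach-S {p} {u} {v} g up vp with facet⊇ g (nonempty up)
    ... | τ , p⊑τ , F with any? (λ s → (s ∈? S) ×-dec (s ∈? τ))
    ...   | yes (s , sS , sτ) = τ , s , F , sS , sτ , p⊑τ u up , p⊑τ v vp
    ...   | no none with avoid-T (u ∷ v ∷ []) (s≤s (s≤s (s≤s z≤n)))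
    ...     | x , xo , xu ∷ xv ∷ [] with T-facet F (λ s sS → not-in λ sτ → none (s , sS , sτ))
    ...       | refl with other-side (proj₁ F) xo
    ...         | z , zS , h = ∁ S ⊟ x ⊞ z , z , (h , size-T⊟⊞ xo zS) , zS , ⊞-new ,
                  ⊞-old (⊟-keep (xu ∘ sym) (p⊑τ u up)) , ⊞-old (⊟-keep (xv ∘ sym) (p⊑τ v vp))

    -- Evidence that `u` has a single level: a level `w` attained on some facet, whose indicator has
    -- no boundary along ∂T.
    record Start (u : V) : Set where
      field
        w : ℚ
        flat : ∀ x → x ∉ S → u ≢ x → bd (E u w true) (∁ S ⊟ x) ≡ false
        τ₀ : Subset m
        τ₀-facet : Facet τ₀
        u∈τ₀ : u ∈ τ₀
        E-τ₀ : E u w true τ₀ ≡ true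

    -- The indicator passes across every ridge through `u`: across ridges meeting S because the
    -- level is read from the ridge itself, across ridges inside T by `flat`.
    level : ∀ {u} → u ∉ S → (st : Start u) → ∀ {τ s} → Facet τ → s ∈ S → s ∈ τ → u ∈ τ → L s u ≡ Start.w st
    level {u} uo st {τ} {s} F sS sτ uτ = isYes-true {d = L s u ℚP.≟ w}
      (trans (sym (E-value (proj₁ F) sS sτ uτ)) (star-connected u (E u w true) closed τ₀ τ u∈τ₀ uτ τ₀-facet F E-τ₀))
      where
      open Start st
      closed : ∀ ρ b c → u ∈ ρ → suc ∣ ρ ∣ ≡ n → b ∉ ρ → c ∉ ρ → Face (ρ ⊞ b) → Face (ρ ⊞ c) →
        E u w true (ρ ⊞ b) ≡ true → E u w true (ρ ⊞ c) ≡ true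
      closed ρ b c uρ e bo co fb fc h with any? (λ s → (s ∈? S) ×-dec (s ∈? ρ))
      ... | yes (s , sS , sρ) = trans (sym (E-mixed sS sρ uρ fb fc)) h
      ... | no none with ⊑-codim1 {p = ρ} {q = ∁ S} (λ y i → ∁-in (not-in λ j → none (y , j , i))) (trans e (sym size-T))
      ...   | x , xi , xo , refl = trans (sym (bd-balanced {E u w true} e E-nonface
                (flat x (∁-in-inv xi) (proj₁ (⊟-inv uρ))) bo co fb fc)) h

    coboundary : (∀ u → u ∉ S → Start u) → ∃ IsCoboundaryOf
    coboundary start = g , check
      where
      lev : ∃ λ g → ∀ u → u ∈ ∁ S → (∀ {τ s} → Facet τ → s ∈ S → s ∈ τ → u ∈ τ → L s u ≡ g u)
      lev = choice {P = λ u w → ∀ {τ s} → Facet τ → s ∈ S → s ∈ τ → u ∈ τ → L s u ≡ w} 0ℚ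
        λ u i → Start.w (start u (∁-in-inv i)) , level (∁-in-inv i) (start u (∁-in-inv i))
      g : V → ℚ
      g u = if ⌊ u ∈? S ⌋ then f u else proj₁ lev u
      g-S : ∀ {u} → u ∈ S → g u ≡ f u
      g-S {u} i rewrite isYes-yes {d = u ∈? S} i = refl
      g-T : ∀ {u τ s} → u ∉ S → Facet τ → s ∈ S → s ∈ τ → u ∈ τ → g u ≡ L s u
      g-T {u} o F sS sτ uτ rewrite isYes-no {d = u ∈? S} (λ i → in∧out i o) = sym (proj₂ lev u (∁-in o) F sS sτ uτ)
      g-L : ∀ {u τ s} → Facet τ → s ∈ S → s ∈ τ → u ∈ τ → g u ≡ L s u
      g-L {u} {τ} {s} F sS sτ uτ = lem (in? u S)
        where
        lem : u ∈ S ⊎ u ∉ S → g u ≡ L s u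
        lem (inj₁ i) = trans (g-S i) (sym (f-potential (proj₁ F) sS i sτ uτ))
        lem (inj₂ o) = g-T o F sS sτ uτ
      check : IsCoboundaryOf g
      check h up vp with reach-S h up vp
      ... | q , s , F , sS , sq , uq , vq =
        trans (cong (_+ _) (g-L F sS sq uq)) (trans (L-T (proj₁ F) sq uq vq) (sym (g-L F sS sq vq)))

    Jump : Set
    Jump = ∃ λ x → ∃ λ u → ∃ λ a → ∃ λ b → x ∉ S × u ∉ S × x ≢ u × a ∈ S × b ∈ S ×
      Face (∁ S ⊟ x ⊞ a) × Face (∁ S ⊟ x ⊞ b) × L a u ≢ L b u

    Jump? : Dec Jump
    Jump? = any? λ x → any? λ u → any? λ a → any? λ b → (x ∉? S) ×-dec (u ∉? S) ×-dec ¬? (x ≟ u) ×-dec (a ∈? S) ×-dec (b ∈? S)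
      ×-dec Face? (∁ S ⊟ x ⊞ a) ×-dec Face? (∁ S ⊟ x ⊞ b) ×-dec ¬? (L a u ℚP.≟ L b u)

    -- When T is a facet, its level is declared to be that of the neighbour across `y`; this is the
    -- role of the default `true`. The ridge `∁ S ⊟ y` is then flat, and `bd-T` carries this to all
    -- ridges of T through `u`.
    start-T : Face (∁ S) → ∀ u → u ∉ S → Start u
    start-T h u uo with avoid-T (u ∷ []) (s≤s (s≤s z≤n))
    ... | y , yo , yu ∷ [] with other-side h yo
    ...   | z , zS , hz = record
      { w = L z u
      ; flat = λ x xo ux → trans (bd-T uo xo yo ux (yu ∘ sym)) flat-y
      ; τ₀ = ∁ S ⊟ y ⊞ z ; τ₀-facet = hz , size-T⊟⊞ yo zS ; u∈τ₀ = ⊞-old u∈ ; E-τ₀ = E-z }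
      where
      z∉ : z ∉ ∁ S ⊟ y
      z∉ = ⊟-out (∁-out zS)
      u∈ : u ∈ ∁ S ⊟ y
      u∈ = ⊟-keep (yu ∘ sym) (∁-in uo)
      E-z : E u (L z u) true (∁ S ⊟ y ⊞ z) ≡ true
      E-z = trans (E-value hz zS ⊞-new (⊞-old u∈)) (isYes-yes {d = L z u ℚP.≟ L z u} refl)
      T≡ : ∁ S ⊟ y ⊞ y ≡ ∁ S
      T≡ = ⊟⊞ (∁-in yo)
      flat-y : bd (E u (L z u) true) (∁ S ⊟ y) ≡ false
      flat-y = trans (bd-pair {E u (L z u) true} (size-T⊟ yo) E-nonface (λ e → in∧out zS (subst (_∉ S) e yo)) ⊟-gone z∉ (subst Face (sym T≡) h) hz)
        (cong₂ _xor_ (trans (cong (E u (L z u) true) T≡) (E-T h λ s i → ∁-out i)) E-z)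

    start-flat : ¬ Face (∁ S) → ¬ Jump → ∀ u → u ∉ S → Start u
    start-flat nf nj u uo with reach-S (vertex u) ⊞-new ⊞-new
    ... | τ , s , F , sS , sτ , uτ , _ = record
      { w = L s u ; flat = flat ; τ₀ = τ ; τ₀-facet = F ; u∈τ₀ = uτ
      ; E-τ₀ = trans (E-value (proj₁ F) sS sτ uτ) (isYes-yes {d = L s u ℚP.≟ L s u} refl) }
      where
      flat : ∀ x → x ∉ S → u ≢ x → bd (E u (L s u) true) (∁ S ⊟ x) ≡ false
      flat x xo ux = bd-closed {E u (L s u) true} (size-T⊟ xo) E-nonface same
        where
        uT : u ∈ ∁ S ⊟ x
        uT = ⊟-keep ux (∁-in uo)
        same : ∀ a b → a ∉ ∁ S ⊟ x → b ∉ ∁ S ⊟ x → Face (∁ S ⊟ x ⊞ a) → Face (∁ S ⊟ x ⊞ b) →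
          E u (L s u) true (∁ S ⊟ x ⊞ a) ≡ E u (L s u) true (∁ S ⊟ x ⊞ b)
        same a b ao bo fa fb with L a u ℚP.≟ L b u
        ... | yes e = trans (E-value fa (beyond nf xo ao fa) ⊞-new (⊞-old uT)) (trans (cong (λ l → ⌊ l ℚP.≟ L s u ⌋) e)
                        (sym (E-value fb (beyond nf xo bo fb) ⊞-new (⊞-old uT))))
        ... | no ne = contradiction (x , u , a , b , xo , uo , ux ∘ sym , beyond nf xo ao fa , beyond nf xo bo fb , fa , fb , ne) nj

  module Bicoloured {m n : ℕ} {Δ : Subset m → Bool} (pm : IsPM n Δ) (n≥5 : 5 ≤ n) (co : Cocycle Δ) (pair : Pair n Δ)
    (T-nonface : ¬ IsFace Δ (∁ (Pair.S pair))) {x₀ u₀ a b : Fin m}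
    (x₀∉S : x₀ ∉ Pair.S pair) (u₀∉S : u₀ ∉ Pair.S pair) (x₀≢u₀ : x₀ ≢ u₀) (a∈S : a ∈ Pair.S pair) (b∈S : b ∈ Pair.S pair)
    (face-a : IsFace Δ (∁ (Pair.S pair) ⊟ x₀ ⊞ a)) (face-b : IsFace Δ (∁ (Pair.S pair) ⊟ x₀ ⊞ b))
    (differ₀ : Levels.L pm n≥5 co pair a u₀ ≢ Levels.L pm n≥5 co pair b u₀) where
    open Pair pair
    open Levels pm n≥5 co pair
    open IsPM pm
    open Cocycle co

    private
      V : Set
      V = Fin m

      in-T₀ : ∀ {u s} → u ∉ S → u ≢ x₀ → u ∈ ∁ S ⊟ x₀ ⊞ s
      in-T₀ uo ux = ⊞-old (⊟-keep ux (∁-in uo))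

      differ : ∀ {u} → u ∉ S → u ≢ x₀ → L a u ≢ L b u
      differ {u} uo ux e = differ₀ (trans (sym (L-T face-a ⊞-new (in-T₀ uo ux) (in-T₀ u₀∉S (x₀≢u₀ ∘ sym))))
        (trans (cong (_+ φ u u₀) e) (L-T face-b ⊞-new (in-T₀ uo ux) (in-T₀ u₀∉S (x₀≢u₀ ∘ sym)))))

      -- The potential on T on the side of `a`. The facet `∁ S ⊟ x₀ ⊞ a` reaches all of T but `x₀`,
      -- which gets its value through `u₀`.
      g : V → ℚ
      g u = if ⌊ u ≟ x₀ ⌋ then L a u₀ + φ u₀ x₀ else L a u

      g-off : ∀ {u} → u ≢ x₀ → g u ≡ L a u
      g-off {u} ne rewrite isYes-no {d = u ≟ x₀} ne = refl

      g-x₀ : g x₀ ≡ L a u₀ + φ u₀ x₀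
      g-x₀ rewrite isYes-yes {d = x₀ ≟ x₀} refl = refl

      -- Over the ridge `∁ S ⊟ x₀` only the facet with apex `a` has the level `g u`, so the boundary
      -- is odd there, and by `bd-T` also at the other ridges of ∂T through `u`.
      jump-at : ∀ {u x} → u ∉ S → x ∉ S → u ≢ x₀ → u ≢ x → bd (E u (g u) false) (∁ S ⊟ x) ≡ true
      jump-at {u} {x} uo xo ux₀ ux = trans (bd-T uo xo x₀∉S ux ux₀)
        (trans (bd-pair {E u (g u) false} (size-T⊟ x₀∉S) E-nonface (λ e → differ uo ux₀ (cong (λ s → L s u) e))
                  (⊟-out (∁-out a∈S)) (⊟-out (∁-out b∈S)) face-a face-b)
          (cong₂ _xor_ (trans (E-value face-a a∈S ⊞-new (in-T₀ uo ux₀)) (isYes-yes {d = L a u ℚP.≟ g u} (sym (g-off ux₀))))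
            (trans (E-value face-b b∈S ⊞-new (in-T₀ uo ux₀)) (isYes-no {d = L b u ℚP.≟ g u} λ e → differ uo ux₀ (sym (trans e (g-off ux₀)))))))

      pick : ∀ x → ∃ λ u → u ∉ S × u ≢ x₀ × u ≢ x
      pick x with avoid-T (x₀ ∷ x ∷ []) (s≤s (s≤s (s≤s z≤n)))
      ... | u , uo , p ∷ q ∷ [] = u , uo , p , q

      E-face : ∀ {u w d τ} → E u w d τ ≡ true → Face τ
      E-face {u} {w} {d} {τ} e with face? τ
      ... | inj₁ h = h
      ... | inj₂ h = true≢false e (E-nonface τ h)

      -- An odd boundary coefficient requires a facet above the ridge, so all of ∂T belongs to the
      -- complex.
      T-face : ∀ {y} → y ∉ S → Face (∁ S ⊟ y)
      T-face {y} yo with pick y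
      ... | u , uo , ux₀ , uy with bd-witness {D = E u (g u) false} (jump-at uo yo ux₀ uy)
      ...   | c , _ , e = down (λ _ i → ⊞-old i) (E-face e)

      g-potential : ∀ {u v} → u ∉ S → v ∉ S → g u + φ u v ≡ g v
      g-potential {u} {v} uo vo = lem (u ≟ x₀) (v ≟ x₀)
        where
        to-x₀ : ∀ {u} → u ∉ S → u ≢ x₀ → g u + φ u x₀ ≡ g x₀
        to-x₀ {u} uo ux with avoid-T (u ∷ u₀ ∷ x₀ ∷ []) (s≤s (s≤s (s≤s (s≤s z≤n))))
        ... | y , yo , yu ∷ yu₀ ∷ yx₀ ∷ [] = trans (cong (_+ φ u x₀) (trans (g-off ux)
                (sym (L-T face-a ⊞-new (in-T₀ u₀∉S (x₀≢u₀ ∘ sym)) (in-T₀ uo ux)))))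
              (trans (ℚP.+-assoc (L a u₀) _ _) (trans (cong (L a u₀ +_)
                (cocycle (T-face yo) (⊟-keep (yu₀ ∘ sym) (∁-in u₀∉S)) (⊟-keep (yu ∘ sym) (∁-in uo)) (⊟-keep (yx₀ ∘ sym) (∁-in x₀∉S)))) (sym g-x₀)))
        lem : Dec (u ≡ x₀) → Dec (v ≡ x₀) → g u + φ u v ≡ g v
        lem (yes refl) (yes refl) = trans (cong (g x₀ +_) (φ-diag (vertex x₀) ⊞-new)) (ℚP.+-identityʳ _)
        lem (no ux) (yes refl) = to-x₀ uo ux
        lem (no ux) (no vx) = trans (cong (_+ φ u v) (g-off ux)) (trans (L-T face-a ⊞-new (in-T₀ uo ux) (in-T₀ vo vx)) (sym (g-off vx)))
        lem (yes refl) (no vx) with avoid-T (x₀ ∷ v ∷ []) (s≤s (s≤s (s≤s z≤n)))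
        ... | y , yo , yx₀ ∷ yv ∷ [] = trans (cong (_+ φ x₀ v) (sym (to-x₀ vo vx)))
              (φ-return (g v) (T-face yo) (⊟-keep (yv ∘ sym) (∁-in vo)) (⊟-keep (yx₀ ∘ sym) (∁-in x₀∉S)))

      -- `true` is the side on which `g` continues the potential; all other levels are lumped
      -- together as `false`.
      colour : V → V → Bool
      colour s u = ⌊ L s u ℚP.≟ g u ⌋

      colour-T : ∀ {p s u v} → Face p → s ∈ S → u ∉ S → v ∉ S → s ∈ p → u ∈ p → v ∈ p → colour s u ≡ colour s v
      colour-T {s = s} {u} {v} h sS uo vo sp up vp with L s u ℚP.≟ g u
      ... | yes e = sym (isYes-yes {d = L s v ℚP.≟ g v} (trans (sym (L-T h sp up vp)) (trans (cong (_+ φ u v) e) (g-potential uo vo))))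
      ... | no ne = sym (isYes-no {d = L s v ℚP.≟ g v} λ e → ne (trans (sym (L-T h sp vp up))
                      (trans (cong (_+ φ v u) e) (g-potential vo uo))))

      -- By `jump-at` exactly one of the two facets on `∁ S ⊟ x` has the level `g u`. As colours are
      -- constant along a face, what holds for the witness `u` holds for the whole ridge.
      both-sides : ∀ x col → x ∉ S → ∃ λ c → c ∈ S × Face (∁ S ⊟ x ⊞ c) × (∀ t → t ∉ S → t ≢ x → colour c t ≡ col)
      both-sides x col xo with pick x
      ... | u , uo , ux₀ , ux with bd-witness {D = E u (g u) false} (jump-at uo xo ux₀ ux)
      ...   | c , co , e with two {∁ S ⊟ x} {c} (size-T⊟ xo) co (E-face e)
      ...     | d , dc , do′ , fd , _ = choose col
        where
        fc : Face (∁ S ⊟ x ⊞ c)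
        fc = E-face e
        spread : ∀ {c v} → (fc : Face (∁ S ⊟ x ⊞ c)) → c ∉ ∁ S ⊟ x → E u (g u) false (∁ S ⊟ x ⊞ c) ≡ v →
          ∀ t → t ∉ S → t ≢ x → colour c t ≡ v
        spread fc co e t to tx = trans (colour-T fc (beyond T-nonface xo co fc) to uo ⊞-new (⊞-old (⊟-keep tx (∁-in to))) (⊞-old (⊟-keep ux (∁-in uo))))
          (trans (sym (E-value fc (beyond T-nonface xo co fc) ⊞-new (⊞-old (⊟-keep ux (∁-in uo))))) e)
        e′ : E u (g u) false (∁ S ⊟ x ⊞ d) ≡ false
        e′ = flip (E u (g u) false (∁ S ⊟ x ⊞ c)) _ e (trans (sym (bd-pair {E u (g u) false} (size-T⊟ xo) E-nonface (dc ∘ sym) co do′ fc fd)) (jump-at uo xo ux₀ ux))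
          where
          flip : ∀ p q → p ≡ true → p xor q ≡ true → q ≡ false
          flip true false _ _ = refl
        choose : ∀ col → ∃ λ c → c ∈ S × Face (∁ S ⊟ x ⊞ c) × (∀ t → t ∉ S → t ≢ x → colour c t ≡ col)
        choose true  = c , beyond T-nonface xo co fc , fc , spread fc co e
        choose false = d , beyond T-nonface xo do′ fd , fd , spread fd do′ e′

    split : Split n Δ
    split = record
      { S = S ; colour = colour ; size-S = size-S ; size-T = size-T
      ; colour-S = λ {p} {s} {s′} {u} h i i′ _ sp sp′ up → cong (λ l → ⌊ l ℚP.≟ g u ⌋) (L-S h i i′ sp sp′ up)
      ; colour-T = colour-T ; both-sides = both-sides ; missing = T-nonface
      ; s₀ = s₀ ; s₁ = s₁ ; s₀≢s₁ = s₀≢s₁ ; s₀∈S = s₀∈S ; s₁∈S = s₁∈S ; face₀ = face₀ ; face₁ = face₁ }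

  split-or-coboundary : ∀ {m n} {Δ : Subset m → Bool} → IsPM n Δ → 5 ≤ n → m ≡ suc (n ℕ.+ n) → (co : Cocycle Δ) →
    Split n Δ ⊎ ∃ (Cocycle.IsCoboundaryOf co)
  split-or-coboundary {Δ = Δ} pm n≥5 m≡ co = go (FindPair.pair pm n≥5 m≡)
    where
    go : Pair _ Δ → Split _ Δ ⊎ ∃ (Cocycle.IsCoboundaryOf co)
    go pr with IsPM.Face? pm (∁ (Pair.S pr))
    ... | yes h = inj₂ (Levels.coboundary pm n≥5 co pr (Levels.start-T pm n≥5 co pr h))
    ... | no nf with Levels.Jump? pm n≥5 co pr
    ...   | yes (_ , _ , _ , _ , xo , uo , xu , aS , bS , fa , fb , ne) =
              inj₁ (Bicoloured.split pm n≥5 co pr nf xo uo xu aS bS fa fb ne)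
    ...   | no nj = inj₂ (Levels.coboundary pm n≥5 co pr (Levels.start-flat pm n≥5 co pr nf nj))

open Bicolourings

-- Rational chains, cochains and the Fredholm alternative.

module RationalChains where
  open import Data.Rational using (_+_; _*_; -_; _-_)

  ==ˢ-refl : ∀ {m} (S : Subset m) → (S ==ˢ S) ≡ true
  ==ˢ-refl S = isYes-yes {d = VecP.≡-dec BoolP._≟_ S S} refl

  ==ˢ-true : ∀ {m} {S S′ : Subset m} → (S ==ˢ S′) ≡ true → S ≡ S′
  ==ˢ-true {S = S} {S′} = isYes-true {d = VecP.≡-dec BoolP._≟_ S S′}

  ==ˢ-false : ∀ {m} {S S′ : Subset m} → S ≢ S′ → (S ==ˢ S′) ≡ false
  ==ˢ-false {S = S} {S′} = isYes-no {d = VecP.≡-dec BoolP._≟_ S S′}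

  Σˢ : ∀ {m} → (Subset m → ℚ) → ℚ
  Σˢ {zero}  f = f []
  Σˢ {suc m} f = Σˢ (λ σ → f (true ∷ σ)) + Σˢ (λ σ → f (false ∷ σ))

  Σˢ-cong : ∀ {m} {f g : Subset m → ℚ} → (∀ σ → f σ ≡ g σ) → Σˢ f ≡ Σˢ g
  Σˢ-cong {zero}  h = h []
  Σˢ-cong {suc m} h = cong₂ _+_ (Σˢ-cong λ σ → h (true ∷ σ)) (Σˢ-cong λ σ → h (false ∷ σ))

  Σˢ-0 : ∀ {m} {f : Subset m → ℚ} → (∀ σ → f σ ≡ 0ℚ) → Σˢ f ≡ 0ℚ
  Σˢ-0 {zero}  h = h []
  Σˢ-0 {suc m} h = trans (cong₂ _+_ (Σˢ-0 λ σ → h (true ∷ σ)) (Σˢ-0 λ σ → h (false ∷ σ))) (ℚP.+-identityˡ 0ℚ)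

  Σˢ-+ : ∀ {m} (f g : Subset m → ℚ) → Σˢ (λ σ → f σ + g σ) ≡ Σˢ f + Σˢ g
  Σˢ-+ {zero}  f g = refl
  Σˢ-+ {suc m} f g = trans (cong₂ _+_ (Σˢ-+ (f ∘ (true ∷_)) (g ∘ (true ∷_))) (Σˢ-+ (f ∘ (false ∷_)) (g ∘ (false ∷_))))
    (solve 4 (λ a b c d → (a :+ b) :+ (c :+ d) := (a :+ c) :+ (b :+ d)) refl
      (Σˢ (f ∘ (true ∷_))) (Σˢ (g ∘ (true ∷_))) (Σˢ (f ∘ (false ∷_))) (Σˢ (g ∘ (false ∷_))))
    where open +-*-Solver

  Σˢ-* : ∀ {m} q (f : Subset m → ℚ) → Σˢ (λ σ → q * f σ) ≡ q * Σˢ f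
  Σˢ-* {zero}  q f = refl
  Σˢ-* {suc m} q f = trans (cong₂ _+_ (Σˢ-* q (f ∘ (true ∷_))) (Σˢ-* q (f ∘ (false ∷_)))) (sym (ℚP.*-distribˡ-+ q _ _))

  δ : ∀ {m} → Subset m → ℚ → Subset m → ℚ
  δ τ q σ = if τ ==ˢ σ then q else 0ℚ

  δ-≢ : ∀ {m} (τ : Subset m) q σ → τ ≢ σ → δ τ q σ ≡ 0ℚ
  δ-≢ τ q σ ne = cong (λ z → if z then q else 0ℚ) (==ˢ-false ne)

  δ-same : ∀ {m} (τ : Subset m) q → δ τ q τ ≡ q
  δ-same τ q = cong (λ z → if z then q else 0ℚ) (==ˢ-refl τ)

  δ-∷ : ∀ {m} b (τ : Subset m) q σ → δ (b ∷ τ) q (b ∷ σ) ≡ δ τ q σ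
  δ-∷ b τ q σ = lem (VecP.≡-dec BoolP._≟_ τ σ)
    where
    lem : Dec (τ ≡ σ) → δ (b ∷ τ) q (b ∷ σ) ≡ δ τ q σ
    lem (yes refl) = trans (δ-same (b ∷ τ) q) (sym (δ-same τ q))
    lem (no ne)    = trans (δ-≢ (b ∷ τ) q (b ∷ σ) (ne ∘ VecP.∷-injectiveʳ)) (sym (δ-≢ τ q σ ne))

  Σˢ-δ : ∀ {m} (f : Subset m → ℚ) τ q → Σˢ (λ σ → f σ * δ τ q σ) ≡ f τ * q
  Σˢ-δ {zero} f [] q = cong (f [] *_) (δ-same [] q)
  Σˢ-δ {suc m} f (true ∷ τ) q = trans (cong₂ _+_
      (trans (Σˢ-cong λ σ → cong (f (true ∷ σ) *_) (δ-∷ true τ q σ)) (Σˢ-δ (f ∘ (true ∷_)) τ q))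
      (Σˢ-0 λ σ → trans (cong (f (false ∷ σ) *_) (δ-≢ (true ∷ τ) q (false ∷ σ) λ ())) (ℚP.*-zeroʳ (f (false ∷ σ))))) (ℚP.+-identityʳ (f (true ∷ τ) * q))
  Σˢ-δ {suc m} f (false ∷ τ) q = trans (cong₂ _+_
      (Σˢ-0 λ σ → trans (cong (f (true ∷ σ) *_) (δ-≢ (false ∷ τ) q (true ∷ σ) λ ())) (ℚP.*-zeroʳ (f (true ∷ σ))))
      (trans (Σˢ-cong λ σ → cong (f (false ∷ σ) *_) (δ-∷ false τ q σ)) (Σˢ-δ (f ∘ (false ∷_)) τ q))) (ℚP.+-identityˡ (f (false ∷ τ) * q))

  ⟨_,_⟩ : ∀ {m} → (Subset m → ℚ) → (Subset m → ℚ) → ℚ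
  ⟨ ψ , h ⟩ = Σˢ λ σ → ψ σ * h σ

  ⟨⟩-cong : ∀ {m} {ψ : Subset m → ℚ} {h h′} → (∀ σ → h σ ≡ h′ σ) → ⟨ ψ , h ⟩ ≡ ⟨ ψ , h′ ⟩
  ⟨⟩-cong {ψ = ψ} e = Σˢ-cong λ σ → cong (ψ σ *_) (e σ)

  ⟨⟩-linearʳ : ∀ {m} (ψ : Subset m → ℚ) q h h′ → ⟨ ψ , (λ σ → q * h σ + h′ σ) ⟩ ≡ q * ⟨ ψ , h ⟩ + ⟨ ψ , h′ ⟩
  ⟨⟩-linearʳ ψ q h h′ = trans (Σˢ-cong λ σ → rearrange (ψ σ) (h σ) (h′ σ))
    (trans (Σˢ-+ (λ σ → q * (ψ σ * h σ)) (λ σ → ψ σ * h′ σ)) (cong (_+ ⟨ ψ , h′ ⟩) (Σˢ-* q (λ σ → ψ σ * h σ))))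
    where
    open +-*-Solver
    rearrange : ∀ a b c → a * (q * b + c) ≡ q * (a * b) + a * c
    rearrange = solve 4 (λ q a b c → a :* (q :* b :+ c) := q :* (a :* b) :+ a :* c) refl q

  ⟨⟩-linearˡ : ∀ {m} q (ψ ψ′ h : Subset m → ℚ) → ⟨ (λ σ → q * ψ σ + ψ′ σ) , h ⟩ ≡ q * ⟨ ψ , h ⟩ + ⟨ ψ′ , h ⟩
  ⟨⟩-linearˡ q ψ ψ′ h = trans (Σˢ-cong λ σ → rearrange (ψ σ) (ψ′ σ) (h σ))
    (trans (Σˢ-+ (λ σ → q * (ψ σ * h σ)) (λ σ → ψ′ σ * h σ)) (cong (_+ ⟨ ψ′ , h ⟩) (Σˢ-* q (λ σ → ψ σ * h σ))))
    where
    open +-*-Solver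
    rearrange : ∀ a b c → (q * a + b) * c ≡ q * (a * c) + b * c
    rearrange = solve 4 (λ q a b c → (q :* a :+ b) :* c := q :* (a :* c) :+ b :* c) refl q

  ⟨⟩-0 : ∀ {m} (ψ : Subset m → ℚ) → ⟨ ψ , (λ _ → 0ℚ) ⟩ ≡ 0ℚ
  ⟨⟩-0 ψ = Σˢ-0 λ σ → ℚP.*-zeroʳ (ψ σ)

  sign : Bool → ℚ
  sign p = if p then - 1ℚ else 1ℚ

  -- Simplices built from `⊥` by updates, so that they compute along the recursion of `incS′`.
  e₁ : ∀ {m} → Fin m → Subset m
  e₁ w = ⊥ [ w ]≔ true

  e₂ : ∀ {m} → Fin m → Fin m → Subset m
  e₂ v w = e₁ w [ v ]≔ true

  e₃ : ∀ {m} → Fin m → Fin m → Fin m → Subset m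
  e₃ u v w = e₂ v w [ u ]≔ true

  inc-true : ∀ {m} (ψ : Subset (suc m) → ℚ) p τ → ⟨ ψ , incS′ p (true ∷ τ) ⟩ ≡ ⟨ ψ ∘ (true ∷_) , incS′ (not p) τ ⟩ + ψ (false ∷ τ) * sign p
  inc-true ψ p τ = cong (⟨ ψ ∘ (true ∷_) , incS′ (not p) τ ⟩ +_) (Σˢ-δ (ψ ∘ (false ∷_)) τ (sign p))

  inc-false : ∀ {m} (ψ : Subset (suc m) → ℚ) p τ → ⟨ ψ , incS′ p (false ∷ τ) ⟩ ≡ ⟨ ψ ∘ (false ∷_) , incS′ p τ ⟩
  inc-false ψ p τ = trans (cong (_+ ⟨ ψ ∘ (false ∷_) , incS′ p τ ⟩) (⟨⟩-0 (ψ ∘ (true ∷_)))) (ℚP.+-identityˡ _)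

  inc-⊥ : ∀ {m} p (σ : Subset m) → incS′ p ⊥ σ ≡ 0ℚ
  inc-⊥ p []          = refl
  inc-⊥ p (true ∷ σ)  = refl
  inc-⊥ p (false ∷ σ) = inc-⊥ p σ

  pair-⊥ : ∀ {m} (ψ : Subset m → ℚ) p → ⟨ ψ , incS′ p ⊥ ⟩ ≡ 0ℚ
  pair-⊥ ψ p = Σˢ-0 λ σ → trans (cong (ψ σ *_) (inc-⊥ p σ)) (ℚP.*-zeroʳ (ψ σ))

  pair-e₁ : ∀ {m} (ψ : Subset m → ℚ) p w → ⟨ ψ , incS′ p (e₁ w) ⟩ ≡ sign p * ψ ⊥
  pair-e₁ ψ p zero    = trans (inc-true ψ p ⊥) (trans (cong (_+ ψ ⊥ * sign p) (pair-⊥ (ψ ∘ (true ∷_)) (not p)))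
                          (trans (ℚP.+-identityˡ _) (ℚP.*-comm (ψ ⊥) (sign p))))
  pair-e₁ ψ p (suc w) = trans (inc-false ψ p (e₁ w)) (pair-e₁ (ψ ∘ (false ∷_)) p w)

  sign-not : ∀ p → sign (not p) ≡ - sign p
  sign-not true  = refl
  sign-not false = refl

  pair-e₂ : ∀ {m} (ψ : Subset m → ℚ) p {v w} → v Fin.< w → ⟨ ψ , incS′ p (e₂ v w) ⟩ ≡ sign p * (ψ (e₁ w) - ψ (e₁ v))
  pair-e₂ ψ p {zero}  {suc w} _ = trans (inc-true ψ p (e₁ w)) (trans (cong (_+ ψ (false ∷ e₁ w) * sign p)
      (trans (pair-e₁ (ψ ∘ (true ∷_)) (not p) w) (cong (_* ψ (true ∷ ⊥)) (sign-not p))))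
      (solve 3 (λ s a b → (:- s) :* a :+ b :* s := s :* (b :+ (:- a))) refl (sign p) (ψ (true ∷ ⊥)) (ψ (false ∷ e₁ w))))
    where open +-*-Solver
  pair-e₂ ψ p {suc v} {suc w} (s≤s v<w) = trans (inc-false ψ p (e₂ v w)) (pair-e₂ (ψ ∘ (false ∷_)) p v<w)

  -- The simplicial coboundary formula; `sign p` accounts for the vertices of the simplex already
  -- passed in the recursion.
  pair-e₃ : ∀ {m} (ψ : Subset m → ℚ) p {u v w} → u Fin.< v → v Fin.< w →
    ⟨ ψ , incS′ p (e₃ u v w) ⟩ ≡ sign p * (ψ (e₂ v w) - ψ (e₂ u w) + ψ (e₂ u v))
  pair-e₃ ψ p {zero} {suc v} {suc w} _ (s≤s v<w) = trans (inc-true ψ p (e₂ v w)) (trans (cong (_+ ψ (false ∷ e₂ v w) * sign p)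
      (trans (pair-e₂ (ψ ∘ (true ∷_)) (not p) v<w) (cong (_* (ψ (true ∷ e₁ w) - ψ (true ∷ e₁ v))) (sign-not p))))
      (solve 4 (λ s a b c → (:- s) :* (a :+ (:- b)) :+ c :* s := s :* (c :+ (:- a) :+ b)) refl (sign p) (ψ (true ∷ e₁ w)) (ψ (true ∷ e₁ v)) (ψ (false ∷ e₂ v w))))
    where open +-*-Solver
  pair-e₃ ψ p {suc u} {suc v} {suc w} (s≤s u<v) (s≤s v<w) = trans (inc-false ψ p (e₃ u v w)) (pair-e₃ (ψ ∘ (false ∷_)) p u<v v<w)

  e₁≡⁅⁆ : ∀ {m} (w : Fin m) → e₁ w ≡ ⁅ w ⁆
  e₁≡⁅⁆ w = trans (sym (⊞-≔ ⊥ w)) (sym (⁅⁆≡⊥⊞ w))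

  e₂≡⊞ : ∀ {m} (v w : Fin m) → e₂ v w ≡ ⊥ ⊞ w ⊞ v
  e₂≡⊞ v w = trans (cong (_[ v ]≔ true) (sym (⊞-≔ ⊥ w))) (sym (⊞-≔ _ v))

  e₃≡⊞ : ∀ {m} (u v w : Fin m) → e₃ u v w ≡ ⊥ ⊞ w ⊞ v ⊞ u
  e₃≡⊞ u v w = trans (cong (_[ u ]≔ true) (e₂≡⊞ v w)) (sym (⊞-≔ _ u))

  size1 : ∀ {m} (τ : Subset m) → ∣ τ ∣ ≡ 1 → ∃ λ v → τ ≡ ⁅ v ⁆
  size1 {m} τ e with inhabited τ (ℕP.≤-reflexive (sym e))
  ... | v , i = v , sym (⊑-size sub (ℕP.≤-reflexive (trans e (sym s))))
    where
    sub : ⁅ v ⁆ ⊑ τ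
    sub y j with ⊞-inv (subst (y ∈_) (⁅⁆≡⊥⊞ v) j)
    ... | inj₁ refl = i
    ... | inj₂ k    = in∧out k ∉⊥
    s : ∣ ⁅ v ⁆ ∣ ≡ 1
    s = trans (cong ∣_∣ (⁅⁆≡⊥⊞ v)) (trans (size-⊞ ∉⊥) (cong suc (size-⊥ m)))

  size2 : ∀ {m} (τ : Subset m) → ∣ τ ∣ ≡ 2 → ∃ λ v → ∃ λ w → v Fin.< w × v ∈ τ × w ∈ τ × τ ≡ e₂ v w
  size2 {m} τ e with inhabited τ (ℕP.≤-trans (s≤s z≤n) (ℕP.≤-reflexive (sym e)))
  ... | a , i with size1 (τ ⊟ a) (ℕP.suc-injective (trans (size-⊟ i) e))
  ...   | b , eq = order (FinP.<-cmp a b)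
    where
    b∈ : b ∈ τ ⊟ a
    b∈ = subst (b ∈_) (sym eq) ∈⁅⁆
    τ≡ : τ ≡ ⊥ ⊞ b ⊞ a
    τ≡ = trans (sym (⊟⊞ i)) (cong (_⊞ a) (trans eq (⁅⁆≡⊥⊞ b)))
    order : _ → _
    order (tri< p _ _) = a , b , p , i , ⊟-sub b b∈ , trans τ≡ (sym (e₂≡⊞ a b))
    order (tri≈ _ p _) = contradiction (sym p) (proj₁ (⊟-inv b∈))
    order (tri> _ _ p) = b , a , p , ⊟-sub b b∈ , i , trans τ≡ (trans (⊞-comm ⊥ b a) (sym (e₂≡⊞ b a)))

  -- A function on vertices as a 0-cochain; it is zero on the empty set, which is a cell of the
  -- augmented complex.
  single : ∀ {m} → (Fin m → ℚ) → Subset m → ℚ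
  single g σ with any? (λ w → VecP.≡-dec BoolP._≟_ σ ⁅ w ⁆)
  ... | yes (w , _) = g w
  ... | no _        = 0ℚ

  ⁅⁆-injective : ∀ {m} {v w : Fin m} → ⁅ v ⁆ ≡ ⁅ w ⁆ → v ≡ w
  ⁅⁆-injective {v = v} {w} e with ⊞-inv (subst (v ∈_) (trans e (⁅⁆≡⊥⊞ w)) ∈⁅⁆)
  ... | inj₁ p = p
  ... | inj₂ k = in∧out k ∉⊥

  single-⁅⁆ : ∀ {m} (g : Fin m → ℚ) w → single g ⁅ w ⁆ ≡ g w
  single-⁅⁆ g w with any? (λ u → VecP.≡-dec BoolP._≟_ ⁅ w ⁆ ⁅ u ⁆)
  ... | yes (u , e) = cong g (sym (⁅⁆-injective e))
  ... | no none     = contradiction (w , refl) none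

  single-0 : ∀ {m} (g : Fin m → ℚ) σ → (∀ w → σ ≡ ⁅ w ⁆ → g w ≡ 0ℚ) → single g σ ≡ 0ℚ
  single-0 g σ h with any? (λ u → VecP.≡-dec BoolP._≟_ σ ⁅ u ⁆)
  ... | yes (u , e) = h u e
  ... | no none     = refl

  single-edge : ∀ {m} (g : Fin m → ℚ) {v w} → v Fin.< w → ⟨ single g , incS (e₂ v w) ⟩ ≡ g w - g v
  single-edge g {v} {w} v<w = trans (pair-e₂ (single g) false v<w) (trans (ℚP.*-identityˡ _)
    (cong₂ _-_ (trans (cong (single g) (e₁≡⁅⁆ w)) (single-⁅⁆ g w)) (trans (cong (single g) (e₁≡⁅⁆ v)) (single-⁅⁆ g v))))

  module ChainComplex {m : ℕ} (Δ : SComplex m) where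
    private
      K : CellCx
      K = simplicialCx Δ

    pair-∂ : ∀ (ψ : Subset m → ℚ) c → (∀ τ q → (τ , q) ∈ˡ c → ⟨ ψ , incS τ ⟩ ≡ 0ℚ) → ⟨ ψ , ∂coeff K c ⟩ ≡ 0ℚ
    pair-∂ ψ [] h = ⟨⟩-0 ψ
    pair-∂ ψ ((τ , q) ∷ c) h = trans (⟨⟩-linearʳ ψ q (incS τ) (∂coeff K c))
      (trans (cong₂ (λ a b → q * a + b) (h τ q (here refl)) (pair-∂ ψ c λ τ q i → h τ q (there i)))
        (trans (ℚP.+-identityʳ _) (ℚP.*-zeroʳ q)))

    pair-coeff : ∀ (ψ χ : Subset m → ℚ) c → (∀ τ q → (τ , q) ∈ˡ c → ψ τ ≡ ⟨ χ , incS τ ⟩) →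
      ⟨ ψ , coeff K c ⟩ ≡ ⟨ χ , ∂coeff K c ⟩
    pair-coeff ψ χ [] h = trans (⟨⟩-0 ψ) (sym (⟨⟩-0 χ))
    pair-coeff ψ χ ((τ , q) ∷ c) h = begin
      ⟨ ψ , coeff K ((τ , q) ∷ c) ⟩               ≡⟨ ⟨⟩-cong {ψ = ψ} (λ σ → cong (_+ coeff K c σ) (sym (ℚP.*-identityˡ (δ τ q σ)))) ⟩
      ⟨ ψ , (λ σ → 1ℚ * δ τ q σ + coeff K c σ) ⟩  ≡⟨ ⟨⟩-linearʳ ψ 1ℚ (δ τ q) (coeff K c) ⟩
      1ℚ * ⟨ ψ , δ τ q ⟩ + ⟨ ψ , coeff K c ⟩      ≡⟨ cong₂ _+_ (trans (ℚP.*-identityˡ _) (Σˢ-δ ψ τ q)) (pair-coeff ψ χ c λ τ q i → h τ q (there i)) ⟩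
      ψ τ * q + ⟨ χ , ∂coeff K c ⟩                ≡⟨ cong (_+ ⟨ χ , ∂coeff K c ⟩) (trans (ℚP.*-comm (ψ τ) q) (cong (q *_) (h τ q (here refl)))) ⟩
      q * ⟨ χ , incS τ ⟩ + ⟨ χ , ∂coeff K c ⟩     ≡⟨ ⟨⟩-linearʳ χ q (incS τ) (∂coeff K c) ⟨
      ⟨ χ , ∂coeff K ((τ , q) ∷ c) ⟩              ∎
      where open ≡-Reasoning

    -- Gaussian elimination along `ts`. If the boundary of `t` depends on those of the rest, `t` may
    -- be dropped. Otherwise some `χ` kills the rest but not the boundary of `t`; subtracting a
    -- multiple of that boundary from `h` brings `h` into the kernel of `χ`, and the answer for the
    -- rest is corrected by `t` or by `χ`.
    fredholm-alternative : ∀ ts (h : Subset m → ℚ) →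
      (∃ λ d → (∀ τ q → (τ , q) ∈ˡ d → τ ∈ˡ ts) × (∀ σ → ∂coeff K d σ ≡ h σ)) ⊎
      (∃ λ ψ → (∀ t → t ∈ˡ ts → ⟨ ψ , incS t ⟩ ≡ 0ℚ) × ⟨ ψ , h ⟩ ≢ 0ℚ)
    fredholm-alternative [] h with anySubset? (λ σ → ¬? (h σ ℚP.≟ 0ℚ))
    ... | yes (σ , ne) = inj₂ (δ σ 1ℚ , (λ _ ()) , λ e → ne (trans (sym (trans (Σˢ-cong λ τ → ℚP.*-comm (δ σ 1ℚ τ) (h τ))
          (trans (Σˢ-δ h σ 1ℚ) (ℚP.*-identityʳ (h σ))))) e))
    ... | no none = inj₁ ([] , (λ _ _ ()) , λ σ → sym (zero-at σ (h σ ℚP.≟ 0ℚ)))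
      where
      zero-at : ∀ σ → Dec (h σ ≡ 0ℚ) → h σ ≡ 0ℚ
      zero-at σ (yes e) = e
      zero-at σ (no ne) = contradiction (σ , ne) none
    fredholm-alternative (t ∷ ts) h with fredholm-alternative ts (incS t)
    ... | inj₁ (e , e∈ , ∂e) with fredholm-alternative ts h
    ...   | inj₁ (d , d∈ , ∂d) = inj₁ (d , (λ τ q i → there (d∈ τ q i)) , ∂d)
    ...   | inj₂ (ψ , ψ0 , ne) = inj₂ (ψ , kills , ne)
      where
      kills : ∀ s → s ∈ˡ t ∷ ts → ⟨ ψ , incS s ⟩ ≡ 0ℚ
      kills s (there i)   = ψ0 s i
      kills s (here refl) = trans (⟨⟩-cong {ψ = ψ} λ σ → sym (∂e σ)) (pair-∂ ψ e λ τ q i → ψ0 τ (e∈ τ q i))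
    fredholm-alternative (t ∷ ts) h | inj₂ (χ , χ0 , a≢0) = reduce (fredholm-alternative ts h′)
      where
      open +-*-Solver
      instance
        a-nonZero : ℚ.NonZero ⟨ χ , incS t ⟩
        a-nonZero = ℚ.≢-nonZero a≢0
      a b β : ℚ
      a = ⟨ χ , incS t ⟩
      b = ℚ.1/ a
      β = ⟨ χ , h ⟩ * b
      b*a : b * a ≡ 1ℚ
      b*a = ℚP.*-inverseˡ a
      h′ : Subset m → ℚ
      h′ σ = (- β) * incS t σ + h σ
      reduce : (∃ λ d → (∀ τ q → (τ , q) ∈ˡ d → τ ∈ˡ ts) × (∀ σ → ∂coeff K d σ ≡ h′ σ)) ⊎
               (∃ λ ψ → (∀ s → s ∈ˡ ts → ⟨ ψ , incS s ⟩ ≡ 0ℚ) × ⟨ ψ , h′ ⟩ ≢ 0ℚ) →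
               (∃ λ d → (∀ τ q → (τ , q) ∈ˡ d → τ ∈ˡ t ∷ ts) × (∀ σ → ∂coeff K d σ ≡ h σ)) ⊎
               (∃ λ ψ → (∀ s → s ∈ˡ t ∷ ts → ⟨ ψ , incS s ⟩ ≡ 0ℚ) × ⟨ ψ , h ⟩ ≢ 0ℚ)
      reduce (inj₁ (d , d∈ , ∂d)) = inj₁ ((t , β) ∷ d , mem , λ σ → trans (cong (β * incS t σ +_) (∂d σ))
          (solve 3 (λ β i h → β :* i :+ ((:- β) :* i :+ h) := h) refl β (incS t σ) (h σ)))
        where
        mem : ∀ τ q → (τ , q) ∈ˡ (t , β) ∷ d → τ ∈ˡ t ∷ ts
        mem τ q (here refl) = here refl
        mem τ q (there i)   = there (d∈ τ q i)
      reduce (inj₂ (ψ , ψ0 , ne)) = inj₂ (ψ′ , kills , λ e → ne (trans same e))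
        where
        κ : ℚ
        κ = ⟨ ψ , incS t ⟩ * b
        ψ′ : Subset m → ℚ
        ψ′ σ = (- κ) * χ σ + ψ σ
        kills : ∀ s → s ∈ˡ t ∷ ts → ⟨ ψ′ , incS s ⟩ ≡ 0ℚ
        kills s (there i) = trans (⟨⟩-linearˡ (- κ) χ ψ (incS s)) (trans (cong₂ (λ x y → (- κ) * x + y) (χ0 s i) (ψ0 s i))
          (trans (ℚP.+-identityʳ _) (ℚP.*-zeroʳ (- κ))))
        kills s (here refl) = trans (⟨⟩-linearˡ (- κ) χ ψ (incS t)) (trans
          (solve 3 (λ p b a → (:- (p :* b)) :* a :+ p := p :* (con 1ℚ :+ (:- (b :* a)))) refl ⟨ ψ , incS t ⟩ b a)
          (trans (cong (λ z → ⟨ ψ , incS t ⟩ * (1ℚ + (- z))) b*a) (ℚP.*-zeroʳ ⟨ ψ , incS t ⟩)))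
        -- Correcting `h` by the boundary of `t` and correcting `ψ` by `χ` subtract the same number
        -- from `⟨ ψ , h ⟩`.
        same : ⟨ ψ , h′ ⟩ ≡ ⟨ ψ′ , h ⟩
        same = trans (⟨⟩-linearʳ ψ (- β) (incS t) h) (trans
          (solve 4 (λ c b p r → (:- (c :* b)) :* p :+ r := (:- (p :* b)) :* c :+ r) refl ⟨ χ , h ⟩ b ⟨ ψ , incS t ⟩ ⟨ ψ , h ⟩)
          (sym (⟨⟩-linearˡ (- κ) χ ψ h)))

open RationalChains

-- First homology vanishes when every cocycle has a potential.

module Cocycles where
  open import Data.Rational using (_+_; _*_; -_; _-_)

  T⇒≡ : ∀ {b} → T b → b ≡ true
  T⇒≡ {true} _ = refl

  ≡⇒T : ∀ {b} → b ≡ true → T b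
  ≡⇒T refl = _

  ∈-allSubsets : ∀ {m} (σ : Subset m) → σ ∈ˡ allSubsets m
  ∈-allSubsets []          = here refl
  ∈-allSubsets (true ∷ σ)  = ∈-++⁺ˡ (∈-map⁺ (true ∷_) (∈-allSubsets σ))
  ∈-allSubsets (false ∷ σ) = ∈-++⁺ʳ _ (∈-map⁺ (false ∷_) (∈-allSubsets σ))

  all-entries : ∀ {A : Set} {P : A × ℚ → Set} {c} → (∀ τ q → (τ , q) ∈ˡ c → P (τ , q)) → All P c
  all-entries h = All.tabulate λ {(τ , q)} i → h τ q i

  module FromFunctional {m : ℕ} {Δ : SComplex m} (down : ∀ {p q : Subset m} → p ⊑ q → IsFace Δ q → IsFace Δ p)
    (ψ : Subset m → ℚ) (kills : ∀ t → IsFace Δ t → ∣ t ∣ ≡ 3 → ⟨ ψ , incS t ⟩ ≡ 0ℚ) where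
    private
      V : Set
      V = Fin m

    abstract
      φ′ : (u v : V) → Tri (u Fin.< v) (u ≡ v) (v Fin.< u) → ℚ
      φ′ u v (tri< _ _ _) = ψ (e₂ u v)
      φ′ u v (tri≈ _ _ _) = 0ℚ
      φ′ u v (tri> _ _ _) = - ψ (e₂ v u)

      φ : V → V → ℚ
      φ u v = φ′ u v (FinP.<-cmp u v)

      φ-< : ∀ {u v} → u Fin.< v → φ u v ≡ ψ (e₂ u v)
      φ-< {u} {v} p with FinP.<-cmp u v
      ... | tri< _ _ _  = refl
      ... | tri≈ np _ _ = contradiction p np
      ... | tri> np _ _ = contradiction p np

      φ-> : ∀ {u v} → v Fin.< u → φ u v ≡ - ψ (e₂ v u)
      φ-> {u} {v} p with FinP.<-cmp u v
      ... | tri< _ _ np = contradiction p np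
      ... | tri≈ _ _ np = contradiction p np
      ... | tri> _ _ _  = refl

      φ-diag : ∀ u → φ u u ≡ 0ℚ
      φ-diag u with FinP.<-cmp u u
      ... | tri< _ ne _ = contradiction refl ne
      ... | tri≈ _ _ _  = refl
      ... | tri> _ ne _ = contradiction refl ne

      φ-anti : ∀ u v → φ v u ≡ - φ u v
      φ-anti u v with FinP.<-cmp u v
      ... | tri< p _ _    = φ-> p
      ... | tri≈ _ refl _ = φ-diag u
      ... | tri> _ _ p    = trans (φ-< p) (sym (solve 1 (λ a → :- (:- a) := a) refl (ψ (e₂ v u))))
        where open +-*-Solver

    -- The sum around a triangle is invariant under rotation and changes sign under a swap. It
    -- therefore suffices to treat sorted triples, where it is the pairing of `ψ` with the boundary
    -- of a triangle.
    Ω : V → V → V → ℚ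
    Ω u v w = φ u v + φ v w + φ w u

    private
      open +-*-Solver

      Ω-rotate : ∀ u v w → Ω u v w ≡ Ω v w u
      Ω-rotate u v w = solve 3 (λ a b c → a :+ b :+ c := b :+ c :+ a) refl (φ u v) (φ v w) (φ w u)

      Ω-swap : ∀ u v w → Ω u v w ≡ - Ω u w v
      Ω-swap u v w = trans (cong₂ _+_ (cong₂ _+_ (φ-anti v u) (φ-anti w v)) (φ-anti u w))
        (solve 3 (λ a b c → (:- a) :+ (:- b) :+ (:- c) := :- (c :+ b :+ a)) refl (φ v u) (φ w v) (φ u w))

      Ω-diag : ∀ u w → Ω u u w ≡ 0ℚ
      Ω-diag u w = trans (cong₂ _+_ (cong₂ _+_ (φ-diag u) refl) (φ-anti u w))
        (solve 1 (λ a → con 0ℚ :+ a :+ (:- a) := con 0ℚ) refl (φ u w))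

      neg-0 : ∀ {a} → a ≡ 0ℚ → - a ≡ 0ℚ
      neg-0 refl = refl

      Ω-sorted : ∀ {p u v w} → IsFace Δ p → u ∈ p → v ∈ p → w ∈ p → u Fin.< v → v Fin.< w → Ω u v w ≡ 0ℚ
      Ω-sorted {p} {u} {v} {w} f up vp wp u<v v<w = trans
        (cong₂ _+_ (cong₂ _+_ (φ-< u<v) (φ-< v<w)) (φ-> u<w))
        (trans (solve 3 (λ a b c → a :+ b :+ (:- c) := con 1ℚ :* (b :+ (:- c) :+ a)) refl (ψ (e₂ u v)) (ψ (e₂ v w)) (ψ (e₂ u w)))
          (trans (sym (pair-e₃ ψ false u<v v<w)) (kills (e₃ u v w) (subst (IsFace Δ) (sym eq) face) size)))
        where
        u<w : u Fin.< w
        u<w = ℕP.<-trans u<v v<w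
        eq : e₃ u v w ≡ ⊥ ⊞ w ⊞ v ⊞ u
        eq = e₃≡⊞ u v w
        sub : ⊥ ⊞ w ⊞ v ⊞ u ⊑ p
        sub y i with ⊞-inv i
        ... | inj₁ refl = up
        ... | inj₂ j with ⊞-inv j
        ...   | inj₁ refl = vp
        ...   | inj₂ k with ⊞-inv k
        ...     | inj₁ refl = wp
        ...     | inj₂ l = in∧out l ∉⊥
        face : IsFace Δ (⊥ ⊞ w ⊞ v ⊞ u)
        face = down sub f
        size : ∣ e₃ u v w ∣ ≡ 3
        size = trans (cong ∣_∣ eq) (trans (size-⊞ (⊞-out (FinP.<⇒≢ u<v) (⊞-out (FinP.<⇒≢ u<w) ∉⊥)))
          (cong suc (trans (size-⊞ (⊞-out (FinP.<⇒≢ v<w) ∉⊥)) (cong suc (trans (size-⊞ ∉⊥) (cong suc (size-⊥ m)))))))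

      Ω-min : ∀ {p u v w} → IsFace Δ p → u ∈ p → v ∈ p → w ∈ p → u Fin.< v → u Fin.< w → Ω u v w ≡ 0ℚ
      Ω-min {p} {u} {v} {w} f up vp wp u<v u<w with FinP.<-cmp v w
      ... | tri< q _ _    = Ω-sorted f up vp wp u<v q
      ... | tri≈ _ refl _ = trans (Ω-rotate u v v) (Ω-diag v u)
      ... | tri> _ _ q    = trans (Ω-swap u v w) (neg-0 (Ω-sorted f up wp vp u<w q))

      Ω-0 : ∀ {p u v w} → IsFace Δ p → u ∈ p → v ∈ p → w ∈ p → Ω u v w ≡ 0ℚ
      Ω-0 {p} {u} {v} {w} f up vp wp with FinP.<-cmp u v | FinP.<-cmp u w | FinP.<-cmp v w
      ... | tri≈ _ refl _ | _ | _ = Ω-diag u w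
      ... | _ | tri≈ _ refl _ | _ = trans (Ω-swap u v u) (neg-0 (Ω-diag u v))
      ... | _ | _ | tri≈ _ refl _ = trans (Ω-rotate u v v) (Ω-diag v u)
      ... | tri< a _ _ | tri< b _ _ | _ = Ω-min f up vp wp a b
      ... | tri> _ _ a | _ | tri< c _ _ = trans (Ω-rotate u v w) (Ω-min f vp wp up c a)
      ... | _ | tri> _ _ b | tri> _ _ c = trans (Ω-rotate u v w) (trans (Ω-rotate v w u) (Ω-min f wp up vp b c))
      ... | tri< a _ _ | tri> _ _ b | tri< c _ _ = contradiction (ℕP.<-trans a (ℕP.<-trans c b)) (ℕP.<-irrefl refl)
      ... | tri> _ _ a | tri< b _ _ | tri> _ _ c = contradiction (ℕP.<-trans a (ℕP.<-trans b c)) (ℕP.<-irrefl refl)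

    cocycle : Cocycle Δ
    cocycle = record { φ = φ ; cocycle = λ {p} {u} {v} {w} f up vp wp → trans
      (solve 3 (λ a b c → a :+ b := (a :+ b :+ c) :+ (:- c)) refl (φ u v) (φ v w) (φ w u))
      (trans (cong (_+ (- φ w u)) (Ω-0 f up vp wp)) (trans (ℚP.+-identityˡ _) (sym (φ-anti w u)))) }

  module FirstHomology {m : ℕ} {Δ : SComplex m} (down : ∀ {p q : Subset m} → p ⊑ q → IsFace Δ q → IsFace Δ p)
    (vertex : ∀ v → T (Δ ⁅ v ⁆)) where
    open ChainComplex Δ
    private
      K : CellCx
      K = simplicialCx Δ

    private
      Triangle? : ∀ t → Dec (IsFace Δ t × ∣ t ∣ ≡ 3)
      Triangle? t = (Δ t BoolP.≟ true) ×-dec (∣ t ∣ ℕP.≟ 3)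

    triangles : List (Subset m)
    triangles = filter Triangle? (allSubsets m)

    killed : ∀ (ψ : Subset m → ℚ) → (∀ t → t ∈ˡ triangles → ⟨ ψ , incS t ⟩ ≡ 0ℚ) → ∀ t → IsFace Δ t → ∣ t ∣ ≡ 3 → ⟨ ψ , incS t ⟩ ≡ 0ℚ
    killed ψ kills t f s = kills t (∈-filter⁺ Triangle? (∈-allSubsets t) (f , s))

    -- On edges `ψ` is the coboundary of `g`, so pairing it with `c` is pairing `g` with the
    -- boundary of `c`.
    coboundary-pairing : ∀ (ψ : Subset m → ℚ) g c → (∀ {u v} → u Fin.< v → IsFace Δ (e₂ u v) → ψ (e₂ u v) ≡ g v - g u) →
      ChainOfSize K 2 c → IsCycle K c → ⟨ ψ , coeff K c ⟩ ≡ 0ℚ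
    coboundary-pairing ψ g c h size cyc = trans (pair-coeff ψ (single g) c on-edges) (Σˢ-0 vanish)
      where
      on-edges : ∀ τ q → (τ , q) ∈ˡ c → ψ τ ≡ ⟨ single g , incS τ ⟩
      on-edges τ q i with All.lookup size i
      ... | f , s with size2 τ s
      ...   | v , w , v<w , _ , _ , refl = trans (h v<w (T⇒≡ f)) (sym (single-edge g v<w))
      vanish : ∀ σ → single g σ * ∂coeff K c σ ≡ 0ℚ
      -- `IsCycle` speaks only of valid cells; on the others `single g` vanishes, because every
      -- vertex is a face.
      vanish σ with Δ σ in e
      ... | true  = trans (cong (single g σ *_) (cyc σ (≡⇒T e))) (ℚP.*-zeroʳ (single g σ))
      ... | false = trans (cong (_* ∂coeff K c σ) (single-0 g σ λ { w refl → true≢false (T⇒≡ (vertex w)) e })) (ℚP.*-zeroˡ (∂coeff K c σ))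

    -- A cycle that does not bound is detected by a functional that kills the boundaries of
    -- triangles. Such a functional is a cocycle; having a potential, it pairs to zero with every
    -- cycle.
    vanishes : (∀ (co : Cocycle Δ) → ∃ (Cocycle.IsCoboundaryOf co)) → HomologyVanishes K 2
    vanishes cob c size cyc with fredholm-alternative triangles (coeff K c)
    ... | inj₁ (d , d∈ , ∂d) = d , all-entries (λ τ q i → let f , s = proj₂ (∈-filter⁻ Triangle? {xs = allSubsets m} (d∈ τ q i)) in ≡⇒T f , s) , λ σ _ → ∂d σ
    ... | inj₂ (ψ , kills , ne) with cob (FromFunctional.cocycle down ψ (killed ψ kills))
    ...   | g , isg = contradiction (coboundary-pairing ψ g c on-edge size cyc) ne
      where
      open +-*-Solver
      module F = FromFunctional down ψ (killed ψ kills)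
      on-edge : ∀ {u v} → u Fin.< v → IsFace Δ (e₂ u v) → ψ (e₂ u v) ≡ g v - g u
      on-edge {u} {v} u<v f = trans (sym (F.φ-< u<v)) (trans
        (solve 2 (λ a b → b := (a :+ b) :+ (:- a)) refl (g u) (F.φ u v))
        (cong (_- g u) (isg f (subst (u ∈_) (sym (e₂≡⊞ u v)) ⊞-new) (subst (v ∈_) (sym (e₂≡⊞ u v)) (⊞-old ⊞-new)))))

open Cocycles

-- Links in homology manifolds: purity, ridges, strong connectivity.

module HomologyManifolds where
  open import Data.Rational using (_+_; _*_; -_; _-_)

  lookup-∪ : ∀ {m} (p q : Subset m) x → lookup (p ∪ q) x ≡ lookup p x ∨ lookup q x
  lookup-∪ p q x = lookup-zipWith _∨_ x p q

  ∪-inv : ∀ {m} {p q : Subset m} {x} → x ∈ p ∪ q → x ∈ p ⊎ x ∈ q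
  ∪-inv {p = p} {q} {x} i with in? x p
  ... | inj₁ j = inj₁ j
  ... | inj₂ o = inj₂ (mk∈ (trans (sym (trans (lookup-∪ p q x) (cong (_∨ lookup q x) (off o)))) (at i)))

  ∪-inˡ : ∀ {m} {p q : Subset m} {x} → x ∈ p → x ∈ p ∪ q
  ∪-inˡ {p = p} {q} {x} i = mk∈ (trans (lookup-∪ p q x) (cong (_∨ lookup q x) (at i)))

  ∪-inʳ : ∀ {m} {p q : Subset m} {x} → x ∈ q → x ∈ p ∪ q
  ∪-inʳ {p = p} {q} {x} i = mk∈ (trans (lookup-∪ p q x) (trans (cong (lookup p x ∨_) (at i)) (BoolP.∨-zeroʳ _)))

  disjoint-∩ : ∀ {m} {p q : Subset m} → (∀ x → x ∈ p → x ∉ q) → p ∩ q ≡ ⊥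
  disjoint-∩ {p = p} {q} h = ext λ x → trans (lookup-zipWith _∧_ x p q) (trans (lem x (in? x p)) (sym (off (∉⊥ {x = x}))))
    where
    lem : ∀ x → x ∈ p ⊎ x ∉ p → lookup p x ∧ lookup q x ≡ false
    lem x (inj₁ i) = trans (cong₂ _∧_ (at i) (off (h x i))) refl
    lem x (inj₂ o) = cong (_∧ lookup q x) (off o)

  ∩-disjoint : ∀ {m} {p q : Subset m} → p ∩ q ≡ ⊥ → ∀ x → x ∈ p → x ∉ q
  ∩-disjoint {p = p} {q} e x i = not-in λ j → true≢false
    (trans (cong (λ s → lookup s x) (sym e)) (trans (lookup-zipWith _∧_ x p q) (cong₂ _∧_ (at i) (at j)))) (off (∉⊥ {x = x}))

  module Links {m n : ℕ} {Δ : SComplex m} (simplicial : IsSimplicialComplex Δ) (vertices : ∀ v → T (Δ ⁅ v ⁆))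
    (manifold : IsHomologyManifold n Δ) where
    private
      V : Set
      V = Fin m

      Face : Subset m → Set
      Face = IsFace Δ

    down : ∀ {p q : Subset m} → p ⊑ q → Face q → Face p
    down {p} {q} h f = T⇒≡ (simplicial p q (λ {x} i → lookup⇒[]= x q (at (h x (mk∈ ([]=⇒lookup i))))) (≡⇒T f))

    dim : ∀ {p} → Face p → ∣ p ∣ ≤ n
    dim {p} f = proj₁ manifold p (≡⇒T f)

    module At (F : Subset m) (face-F : Face F) (1≤F : 1 ≤ ∣ F ∣) where
      private
        L : SComplex m
        L = link Δ F
        K : CellCx
        K = simplicialCx L
        t : ℕ
        t = n ∸ ∣ F ∣
      open ChainComplex L

      sphere : IsHomologySphere t L
      sphere = proj₂ manifold F (≡⇒T face-F) 1≤F

      valid : ∀ {τ} → Face (τ ∪ F) → (∀ x → x ∈ τ → x ∉ F) → T (L τ)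
      valid {τ} f h = ≡⇒T (trans (cong₂ _∧_ f (trans (cong (_==ˢ ⊥) (disjoint-∩ h)) (==ˢ-refl ⊥))) refl)

      valid-inv : ∀ {τ} → T (L τ) → Face (τ ∪ F) × (∀ x → x ∈ τ → x ∉ F)
      valid-inv {τ} v with Δ (τ ∪ F) in e | (τ ∩ F) ==ˢ ⊥ in e′
      ... | true | true = refl , ∩-disjoint (==ˢ-true e′)

      valid-⊥ : T (L ⊥)
      valid-⊥ = valid (down (λ x i → [ (λ j → in∧out j ∉⊥) , (λ j → j) ]′ (∪-inv i)) face-F) λ x i → in∧out i ∉⊥

      valid-vertex : ∀ {v} → v ∉ F → Face (F ⊞ v) → T (L ⁅ v ⁆)
      valid-vertex {v} o f = valid (down sub f) λ x i → subst (_∉ F) (sym (∈⁅⁆-inv i)) o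
        where
        ∈⁅⁆-inv : ∀ {x} → x ∈ ⁅ v ⁆ → x ≡ v
        ∈⁅⁆-inv i with ⊞-inv (subst (_ ∈_) (⁅⁆≡⊥⊞ v) i)
        ... | inj₁ e = e
        ... | inj₂ j = in∧out j ∉⊥
        sub : ⁅ v ⁆ ∪ F ⊑ F ⊞ v
        sub x i with ∪-inv i
        ... | inj₁ j = subst (_∈ F ⊞ v) (sym (∈⁅⁆-inv j)) ⊞-new
        ... | inj₂ j = ⊞-old j

      link-⊞ : ∀ {τ v} → T (L τ) → v ∈ τ → v ∉ F × Face (F ⊞ v)
      link-⊞ {τ} {v} h i with valid-inv h
      ... | f , d = d v i , down (λ x j → [ (λ { refl → ∪-inˡ i }) , ∪-inʳ ]′ (⊞-inv j)) f

      link-⊞⊞ : ∀ {τ u v} → T (L τ) → u ∈ τ → v ∈ τ → Face (F ⊞ u ⊞ v)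
      link-⊞⊞ {τ} {u} {v} h i j = down sub (proj₁ (valid-inv h))
        where
        sub : F ⊞ u ⊞ v ⊑ τ ∪ F
        sub x k with ⊞-inv k
        ... | inj₁ refl = ∪-inˡ j
        ... | inj₂ k′ with ⊞-inv k′
        ...   | inj₁ refl = ∪-inˡ i
        ...   | inj₂ k″   = ∪-inʳ k″

      -- Reduced homology of the link vanishes in degree -1, so the empty cell is a boundary and the
      -- link has a vertex.
      extend : ∣ F ∣ < n → ∃ λ v → v ∉ F × Face (F ⊞ v)
      extend F<n with proj₁ sphere 0 (ℕP.<⇒≢ (ℕP.m<n⇒0<n∸m F<n)) ((⊥ , 1ℚ) ∷ []) ((valid-⊥ , size-⊥ m) ∷ [])
                        (λ σ _ → cong (λ z → 1ℚ * z + 0ℚ) (inc-⊥ false σ))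
      ... | (τ , q) ∷ _ , (vτ , s) ∷ _ , _ with inhabited τ (ℕP.≤-reflexive (sym s))
      ...   | v , i = v , link-⊞ vτ i
      extend F<n | [] , _ , bd = contradiction absurd λ ()
        where
        absurd : 0ℚ ≡ 1ℚ + 0ℚ
        absurd = trans (bd ⊥ valid-⊥) (cong (_+ 0ℚ) (δ-same {m} ⊥ 1ℚ))

      inc-⁅⁆ : ∀ {k} p (v : Fin k) σ → incS′ p ⁅ v ⁆ σ ≡ δ ⊥ (sign p) σ
      inc-⁅⁆ p zero (true ∷ σ)     = trans (inc-⊥ (not p) σ) (sym (δ-≢ (false ∷ ⊥) (sign p) (true ∷ σ) λ ()))
      inc-⁅⁆ p zero (false ∷ σ)    = sym (δ-∷ false ⊥ (sign p) σ)
      inc-⁅⁆ p (suc v) (true ∷ σ)  = sym (δ-≢ (false ∷ ⊥) (sign p) (true ∷ σ) λ ())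
      inc-⁅⁆ p (suc v) (false ∷ σ) = trans (inc-⁅⁆ p v σ) (sym (δ-∷ false ⊥ (sign p) σ))

      difference : V → V → Chain K
      difference u v = (⁅ u ⁆ , 1ℚ) ∷ (⁅ v ⁆ , - 1ℚ) ∷ []

      size-⁅⁆ : ∀ (v : V) → ∣ ⁅ v ⁆ ∣ ≡ 1
      size-⁅⁆ v = trans (cong ∣_∣ (⁅⁆≡⊥⊞ v)) (trans (size-⊞ ∉⊥) (cong suc (size-⊥ m)))

      difference-size : ∀ {u v} → T (L ⁅ u ⁆) → T (L ⁅ v ⁆) → ChainOfSize K 1 (difference u v)
      difference-size {u} {v} a b = (a , size-⁅⁆ u) ∷ (b , size-⁅⁆ v) ∷ []

      difference-cycle : ∀ u v → IsCycle K (difference u v)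
      difference-cycle u v σ _ = trans (cong₂ (λ a b → 1ℚ * a + ((- 1ℚ) * b + 0ℚ)) (inc-⁅⁆ {m} false u σ) (inc-⁅⁆ {m} false v σ))
        (cancel (δ {m} ⊥ 1ℚ σ))
        where
        open +-*-Solver
        cancel : ∀ a → 1ℚ * a + ((- 1ℚ) * a + 0ℚ) ≡ 0ℚ
        cancel = solve 1 (λ a → con 1ℚ :* a :+ (con (- 1ℚ) :* a :+ con 0ℚ) := con 0ℚ) refl

      -- Reduced homology of the link vanishes in degree 0, so the difference of `u` and `v` bounds.
      -- The indicator of `D` is constant on edges, hence kills boundaries and takes the same value
      -- at both vertices.
      connected : suc ∣ F ∣ < n → (D : V → Bool) → (∀ a b → a ∉ F → b ∉ F → Face (F ⊞ a ⊞ b) → D a ≡ D b) →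
        ∀ u v → u ∉ F → v ∉ F → Face (F ⊞ u) → Face (F ⊞ v) → D u ≡ D v
      connected F<n D same u v uo vo fu fv =
        separated (proj₁ sphere 1 (ℕP.<⇒≢ (ℕP.+-cancelʳ-< ∣ F ∣ 1 t (subst (suc ∣ F ∣ <_) (sym (ℕP.m∸n+n≡m (dim face-F))) F<n)))
          (difference u v) (difference-size {u} {v} (valid-vertex uo fu) (valid-vertex vo fv)) (difference-cycle u v))
        where
        open +-*-Solver
        InLink : V → Set
        InLink w = w ∉ F × Face (F ⊞ w)
        InLink? : ∀ w → Dec (InLink w)
        InLink? w = (w ∉? F) ×-dec (Δ (F ⊞ w) BoolP.≟ true)
        -- The indicator is cut off outside the link, since the boundary equation is known only on
        -- cells of the link.
        g : V → ℚ
        g w = if ⌊ InLink? w ⌋ then (if D w then 1ℚ else 0ℚ) else 0ℚ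
        g-in : ∀ {w} → InLink w → g w ≡ (if D w then 1ℚ else 0ℚ)
        g-in {w} h = cong (λ z → if z then (if D w then 1ℚ else 0ℚ) else 0ℚ) (isYes-yes {d = InLink? w} h)
        g-out : ∀ {w} → ¬ InLink w → g w ≡ 0ℚ
        g-out {w} h = cong (λ z → if z then (if D w then 1ℚ else 0ℚ) else 0ℚ) (isYes-no {d = InLink? w} h)
        G : Subset m → ℚ
        G = single g
        kills : ∀ {d} → ChainOfSize K 2 d → ∀ τ q → (τ , q) ∈ˡ d → ⟨ G , incS τ ⟩ ≡ 0ℚ
        kills d-size τ q i with All.lookup d-size i
        ... | vτ , s with size2 τ s
        ...   | a , b , a<b , ai , bi , refl = trans (single-edge g a<b)
          (trans (cong (_- g a) (trans (g-in (link-⊞ vτ bi)) (trans (cong (λ z → if z then 1ℚ else 0ℚ)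
              (same b a (proj₁ (link-⊞ vτ bi)) (proj₁ (link-⊞ vτ ai)) (link-⊞⊞ vτ bi ai))) (sym (g-in (link-⊞ vτ ai))))))
            (ℚP.+-inverseʳ (g a)))
        agree : ∀ (h h′ : Subset m → ℚ) → (∀ σ → T (L σ) → h σ ≡ h′ σ) → ∀ σ → G σ * h σ ≡ G σ * h′ σ
        agree h h′ e σ with L σ in eσ
        ... | true  = cong (G σ *_) (e σ (≡⇒T eσ))
        ... | false = trans (cong (_* h σ) zero-G) (trans (ℚP.*-zeroˡ (h σ)) (sym (trans (cong (_* h′ σ) zero-G) (ℚP.*-zeroˡ (h′ σ)))))
          where
          zero-G : G σ ≡ 0ℚ
          zero-G = single-0 g σ λ { w refl → g-out λ (wo , fw) → true≢false (T⇒≡ (valid-vertex wo fw)) eσ }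
        pairing : ⟨ G , coeff K (difference u v) ⟩ ≡ g u - g v
        pairing = trans (⟨⟩-cong {ψ = G} λ σ → expand (δ ⁅ u ⁆ 1ℚ σ) (δ ⁅ v ⁆ (- 1ℚ) σ))
          (trans (⟨⟩-linearʳ G 1ℚ (δ ⁅ u ⁆ 1ℚ) (δ ⁅ v ⁆ (- 1ℚ)))
            (trans (cong₂ (λ a b → 1ℚ * a + b) (trans (Σˢ-δ G ⁅ u ⁆ 1ℚ) (cong (_* 1ℚ) (single-⁅⁆ g u))) (trans (Σˢ-δ G ⁅ v ⁆ (- 1ℚ)) (cong (_* (- 1ℚ)) (single-⁅⁆ g v))))
              (collect (g u) (g v))))
          where
          expand : ∀ a b → a + (b + 0ℚ) ≡ 1ℚ * a + b
          expand = solve 2 (λ a b → a :+ (b :+ con 0ℚ) := con 1ℚ :* a :+ b) refl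
          collect : ∀ a b → 1ℚ * (a * 1ℚ) + b * (- 1ℚ) ≡ a - b
          collect = solve 2 (λ a b → con 1ℚ :* (a :* con 1ℚ) :+ b :* con (- 1ℚ) := a :+ (:- b)) refl
        value : g u - g v ≡ 0ℚ → ∀ a b → D u ≡ a → D v ≡ b → (if a then 1ℚ else 0ℚ) - (if b then 1ℚ else 0ℚ) ≡ 0ℚ
        value e a b p q = trans (sym (cong₂ _-_ (trans (g-in (uo , fu)) (cong (λ z → if z then 1ℚ else 0ℚ) p))
                                              (trans (g-in (vo , fv)) (cong (λ z → if z then 1ℚ else 0ℚ) q)))) e
        decide : g u - g v ≡ 0ℚ → ∀ a b → D u ≡ a → D v ≡ b → D u ≡ D v
        decide e true  true  p q = trans p (sym q)
        decide e false false p q = trans p (sym q)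
        decide e true  false p q = contradiction (value e true false p q) λ ()
        decide e false true  p q = contradiction (value e false true p q) λ ()
        separated : IsBoundary K 1 (difference u v) → D u ≡ D v
        separated (d , d-size , ∂d) = decide
          (trans (sym pairing) (trans (sym (Σˢ-cong (agree (∂coeff K d) (coeff K (difference u v)) ∂d))) (pair-∂ G d (kills d-size))))
          (D u) (D v) refl refl

      module _ (codim : suc ∣ F ∣ ≡ n) where
        private
          t≡1 : t ≡ 1
          t≡1 = trans (cong (_∸ ∣ F ∣) (sym codim)) (ℕP.m+n∸n≡m 1 ∣ F ∣)

          top : HomologyIsℚ K 1
          top = subst (HomologyIsℚ K) t≡1 (proj₂ sphere)

          no-edges : ∀ d → ChainOfSize K 2 d → d ≡ []
          no-edges [] _ = refl
          no-edges ((τ , _) ∷ _) ((vτ , s) ∷ _) with size2 τ s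
          ... | a , b , a<b , ai , bi , _ = contradiction (dim (link-⊞⊞ vτ ai bi))
            (ℕP.<⇒≱ (ℕP.≤-reflexive (trans (cong suc (sym codim)) (sym (trans (size-⊞ (⊞-out (FinP.<⇒≢ a<b ∘ sym) (proj₁ (link-⊞ vτ bi))))
              (cong suc (size-⊞ (proj₁ (link-⊞ vτ ai)))))))))

          z : Chain K
          z = proj₁ top
          z-size : ChainOfSize K 1 z
          z-size = proj₁ (proj₂ top)
          z-cycle : IsCycle K z
          z-cycle = proj₁ (proj₂ (proj₂ top))
          z-nonzero : ¬ IsBoundary K 1 z
          z-nonzero = proj₁ (proj₂ (proj₂ (proj₂ top)))

          coeff-scaled : ∀ (f : Subset m × ℚ → Subset m × ℚ) k → (∀ τ r → f (τ , r) ≡ (τ , - (k * r))) → ∀ w c σ →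
            coeff K (w ++ map f c) σ ≡ coeff K w σ - k * coeff K c σ
          coeff-scaled f k h [] [] σ = solve 1 (λ k → con 0ℚ := con 0ℚ :+ (:- (k :* con 0ℚ))) refl k
            where open +-*-Solver
          coeff-scaled f k h [] ((τ , r) ∷ c) σ rewrite h τ r = trans (cong₂ _+_ (δ-scaled τ r) (coeff-scaled f k h [] c σ))
              (solve 3 (λ k a b → (:- (k :* a)) :+ (con 0ℚ :+ (:- (k :* b))) := con 0ℚ :+ (:- (k :* (a :+ b)))) refl k (δ τ r σ) (coeff K c σ))
            where
            open +-*-Solver
            δ-scaled : ∀ τ r → δ τ (- (k * r)) σ ≡ - (k * δ τ r σ)
            δ-scaled τ r with τ ==ˢ σ
            ... | true  = refl
            ... | false = solve 1 (λ k → con 0ℚ := :- (k :* con 0ℚ)) refl k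
          coeff-scaled f k h ((τ , r) ∷ w) c σ = trans (cong (δ τ r σ +_) (coeff-scaled f k h w c σ))
            (sym (ℚP.+-assoc (δ τ r σ) (coeff K w σ) (- (k * coeff K c σ))))

          multiple : ∀ w → ChainOfSize K 1 w → IsCycle K w → ∃ λ k → ∀ σ → T (L σ) → coeff K w σ ≡ k * coeff K z σ
          multiple w s c with proj₂ (proj₂ (proj₂ (proj₂ top))) w s c
          ... | k , d , d-size , ∂d with no-edges d d-size
          ...   | refl = k , λ σ vσ → difference-0 (trans (∂d σ vσ) (coeff-scaled _ k (λ _ _ → refl) w z σ))
            where
            open +-*-Solver
            difference-0 : ∀ {a b} → 0ℚ ≡ a - b → a ≡ b
            difference-0 {a} {b} e = trans (solve 2 (λ a b → a := (a :+ (:- b)) :+ b) refl a b) (trans (cong (_+ b) (sym e)) (ℚP.+-identityˡ b))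

        -- If `a` were the only vertex of the link, the generator would be a multiple of `a`; its
        -- augmentation is zero, so it would vanish and hence bound.
        second : ∀ a → a ∉ F → Face (F ⊞ a) → ∃ λ b → b ≢ a × b ∉ F × Face (F ⊞ b)
        second a ao fa with any? (λ b → ¬? (b ≟ a) ×-dec (b ∉? F) ×-dec (Δ (F ⊞ b) BoolP.≟ true))
        ... | yes r = r
        ... | no none = ⊥-elim (z-nonzero ([] , [] , λ σ _ → sym (trans (concentrated z z-size σ)
                (trans (cong (λ q → δ ⁅ a ⁆ q σ) (z-cycle ⊥ valid-⊥)) (δ-0 σ)))))
          where
          δ-0 : ∀ σ → δ ⁅ a ⁆ 0ℚ σ ≡ 0ℚ
          δ-0 σ with ⁅ a ⁆ ==ˢ σ
          ... | true  = refl
          ... | false = refl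
          δ-+ : ∀ q r σ → δ ⁅ a ⁆ q σ + δ ⁅ a ⁆ r σ ≡ δ ⁅ a ⁆ (q + r) σ
          δ-+ q r σ with ⁅ a ⁆ ==ˢ σ
          ... | true  = refl
          ... | false = refl
          concentrated : ∀ c → ChainOfSize K 1 c → ∀ σ → coeff K c σ ≡ δ ⁅ a ⁆ (∂coeff K c ⊥) σ
          concentrated [] _ σ = sym (δ-0 σ)
          concentrated ((τ , q) ∷ c) ((vτ , s) ∷ sc) σ with size1 τ s
          ... | b , refl with b ≟ a
          ...   | no ne = contradiction (b , ne , link-⊞ vτ ∈⁅⁆) none
          ...   | yes refl = trans (cong (δ ⁅ a ⁆ q σ +_) (concentrated c sc σ)) (trans (δ-+ q (∂coeff K c ⊥) σ)
            (cong (λ r → δ ⁅ a ⁆ (r + ∂coeff K c ⊥) σ) (trans (sym (ℚP.*-identityʳ q)) (cong (q *_) (sym (trans (inc-⁅⁆ false a ⊥) (δ-same ⊥ 1ℚ)))))))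

        -- Without edges there are no boundaries, so `a - b` and `a - c` are multiples of one chain.
        -- Their coefficients at `b` and `c` would form a singular matrix, but its diagonal entries
        -- are -1 and the others are 0.
        at-most-two : ∀ {a b c} → a ≢ b → a ≢ c → b ≢ c → a ∉ F → b ∉ F → c ∉ F → ¬ (Face (F ⊞ a) × Face (F ⊞ b) × Face (F ⊞ c))
        at-most-two {a} {b} {c} ab ac bc ao bo co (fa , fb , fc) = absurd (multiple _ (difference-size {a} {b} va vb) (difference-cycle a b))
            (multiple _ (difference-size {a} {c} va vc) (difference-cycle a c))
          where
          open +-*-Solver
          va = valid-vertex ao fa
          vb = valid-vertex bo fb
          vc = valid-vertex co fc
          apart : ∀ {u v} q → u ≢ v → δ ⁅ u ⁆ q ⁅ v ⁆ ≡ 0ℚ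
          apart {u} {v} q ne = δ-≢ ⁅ u ⁆ q ⁅ v ⁆ (ne ∘ ⁅⁆-injective)
          end : ∀ {u v} → u ≢ v → coeff K (difference u v) ⁅ v ⁆ ≡ - 1ℚ
          end {u} {v} ne = cong₂ (λ x y → x + (y + 0ℚ)) (apart 1ℚ ne) (δ-same ⁅ v ⁆ (- 1ℚ))
          away : ∀ {u v w} → u ≢ w → v ≢ w → coeff K (difference u v) ⁅ w ⁆ ≡ 0ℚ
          away ne ne′ = cong₂ (λ x y → x + (y + 0ℚ)) (apart 1ℚ ne) (apart (- 1ℚ) ne′)
          absurd : (∃ λ k → ∀ σ → T (L σ) → coeff K (difference a b) σ ≡ k * coeff K z σ) →
                   (∃ λ k → ∀ σ → T (L σ) → coeff K (difference a c) σ ≡ k * coeff K z σ) → Empty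
          absurd (k , h) (l , h′) = contradiction (trans (cong₂ _*_ (trans (sym (end ab)) (h ⁅ b ⁆ vb)) (trans (sym (end ac)) (h′ ⁅ c ⁆ vc)))
            (trans (solve 4 (λ k l x y → (k :* x) :* (l :* y) := (k :* y) :* (l :* x)) refl k l (coeff K z ⁅ b ⁆) (coeff K z ⁅ c ⁆))
              (cong₂ _*_ (trans (sym (h ⁅ c ⁆ vc)) (away ac bc)) (trans (sym (h′ ⁅ b ⁆ vb)) (away ab (bc ∘ sym)))))) λ ()

    RidgeClosed : (Subset m → Bool) → Subset m → Set
    RidgeClosed D F = ∀ ρ a b → F ⊑ ρ → suc ∣ ρ ∣ ≡ n → a ∉ ρ → b ∉ ρ → Face (ρ ⊞ a) → Face (ρ ⊞ b) → D (ρ ⊞ a) ≡ true → D (ρ ⊞ b) ≡ true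

    private
      facet⊇ : ∀ k {p} → Face p → 1 ≤ ∣ p ∣ → k ℕ.+ ∣ p ∣ ≡ n → ∃ λ τ → p ⊑ τ × IsFacet n Δ τ
      facet⊇ zero    {p} f h e = p , (λ _ i → i) , f , e
      facet⊇ (suc k) {p} f h e with At.extend p f h (subst (suc ∣ p ∣ ≤_) e (s≤s (ℕP.m≤n+m _ k)))
      ... | v , o , f′ with facet⊇ k f′ (nonempty {x = v} {p = p ⊞ v} ⊞-new) (trans (cong (k ℕ.+_) (size-⊞ o)) (trans (ℕP.+-suc k _) e))
      ...   | τ , s , F = τ , (λ x i → s x (⊞-old i)) , F

      ⊞-⊑ : ∀ {F τ : Subset m} {v} → F ⊑ τ → v ∈ τ → F ⊞ v ⊑ τ
      ⊞-⊑ h i x j = [ (λ { refl → i }) , h x ]′ (⊞-inv j)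

    -- Induction on the codimension `k` of `F`. For `k` equal to 1, `F` is a ridge and `D` passes
    -- across it. Beyond that the link of `F` is connected, and the property moves along its edges:
    -- two vertices joined by an edge lie in a common facet, and the induction applies to `F` with
    -- one vertex added.
    star-connected : ∀ k F → Face F → 1 ≤ ∣ F ∣ → k ℕ.+ ∣ F ∣ ≡ n → (D : Subset m → Bool) → RidgeClosed D F →
      ∀ τ τ′ → F ⊑ τ → F ⊑ τ′ → IsFacet n Δ τ → IsFacet n Δ τ′ → D τ ≡ true → D τ′ ≡ true
    star-connected zero F f 1≤F e D cl τ τ′ s s′ (_ , c) (_ , c′) d =
      subst (λ p → D p ≡ true) (trans (sym (⊑-size s (ℕP.≤-reflexive (trans c (sym e))))) (⊑-size s′ (ℕP.≤-reflexive (trans c′ (sym e))))) d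
    star-connected (suc k) F f 1≤F e D cl τ τ′ s s′ T₁@(g , c) T₂@(g′ , c′) d
      with diff F τ (subst (∣ F ∣ <_) (trans e (sym c)) (s≤s (ℕP.m≤n+m _ k)))
         | diff F τ′ (subst (∣ F ∣ <_) (trans e (sym c′)) (s≤s (ℕP.m≤n+m _ k)))
    ... | u , ui , uo | v , vi , vo = cases (k ℕP.≟ 0)
      where
      codim-one : suc ∣ F ∣ ≡ n → D τ′ ≡ true
      codim-one e = subst (λ w → D w ≡ true) (full vi vo s′ c′) (cl F u v (λ _ i → i) e uo vo
          (subst Face (sym (full ui uo s c)) g) (subst Face (sym (full vi vo s′ c′)) g′) (subst (λ w → D w ≡ true) (sym (full ui uo s c)) d))
        where
        full : ∀ {τ u} → u ∈ τ → u ∉ F → F ⊑ τ → ∣ τ ∣ ≡ n → F ⊞ u ≡ τ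
        full ui uo s c = ⊑-size (⊞-⊑ s ui) (ℕP.≤-reflexive (trans c (trans (sym e) (sym (size-⊞ uo)))))
      ⊑? : ∀ (p q : Subset m) → Dec (p ⊑ q)
      ⊑? p q with any? (λ x → (x ∈? p) ×-dec (x ∉? q))
      ... | yes (x , i , o) = no λ h → in∧out (h x i) o
      ... | no none = yes λ x i → [ (λ j → j) , (λ o → contradiction (x , i , o) none) ]′ (in? x q)
      -- One facet above `F ⊞ w` with the property is enough, since the induction spreads it to all
      -- of them.
      Dv : V → Set
      Dv w = ∃ λ τ → IsFacet n Δ τ × F ⊞ w ⊑ τ × D τ ≡ true
      Dv? : ∀ w → Dec (Dv w)
      Dv? w = anySubset? λ τ → ((Δ τ BoolP.≟ true) ×-dec (∣ τ ∣ ℕP.≟ n)) ×-dec ⊑? (F ⊞ w) τ ×-dec (D τ BoolP.≟ true)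
      inner : ∀ {w} → w ∉ F → Face (F ⊞ w) → ∀ τ τ′ → F ⊞ w ⊑ τ → F ⊞ w ⊑ τ′ → IsFacet n Δ τ → IsFacet n Δ τ′ → D τ ≡ true → D τ′ ≡ true
      inner {w} wo fw = star-connected k (F ⊞ w) fw (nonempty {x = w} {p = F ⊞ w} ⊞-new)
        (trans (cong (k ℕ.+_) (size-⊞ wo)) (trans (ℕP.+-suc k _) e)) D λ ρ a b h → cl ρ a b (λ x i → h x (⊞-old i))
      forward : ∀ {a b} → a ∉ F → b ∉ F → Face (F ⊞ a ⊞ b) → Dv a → Dv b
      forward {a} {b} ao bo fab (σ , Tσ , h , dσ) with facet⊇ (n ∸ ∣ F ⊞ a ⊞ b ∣) fab (nonempty {x = b} {p = F ⊞ a ⊞ b} ⊞-new) (ℕP.m∸n+n≡m (dim fab))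
      ... | σ′ , h′ , Tσ′ = σ′ , Tσ′ , ⊞-⊑ (λ x i → h′ x (⊞-old (⊞-old i))) (h′ b ⊞-new) ,
            inner ao (down (λ x i → ⊞-old i) fab) σ σ′ h (λ x i → h′ x (⊞-old i)) Tσ Tσ′ dσ
      edge : ∀ a b → a ∉ F → b ∉ F → Face (F ⊞ a ⊞ b) → ⌊ Dv? a ⌋ ≡ ⌊ Dv? b ⌋
      edge a b ao bo fab = lem (Dv? a)
        where
        lem : Dec (Dv a) → ⌊ Dv? a ⌋ ≡ ⌊ Dv? b ⌋
        lem (yes p) = trans (isYes-yes {d = Dv? a} p) (sym (isYes-yes {d = Dv? b} (forward ao bo fab p)))
        lem (no np) = trans (isYes-no {d = Dv? a} np) (sym (isYes-no {d = Dv? b} λ q → np (forward bo ao (subst Face (⊞-comm F a b) fab) q)))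
      fu : Face (F ⊞ u)
      fu = down (⊞-⊑ s ui) (proj₁ T₁)
      fv : Face (F ⊞ v)
      fv = down (⊞-⊑ s′ vi) (proj₁ T₂)
      d-equal : k ≢ 0 → ⌊ Dv? u ⌋ ≡ ⌊ Dv? v ⌋
      d-equal k≢0 = At.connected F f 1≤F (subst (suc (suc ∣ F ∣) ≤_) e (s≤s (ℕP.+-monoˡ-≤ ∣ F ∣ (ℕP.n≢0⇒n>0 k≢0))))
        (λ w → ⌊ Dv? w ⌋) edge u v uo vo fu fv
      finish : Dv v → D τ′ ≡ true
      finish (σ , Tσ , h , dσ) = inner vo fv σ τ′ h (⊞-⊑ s′ vi) Tσ T₂ dσ
      cases : Dec (k ≡ 0) → D τ′ ≡ true
      cases (yes refl) = codim-one e
      cases (no k≢0)   = finish (isYes-true {d = Dv? v} (trans (sym (d-equal k≢0)) (isYes-yes {d = Dv? u} (τ , T₁ , ⊞-⊑ s ui , d))))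

    isPM : 2 ≤ n → IsPM n Δ
    isPM 2≤n = record
      { down = down ; dim = dim
      ; vertex = vertex
      ; extend = λ f h → At.extend _ f h
      ; two = two
      ; star-connected = λ u D cl τ τ′ i i′ → star-connected (n ∸ ∣ ⊥ ⊞ u ∣) (⊥ ⊞ u) (vertex u) (nonempty {x = u} {p = ⊥ ⊞ u} ⊞-new)
          (ℕP.m∸n+n≡m (dim (vertex u))) D (λ ρ a b h → cl ρ a b (h u ⊞-new)) τ τ′ (⊞-⊑ (λ x j → in∧out j ∉⊥) i) (⊞-⊑ (λ x j → in∧out j ∉⊥) i′) }
      where
      vertex : ∀ v → Face (⊥ ⊞ v)
      vertex v = subst Face (⁅⁆≡⊥⊞ v) (T⇒≡ (vertices v))
      two : ∀ {p a} → suc ∣ p ∣ ≡ n → a ∉ p → Face (p ⊞ a) → ∃ λ b → b ≢ a × b ∉ p × Face (p ⊞ b) × (∀ c → c ∉ p → Face (p ⊞ c) → c ≡ a ⊎ c ≡ b)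
      two {p} {a} e ao fa = let b , ba , bo , fb = At.second p fp 1≤p e a ao fa in b , ba , bo , fb , only b ba bo fb
        where
        fp : Face p
        fp = down (λ x i → ⊞-old i) fa
        1≤p : 1 ≤ ∣ p ∣
        1≤p = s≤s⁻¹ (subst (2 ≤_) (sym e) 2≤n)
        only : ∀ b → b ≢ a → b ∉ p → Face (p ⊞ b) → ∀ c → c ∉ p → Face (p ⊞ c) → c ≡ a ⊎ c ≡ b
        only b ba bo fb c co fc with c ≟ a | c ≟ b
        ... | yes q | _ = inj₁ q
        ... | no _  | yes q = inj₂ q
        ... | no ca | no cb = ⊥-elim (At.at-most-two p fp 1≤p e (ba ∘ sym) (ca ∘ sym) (cb ∘ sym) ao bo co (fa , fb , fc))

open HomologyManifolds

-- Deciding the existence of a cyclic order.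

open import Data.Nat using (_+_)

theorem3p6 : (n : ℕ) → 5 ≤ n → (Δ : SComplex (suc (n + n))) →
    IsSimplicialComplex Δ →
    (∀ (v : Fin (suc (n + n))) → T (Δ ⁅ v ⁆)) →
    IsHomologyManifold n Δ →
    ¬ HomologyVanishes (simplicialCx Δ) 2 →
    HomologyVanishes (orientationDoubleCover n Δ) 3 →
    IsomorphicToM n Δ
theorem3p6 n@(suc _) n≥5 Δ simplicial vertices manifold H₁≢0 _ = conclude (Stable.cyclic? {n} {Δ})
  where
  pm : IsPM n Δ
  pm = Links.isPM simplicial vertices manifold (ℕP.≤-trans (s≤s (s≤s z≤n)) n≥5)
  conclude : Dec (Cyclic n Δ) → IsomorphicToM n Δ
  conclude (yes cyc) = ToM.isomorphic pm n≥5 cyc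
  conclude (no none) = contradiction (FirstHomology.vanishes (IsPM.down pm) vertices coboundary) H₁≢0
    where
    coboundary : ∀ co → ∃ (Cocycle.IsCoboundaryOf co)
    coboundary co with split-or-coboundary pm n≥5 refl co
    ... | inj₁ split = contradiction (FIFO.cyclic (trace pm n≥5 split) (IsPM.Face? pm)) none
    ... | inj₂ r     = r
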